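{- (i) Let $S\equiv\pm\{1, 8, 10, 11, 12, 13, 14, 15, 17, 19, 21, 23\}\pmod{60}$ and $T\equiv\pm\{1, 7, 9, 10, 11, 12, 13, 15, 23, 26, 28, 29\}\pmod{60}$. Then $p(S,n)=p(T,n-1)$ for all $n\geq 1$. (ii) Let $S\equiv\pm\{2, 3, 7, 10, 11, 15, 16, 17, 19, 23, 24, 29\}\pmod{60}$ and $T\equiv\pm\{1, 4, 7, 10, 13, 15, 17, 19, 22, 24, 27, 29\}\pmod{60}$. Then $p(S,n)=p(T,n-2)$ for all $n\geq 2$. (iii) Let $S\equiv\pm\{1, 3, 4, 10, 11, 13, 15, 17, 22, 23, 24, 29\}\pmod{60}$ and $T\equiv\pm\{1, 2, 7, 10, 11, 13, 15, 16, 19, 23, 24, 27\}\pmod{60}$. Then $p(S,n)=p(T,n)$ for all integers $n\ge0$ with $n\neq 2$. (iv) Let $S\equiv\pm\{7, 8, 9, 10, 11, 12, 13, 14, 15, 17, 19, 29\}\pmod{60}$ and $T\equiv\pm\{1, 7, 10, 12, 15, 17, 19, 21, 23, 26, 28, 29\}\pmod{60}$. Then $p(S,n)=p(T,n-7)$ for all $n\geq 7$.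
   Context: For a set $S$ of positive integers and an integer $n\ge 0$, $p(S,n)$ denotes the number of partitions of $n$ into parts belonging to $S$ (so $p(S,0)=1$). The notation $S\equiv\pm\{r_1,\dots,r_k\}\pmod M$ means that $S$ is the set of all positive integers $n$ such that $n\equiv r_i$ or $n\equiv -r_i\pmod M$ for some $i$. -}

module Defs where

open import Data.Nat using (ℕ; zero; suc; _+_; _∸_; _%_; _≡ᵇ_; _≤ᵇ_)
open import Data.Bool using (Bool; true; false; if_then_else_; _∨_)
open import Data.List using (List; []; _∷_)
open import Data.Bool.ListAction using (any)

-- A set S of positive integers is represented by its (decidable) characteristic
-- function ℕ → Bool.  Only values at positive integers are ever consulted.
PosSet : Set
PosSet = ℕ → Bool

-- S ≡ ±{r₁,…,r_k} (mod M): n ∈ S iff n ≥ 1 and n ≡ rᵢ or n ≡ −rᵢ (mod M) for some i.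
-- (n ≡ −r (mod M)  ⇔  (n + r) % M = 0)
pmMod : (M : ℕ) → List ℕ → PosSet
pmMod M rs zero = false
pmMod M rs n@(suc _) with M
... | zero = false
... | suc M' = any (λ r → ((n % suc M') ≡ᵇ (r % suc M')) ∨ (((n + r) % suc M') ≡ᵇ 0)) rs

-- pb S k n fuel : number of partitions of n into parts belonging to S that are ≤ k.
-- The extra argument 'fuel' only ensures structural termination; it is ≥ n in every call
-- made from p below, so it never cuts off the recursion.
pb : PosSet → ℕ → ℕ → ℕ → ℕ
pb S zero    zero    _        = 1
pb S zero    (suc _) _        = 0
pb S (suc k) n       zero     = pb S k n zero
pb S (suc k) n       (suc f)  =
  pb S k n (suc f) +
  (if S (suc k) ∧' (suc k ≤ᵇ n) then pb S (suc k) (n ∸ suc k) f else 0)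
  where
  _∧'_ : Bool → Bool → Bool
  true ∧' b = b
  false ∧' _ = false

p : PosSet → ℕ → ℕ
p S n = pb S n n n

{-# OPTIONS --safe #-}
module Submission where

-- Write θ(r) for the product of 1 − qⁿ over the positive n ≡ ± r (mod 60).  The generating functions of
-- p(S,n) and p(T,n) are the reciprocals of the products of θ over S and T.  After cancelling the factors
-- common to S and T, (i) says α v = u + q δ t, where u is the product of θ over S ∪ T,
--   α = θ(7)θ(26)θ(28)θ(29),  β = θ(8)θ(11)θ(13)θ(14),  γ = θ(1)θ(23)θ(26)θ(28),  δ = θ(8)θ(14)θ(17)θ(19),
-- t = θ(21), v = θ(9), and (iv) says γ t = u + q⁷ β v.  With x = θ(15)θ(18)θ(20) both follow from
--   x t = α + q⁷ β,   x v = γ + q δ,   α γ = q⁸ β δ + x u.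
-- The first two are three-term (Weierstrass) relations for theta functions with nome q⁶⁰; the third is one
-- with nome q³⁰ and arguments ± qʳ, rewritten with (−qʳ; q³⁰)(qʳ; q³⁰) = (q²ʳ; q⁶⁰).  Parts (ii) and (iii)
-- follow in the same way from x t = α + q⁴ β, x v = γ + q² δ, α δ = q² β γ + x u for other products.
--
-- The Weierstrass relation is the Plücker relation for 2 × 2 minors: by the Jacobi triple product
-- θ(xy) θ(x/y) is a double sum, which splits by the parity of the summation indices into
-- A(x) C(y) − (x/y) C(x) A(y).

open import Defs
open import Algebra.Bundles using (CommutativeRing)
open import Algebra.Structures using (IsCommutativeRing)
import Algebra.Properties.AbelianGroup as AbelianGroupProperties
import Algebra.Solver.Ring as RingSolver
open import Algebra.Solver.Ring.AlmostCommutativeRing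
  using (fromCommutativeRing; _-Raw-AlmostCommutative⟶_; Induced-equivalence)
open import Data.Bool using (Bool; true; false; if_then_else_; _∨_)
open import Data.Bool.ListAction using (any)
open import Data.Bool.Properties using (T-≡; ¬-not)
open import Data.Integer as ℤ using (ℤ; +_; -[1+_]; 0ℤ; 1ℤ)
import Data.Integer.Properties as ℤ
import Data.Integer.Tactic.RingSolver as ℤ-Solver
open import Data.List using (List; []; _∷_; _++_; concatMap)
open import Data.List.Relation.Unary.All using (All; []; _∷_; all?)
open import Data.List.Relation.Unary.All.Properties using (++⁻ˡ; ++⁻ʳ)
open import Data.Maybe using (just; nothing)
open import Data.Nat as ℕ using (ℕ; zero; suc; _∸_; _≤_; _<_; z≤n; s≤s; _%_; _≡ᵇ_; _≤ᵇ_)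
open import Data.Nat.DivMod using ([m+kn]%n≡m%n)
import Data.Nat.Properties as ℕ
import Data.Nat.Tactic.RingSolver as ℕ-Solver
open import Data.Product using (_×_; _,_)
open import Data.Sign as Sign using (Sign)
open import Data.Sum using (inj₁; inj₂)
open import Function using (_∘_; Equivalence)
open import Level using (0ℓ)
open import Relation.Binary.Bundles using (Setoid)
open import Relation.Binary.Definitions using (WeaklyDecidable)
open import Relation.Binary.PropositionalEquality
  using (_≡_; _≢_; refl; sym; trans; cong; cong₂; subst; subst₂; module ≡-Reasoning)
import Relation.Binary.Reasoning.Setoid as SetoidReasoning
open import Relation.Nullary using (Dec; yes; no; contradiction)
open import Relation.Nullary.Decidable using (from-yes; _×-dec_)

-- Every term of a three-term relation is a product of four thetas, while `u` has seventeen, so none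
-- of the four statements is an instance of one. The factor `x` is chosen so that it completes both
-- `t` and `v` to products of four thetas to which the relation modulo 60 applies; having constant
-- term 1, it is cancelled afterwards. It reappears in front of `u` because each theta with nome q³⁰
-- splits into two thetas modulo 60, and the four thetas without sign in the third relation
-- contribute every factor of `x`.
--
-- Neither limits nor inverses are formed. An identity between infinite sums or products is a
-- congruence modulo qⁿ for every n, and division is cancellation of a series with constant term 1.
-- Half-integral exponents are avoided by taking half differences as parameters: the four columns
-- are d, d + 2z, d + 2z + 2y, d + 2z + 2y + 2x. The sign in ± qʳ is a series `s` with s² = 1, so
-- that the nomes q⁶⁰ and q³⁰ are served by one proof.

private module ℤ-Group = AbelianGroupProperties ℤ.+-0-abelianGroup

-- Formal power series over ℤ

Series : Set
Series = ℕ → ℤ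

infix 4 _≈_ _≈[_]_

record _≈_ (f g : Series) : Set where
  constructor coeffs
  field coeff : ∀ n → f n ≡ g n
open _≈_

infixl 6 _⊕_
infixl 7 _⊛_
infix 8 ⊖_

opaque
  _⊕_ : Series → Series → Series
  (f ⊕ g) n = f n ℤ.+ g n

  ⊖_ : Series → Series
  (⊖ f) n = ℤ.- f n

  ⊕-coeff : ∀ f g n → (f ⊕ g) n ≡ f n ℤ.+ g n
  ⊕-coeff f g n = refl

const : ℤ → Series
const c zero = c
const c (suc n) = 0ℤ

𝟘 𝟙 : Series
𝟘 n = 0ℤ
𝟙 = const 1ℤ

-- Cauchy product through f = f₀ + q f′, where f′ is `f ∘ suc`: f g = f₀ g + q f′ g.
_⊛_ : Series → Series → Series
(f ⊛ g) zero = f 0 ℤ.* g 0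
(f ⊛ g) (suc n) = f 0 ℤ.* g (suc n) ℤ.+ (f ∘ suc ⊛ g) n

-- Congruence modulo qⁿ, which takes the place of convergence; `≈[]⇒≈` assembles the congruences for
-- all n into an identity.
record _≈[_]_ (f : Series) (n : ℕ) (g : Series) : Set where
  constructor coeffs
  field coeff : ∀ i → i < n → f i ≡ g i
open _≈[_]_ renaming (coeff to coeff<)

≈⇒≈[] : ∀ {n f g} → f ≈ g → f ≈[ n ] g
≈⇒≈[] p = coeffs λ i _ → coeff p i

≈[]⇒≈ : ∀ {f g} → (∀ n → f ≈[ n ] g) → f ≈ g
≈[]⇒≈ p = coeffs λ n → coeff< (p (suc n)) n ℕ.≤-refl

≈[]-weaken : ∀ {m n f g} → m ≤ n → f ≈[ n ] g → f ≈[ m ] g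
≈[]-weaken m≤n p = coeffs λ i i<m → coeff< p i (ℕ.<-≤-trans i<m m≤n)

≈[]-setoid : ℕ → Setoid 0ℓ 0ℓ
≈[]-setoid n = record
  { Carrier = Series
  ; _≈_ = _≈[ n ]_
  ; isEquivalence = record
    { refl = coeffs λ _ _ → refl
    ; sym = λ p → coeffs λ i i<n → sym (coeff< p i i<n)
    ; trans = λ p r → coeffs λ i i<n → trans (coeff< p i i<n) (coeff< r i i<n)
    }
  }

module _ {n : ℕ} where
  open Setoid (≈[]-setoid n) public using () renaming (refl to ≈[]-refl; sym to ≈[]-sym; trans to ≈[]-trans)

opaque
  unfolding _⊕_ ⊖_

  ⊕-cong[] : ∀ {n f f′ g g′} → f ≈[ n ] f′ → g ≈[ n ] g′ → f ⊕ g ≈[ n ] f′ ⊕ g′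
  ⊕-cong[] p r = coeffs λ i i<n → cong₂ ℤ._+_ (coeff< p i i<n) (coeff< r i i<n)

  ⊖-cong[] : ∀ {n f f′} → f ≈[ n ] f′ → ⊖ f ≈[ n ] ⊖ f′
  ⊖-cong[] p = coeffs λ i i<n → cong ℤ.-_ (coeff< p i i<n)

⊛-cong[] : ∀ {n f f′ g g′} → f ≈[ n ] f′ → g ≈[ n ] g′ → f ⊛ g ≈[ n ] f′ ⊛ g′
⊛-cong[] {n} p r = coeffs λ i i<n →
  go i (λ j j≤i → coeff< p j (ℕ.≤-<-trans j≤i i<n)) (λ j j≤i → coeff< r j (ℕ.≤-<-trans j≤i i<n))
  where
  go : ∀ {f f′ g g′} i → (∀ j → j ≤ i → f j ≡ f′ j) → (∀ j → j ≤ i → g j ≡ g′ j) → (f ⊛ g) i ≡ (f′ ⊛ g′) i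
  go zero p r = cong₂ ℤ._*_ (p 0 z≤n) (r 0 z≤n)
  go (suc i) p r = cong₂ ℤ._+_ (cong₂ ℤ._*_ (p 0 z≤n) (r (suc i) ℕ.≤-refl))
    (go i (λ j j≤i → p (suc j) (s≤s j≤i)) (λ j j≤i → r j (ℕ.m≤n⇒m≤1+n j≤i)))

⊛-cong : ∀ {f f′ g g′} → f ≈ f′ → g ≈ g′ → f ⊛ g ≈ f′ ⊛ g′
⊛-cong p r = ≈[]⇒≈ λ _ → ⊛-cong[] (≈⇒≈[] p) (≈⇒≈[] r)

⊛-zeroˡ : ∀ g → 𝟘 ⊛ g ≈ 𝟘
⊛-zeroˡ g = coeffs go
  where
  go : ∀ n → (𝟘 ⊛ g) n ≡ 0ℤ
  go zero = refl
  go (suc n) = trans (ℤ.+-identityˡ _) (go n)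

const-⊛ : ∀ c g n → (const c ⊛ g) n ≡ c ℤ.* g n
const-⊛ c g zero = refl
const-⊛ c g (suc n) = trans (cong (λ z → c ℤ.* g (suc n) ℤ.+ z) (coeff (⊛-zeroˡ g) n)) (ℤ.+-identityʳ _)

opaque
  unfolding _⊕_ ⊖_

  ⊛-distribʳ : ∀ h f g → (f ⊕ g) ⊛ h ≈ f ⊛ h ⊕ g ⊛ h
  ⊛-distribʳ h f g = coeffs (go f g)
    where
    interchange : ∀ a b c x y → (a ℤ.+ b) ℤ.* c ℤ.+ (x ℤ.+ y) ≡ a ℤ.* c ℤ.+ x ℤ.+ (b ℤ.* c ℤ.+ y)
    interchange = ℤ-Solver.solve-∀
    go : ∀ f g n → ((f ⊕ g) ⊛ h) n ≡ (f ⊛ h ⊕ g ⊛ h) n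
    go f g zero = ℤ.*-distribʳ-+ (h 0) (f 0) (g 0)
    go f g (suc n) = trans (cong (λ z → (f 0 ℤ.+ g 0) ℤ.* h (suc n) ℤ.+ z) (go (f ∘ suc) (g ∘ suc) n))
      (interchange (f 0) (g 0) (h (suc n)) _ _)

⊛-scaleˡ : ∀ c f g n → ((λ i → c ℤ.* f i) ⊛ g) n ≡ c ℤ.* (f ⊛ g) n
⊛-scaleˡ c f g zero = ℤ.*-assoc c (f 0) (g 0)
⊛-scaleˡ c f g (suc n) = trans (cong₂ ℤ._+_ (ℤ.*-assoc c (f 0) _) (⊛-scaleˡ c (f ∘ suc) g n))
  (sym (ℤ.*-distribˡ-+ c _ _))

opaque
  unfolding _⊕_ ⊖_

  ⊛-assoc : ∀ f g h → (f ⊛ g) ⊛ h ≈ f ⊛ (g ⊛ h)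
  ⊛-assoc f g h = coeffs (go f)
    where
    rearrange : ∀ a b c x y → a ℤ.* b ℤ.* c ℤ.+ (a ℤ.* x ℤ.+ y) ≡ a ℤ.* (b ℤ.* c ℤ.+ x) ℤ.+ y
    rearrange = ℤ-Solver.solve-∀
    go : ∀ f n → ((f ⊛ g) ⊛ h) n ≡ (f ⊛ (g ⊛ h)) n
    go f zero = ℤ.*-assoc (f 0) (g 0) (h 0)
    go f (suc n) = begin
      f 0 ℤ.* g 0 ℤ.* h (suc n) ℤ.+ (((λ i → f 0 ℤ.* g (suc i)) ⊕ (f ∘ suc ⊛ g)) ⊛ h) n
        ≡⟨ cong (λ z → f 0 ℤ.* g 0 ℤ.* h (suc n) ℤ.+ z) (coeff (⊛-distribʳ h (λ i → f 0 ℤ.* g (suc i)) (f ∘ suc ⊛ g)) n) ⟩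
      f 0 ℤ.* g 0 ℤ.* h (suc n) ℤ.+ (((λ i → f 0 ℤ.* g (suc i)) ⊛ h) n ℤ.+ ((f ∘ suc ⊛ g) ⊛ h) n)
        ≡⟨ cong (λ z → f 0 ℤ.* g 0 ℤ.* h (suc n) ℤ.+ z) (cong₂ ℤ._+_ (⊛-scaleˡ (f 0) (g ∘ suc) h n) (go (f ∘ suc) n)) ⟩
      f 0 ℤ.* g 0 ℤ.* h (suc n) ℤ.+ (f 0 ℤ.* (g ∘ suc ⊛ h) n ℤ.+ (f ∘ suc ⊛ (g ⊛ h)) n)
        ≡⟨ rearrange (f 0) (g 0) (h (suc n)) _ _ ⟩
      f 0 ℤ.* (g ⊛ h) (suc n) ℤ.+ (f ∘ suc ⊛ (g ⊛ h)) n ∎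
      where open ≡-Reasoning

-- The definition of the product peels off the first coefficient of `f`; this form peels off the
-- last, as the mirrored recursion in `⊛-comm` requires.
⊛-suc : ∀ f g n → (f ⊛ g) (suc n) ≡ (f ⊛ g ∘ suc) n ℤ.+ f (suc n) ℤ.* g 0
⊛-suc f g zero = refl
⊛-suc f g (suc n) = trans (cong (λ z → f 0 ℤ.* g (suc (suc n)) ℤ.+ z) (⊛-suc (f ∘ suc) g n))
  (sym (ℤ.+-assoc (f 0 ℤ.* g (suc (suc n))) _ _))

⊛-comm : ∀ f g → f ⊛ g ≈ g ⊛ f
⊛-comm f g = coeffs (go f g)
  where
  go : ∀ f g n → (f ⊛ g) n ≡ (g ⊛ f) n
  go f g zero = ℤ.*-comm (f 0) (g 0)
  go f g (suc n) = begin
    f 0 ℤ.* g (suc n) ℤ.+ (f ∘ suc ⊛ g) n ≡⟨ cong₂ ℤ._+_ (ℤ.*-comm (f 0) _) (go (f ∘ suc) g n) ⟩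
    g (suc n) ℤ.* f 0 ℤ.+ (g ⊛ f ∘ suc) n ≡⟨ ℤ.+-comm (g (suc n) ℤ.* f 0) _ ⟩
    (g ⊛ f ∘ suc) n ℤ.+ g (suc n) ℤ.* f 0 ≡⟨ sym (⊛-suc g f n) ⟩
    (g ⊛ f) (suc n) ∎
    where open ≡-Reasoning

⊛-identityˡ : ∀ f → 𝟙 ⊛ f ≈ f
⊛-identityˡ f = coeffs λ n → trans (const-⊛ 1ℤ f n) (ℤ.*-identityˡ (f n))

opaque
  unfolding _⊕_ ⊖_

  ⊕-⊖-𝟘 : ∀ f → f ⊕ ⊖ 𝟘 ≈ f
  ⊕-⊖-𝟘 f = coeffs λ n → ℤ.+-identityʳ (f n)

  ⊛-distribˡ : ∀ h f g → h ⊛ (f ⊕ g) ≈ h ⊛ f ⊕ h ⊛ g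
  ⊛-distribˡ h f g = coeffs λ n → begin
    (h ⊛ (f ⊕ g)) n ≡⟨ coeff (⊛-comm h (f ⊕ g)) n ⟩
    ((f ⊕ g) ⊛ h) n ≡⟨ coeff (⊛-distribʳ h f g) n ⟩
    (f ⊛ h) n ℤ.+ (g ⊛ h) n ≡⟨ cong₂ ℤ._+_ (coeff (⊛-comm f h) n) (coeff (⊛-comm g h) n) ⟩
    (h ⊛ f) n ℤ.+ (h ⊛ g) n ∎
    where open ≡-Reasoning

opaque
  unfolding _⊕_ ⊖_

  ⊕-⊛-isCommutativeRing : IsCommutativeRing _≈_ _⊕_ _⊛_ ⊖_ 𝟘 𝟙
  ⊕-⊛-isCommutativeRing = record
    { isRing = record
      { +-isAbelianGroup = record
        { isGroup = record
          { isMonoid = record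
            { isSemigroup = record
              { isMagma = record
                { isEquivalence = record
                  { refl = coeffs λ _ → refl
                  ; sym = λ p → coeffs λ n → sym (coeff p n)
                  ; trans = λ p r → coeffs λ n → trans (coeff p n) (coeff r n)
                  }
                ; ∙-cong = λ p r → coeffs λ n → cong₂ ℤ._+_ (coeff p n) (coeff r n)
                }
              ; assoc = λ f g h → coeffs λ n → ℤ.+-assoc (f n) (g n) (h n)
              }
            ; identity = (λ f → coeffs λ n → ℤ.+-identityˡ (f n)) , (λ f → coeffs λ n → ℤ.+-identityʳ (f n))
            }
          ; inverse = (λ f → coeffs λ n → ℤ.+-inverseˡ (f n)) , (λ f → coeffs λ n → ℤ.+-inverseʳ (f n))
          ; ⁻¹-cong = λ p → coeffs λ n → cong ℤ.-_ (coeff p n)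
          }
        ; comm = λ f g → coeffs λ n → ℤ.+-comm (f n) (g n)
        }
      ; *-cong = ⊛-cong
      ; *-assoc = ⊛-assoc
      ; *-identity = ⊛-identityˡ , λ f → coeffs λ n → trans (coeff (⊛-comm f 𝟙) n) (coeff (⊛-identityˡ f) n)
      ; distrib = ⊛-distribˡ , ⊛-distribʳ
      }
    ; *-comm = ⊛-comm
    }

seriesRing : CommutativeRing 0ℓ 0ℓ
seriesRing = record { isCommutativeRing = ⊕-⊛-isCommutativeRing }

open CommutativeRing seriesRing using ()
  renaming ( refl to ≈-refl; sym to ≈-sym; trans to ≈-trans; setoid to ≈-setoid; +-cong to ⊕-cong; -‿cong to ⊖-cong
           ; *-identityʳ to ⊛-identityʳ; +-identityˡ to ⊕-identityˡ; +-identityʳ to ⊕-identityʳ; zeroʳ to ⊛-zeroʳ; +-assoc to ⊕-assoc)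

opaque
  unfolding _⊕_ ⊖_

  const-+ : ∀ a b → const (a ℤ.+ b) ≈ const a ⊕ const b
  const-+ a b = coeffs λ { zero → refl ; (suc n) → refl }

  const-neg : ∀ a → const (ℤ.- a) ≈ ⊖ const a
  const-neg a = coeffs λ { zero → refl ; (suc n) → refl }

constMorphism : CommutativeRing.rawRing ℤ.+-*-commutativeRing -Raw-AlmostCommutative⟶ fromCommutativeRing seriesRing
constMorphism = record
  { ⟦_⟧ = const
  ; +-homo = const-+
  ; *-homo = λ a b → coeffs λ { zero → refl
                              ; (suc n) → sym (trans (const-⊛ a (const b) (suc n)) (ℤ.*-zeroʳ a)) }
  ; -‿homo = const-neg
  ; 0-homo = coeffs λ { zero → refl ; (suc n) → refl }
  ; 1-homo = ≈-refl
  }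

weaklyDecide : WeaklyDecidable (Induced-equivalence constMorphism)
weaklyDecide a b with a ℤ.≟ b
... | yes refl = just ≈-refl
... | no _ = nothing

open RingSolver (CommutativeRing.rawRing ℤ.+-*-commutativeRing) (fromCommutativeRing seriesRing) constMorphism
  weaklyDecide
  using (solve; _:=_; _:+_; _:*_; _:-_; :-_; con)

-- Powers of q and infinite products

≡⇒≈ : ∀ {f g} → f ≡ g → f ≈ g
≡⇒≈ refl = ≈-refl

⊛-congˡ : ∀ {f g} h → f ≈ g → h ⊛ f ≈ h ⊛ g
⊛-congˡ h = ⊛-cong (≈-refl {h})

⊛-congʳ : ∀ {f g} h → f ≈ g → f ⊛ h ≈ g ⊛ h
⊛-congʳ h p = ⊛-cong p (≈-refl {h})

shift : Series → Series
shift f zero = 0ℤ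
shift f (suc n) = f n

shift-⊛ : ∀ f g → shift f ⊛ g ≈ shift (f ⊛ g)
shift-⊛ f g = coeffs λ { zero → refl ; (suc n) → ℤ.+-identityˡ _ }

shift-cong : ∀ {f g} → f ≈ g → shift f ≈ shift g
shift-cong p = coeffs λ { zero → refl ; (suc n) → coeff p n }

shift-cong[] : ∀ {n f g} → f ≈[ n ] g → shift f ≈[ suc n ] shift g
shift-cong[] p = coeffs λ { zero _ → refl ; (suc i) (s≤s i<n) → coeff< p i i<n }

infix 9 q^_

q^_ : ℕ → Series
q^ zero = 𝟙
q^ suc k = shift (q^ k)

q^suc-⊛ : ∀ k f → q^ suc k ⊛ f ≈ shift (q^ k ⊛ f)
q^suc-⊛ k f = shift-⊛ (q^ k) f

q^-+ : ∀ k l → q^ (k ℕ.+ l) ≈ q^ k ⊛ q^ l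
q^-+ zero l = ≈-sym (⊛-identityˡ _)
q^-+ (suc k) l = ≈-trans (shift-cong (q^-+ k l)) (≈-sym (q^suc-⊛ k (q^ l)))

q^-⊛-cong[] : ∀ {n f g} k → f ≈[ n ] g → q^ k ⊛ f ≈[ k ℕ.+ n ] q^ k ⊛ g
q^-⊛-cong[] zero p = ⊛-cong[] ≈[]-refl p
q^-⊛-cong[] {f = f} {g} (suc k) p = ≈[]-trans (≈⇒≈[] (q^suc-⊛ k f))
  (≈[]-trans (shift-cong[] (q^-⊛-cong[] k p)) (≈⇒≈[] (≈-sym (q^suc-⊛ k g))))

q^-cancel : ∀ {f g} k → q^ k ⊛ f ≈ q^ k ⊛ g → f ≈ g
q^-cancel {f} {g} zero p = ≈-trans (≈-sym (⊛-identityˡ f)) (≈-trans p (⊛-identityˡ g))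
q^-cancel {f} {g} (suc k) p = q^-cancel k (coeffs λ n → coeff p′ (suc n))
  where
  p′ : shift (q^ k ⊛ f) ≈ shift (q^ k ⊛ g)
  p′ = ≈-trans (≈-sym (q^suc-⊛ k f)) (≈-trans p (q^suc-⊛ k g))

q^-small : ∀ {n} k f → n ≤ k → q^ k ⊛ f ≈[ n ] 𝟘
q^-small k f n≤k = ≈[]-trans
  (≈[]-weaken (ℕ.≤-trans n≤k (ℕ.m≤m+n k 0)) (q^-⊛-cong[] {f = f} {𝟘} k (coeffs λ _ ())))
  (≈⇒≈[] (⊛-zeroʳ (q^ k)))

q^-⊛-coeff : ∀ k f n → (q^ k ⊛ f) (k ℕ.+ n) ≡ f n
q^-⊛-coeff zero f n = coeff (⊛-identityˡ f) n
q^-⊛-coeff (suc k) f n = trans (coeff (q^suc-⊛ k f) (suc k ℕ.+ n)) (q^-⊛-coeff k f n)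

q^-factor : ∀ {n f} → f ≈[ n ] 𝟘 → f ≈ q^ n ⊛ (λ i → f (n ℕ.+ i))
q^-factor {n} {f} p = coeffs λ i → go i (n ℕ.≤? i)
  where
  go : ∀ i → _ → f i ≡ (q^ n ⊛ (λ i → f (n ℕ.+ i))) i
  go i (no n≰i) = trans (coeff< p i (ℕ.≰⇒> n≰i)) (sym (coeff< (q^-small n _ ℕ.≤-refl) i (ℕ.≰⇒> n≰i)))
  go i (yes n≤i) = subst (λ i → f i ≡ (q^ n ⊛ (λ i → f (n ℕ.+ i))) i) (ℕ.m+[n∸m]≡n n≤i) (sym (q^-⊛-coeff n _ (i ∸ n)))

-- A factor `h` divisible by qⁿ adds n orders of precision. In the triple product this compensates
-- for the Gaussian binomials being close to their limit only in the middle of the sum.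
⊛-cong-small : ∀ {m n f g h} → h ≈[ n ] 𝟘 → f ≈[ m ] g → f ⊛ h ≈[ n ℕ.+ m ] g ⊛ h
⊛-cong-small {m} {n} {f} {g} {h} p r = ≈[]-trans (≈⇒≈[] (expand f))
  (≈[]-trans (q^-⊛-cong[] n (⊛-cong[] r ≈[]-refl)) (≈⇒≈[] (≈-sym (expand g))))
  where
  expand : ∀ f → f ⊛ h ≈ q^ n ⊛ (f ⊛ (λ i → h (n ℕ.+ i)))
  expand f = ≈-trans (⊛-congˡ f (q^-factor p))
    (solve 3 (λ f x k → f :* (x :* k) := x :* (f :* k)) ≈-refl f (q^ n) _)

-- The coefficient of qⁿ in u f is f n plus a combination of earlier coefficients of f, so the
-- coefficients are recovered one after the other.
unit-cancel[] : ∀ {n u f g} → u 0 ≡ 1ℤ → u ⊛ f ≈[ n ] u ⊛ g → f ≈[ n ] g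
unit-cancel[] {zero} u₀ p = coeffs λ _ ()
unit-cancel[] {suc n} {u} {f} {g} u₀ p = coeffs go
  where
  ih : f ≈[ n ] g
  ih = unit-cancel[] u₀ (≈[]-weaken (ℕ.n≤1+n n) p)
  unscale : ∀ {a b} → u 0 ℤ.* a ≡ u 0 ℤ.* b → a ≡ b
  unscale {a} {b} e = trans (sym (ℤ.*-identityˡ a))
    (trans (subst (λ c → c ℤ.* a ≡ c ℤ.* b) u₀ e) (ℤ.*-identityˡ b))
  last : ∀ n → f ≈[ n ] g → (u ⊛ f) n ≡ (u ⊛ g) n → f n ≡ g n
  last zero ih e = unscale e
  last (suc n) ih e = unscale (ℤ-Group.∙-cancelʳ _ (u 0 ℤ.* f (suc n)) (u 0 ℤ.* g (suc n))
    (trans e (cong (λ z → u 0 ℤ.* g (suc n) ℤ.+ z)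
      (sym (coeff< (⊛-cong[] {f = u ∘ suc} ≈[]-refl ih) n ℕ.≤-refl)))))
  go : ∀ i → i < suc n → f i ≡ g i
  go i (s≤s i≤n) with ℕ.m≤n⇒m<n∨m≡n i≤n
  ... | inj₁ i<n = coeff< ih i i<n
  ... | inj₂ refl = last n ih (coeff< p n ℕ.≤-refl)

unit-cancel : ∀ {u f g} → u 0 ≡ 1ℤ → u ⊛ f ≈ u ⊛ g → f ≈ g
unit-cancel u₀ p = ≈[]⇒≈ λ _ → unit-cancel[] u₀ (≈⇒≈[] p)

∏ : ℕ → (ℕ → Series) → Series
∏ zero f = 𝟙
∏ (suc n) f = ∏ n f ⊛ f n

∏-cong : ∀ n {f g} → (∀ i → f i ≈ g i) → ∏ n f ≈ ∏ n g
∏-cong zero p = ≈-refl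
∏-cong (suc n) p = ⊛-cong (∏-cong n p) (p n)

∏-⊛ : ∀ n f g → ∏ n (λ i → f i ⊛ g i) ≈ ∏ n f ⊛ ∏ n g
∏-⊛ zero f g = ≈-sym (⊛-identityˡ 𝟙)
∏-⊛ (suc n) f g = ≈-trans (⊛-congʳ (f n ⊛ g n) (∏-⊛ n f g))
  (solve 4 (λ a b c d → (a :* b) :* (c :* d) := (a :* c) :* (b :* d)) ≈-refl (∏ n f) (∏ n g) (f n) (g n))

∏-+ : ∀ m n f → ∏ (m ℕ.+ n) f ≈ ∏ m f ⊛ ∏ n (λ i → f (m ℕ.+ i))
∏-+ m zero f = ≈-trans (≡⇒≈ (cong (λ k → ∏ k f) (ℕ.+-identityʳ m))) (≈-sym (⊛-identityʳ _))
∏-+ m (suc n) f = ≈-trans (≡⇒≈ (cong (λ k → ∏ k f) (ℕ.+-suc m n)))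
  (≈-trans (⊛-congʳ (f (m ℕ.+ n)) (∏-+ m n f)) (⊛-assoc _ _ _))

∏-blocks : ∀ b n f → ∏ (n ℕ.* b) f ≈ ∏ n (λ i → ∏ b (λ j → f (i ℕ.* b ℕ.+ j)))
∏-blocks b zero f = ≈-refl
∏-blocks b (suc n) f = ≈-trans (≡⇒≈ (cong (λ k → ∏ k f) (ℕ.+-comm b (n ℕ.* b))))
  (≈-trans (∏-+ (n ℕ.* b) b f) (⊛-congʳ _ (∏-blocks b n f)))

∏-one : ∀ {n} k {f} → (∀ i → f i ≈[ n ] 𝟙) → ∏ k f ≈[ n ] 𝟙
∏-one zero p = ≈[]-refl
∏-one (suc k) p = ≈[]-trans (⊛-cong[] (∏-one k p) (p k)) (≈⇒≈[] (⊛-identityˡ 𝟙))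

Convergent : (ℕ → Series) → Set
Convergent f = ∀ i → f i ≈[ suc i ] 𝟙

-- Only the first n factors of a convergent product affect the coefficient of qⁿ.
∏∞ : (ℕ → Series) → Series
∏∞ f n = ∏ n f n

-- The factors from index m on are all 1 modulo q^(m+1).
∏-stable : ∀ {f} → Convergent f → ∀ m n → ∏ (m ℕ.+ n) f ≈[ suc m ] ∏ m f
∏-stable {f} c m n = ≈[]-trans (≈⇒≈[] (∏-+ m n f))
  (≈[]-trans (⊛-cong[] {f = ∏ m f} ≈[]-refl (∏-one n (λ i → ≈[]-weaken (s≤s (ℕ.m≤m+n m i)) (c (m ℕ.+ i)))))
    (≈⇒≈[] (⊛-identityʳ (∏ m f))))

∏∞-truncate : ∀ {f} → Convergent f → ∀ {n N} → n ≤ suc N → ∏∞ f ≈[ n ] ∏ N f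
∏∞-truncate {f} c {n} {N} n≤ = coeffs λ i i<n →
  let i≤N = ℕ.≤-pred (ℕ.≤-trans i<n n≤) in
  sym (trans (cong (λ k → ∏ k f i) (sym (ℕ.m+[n∸m]≡n i≤N))) (coeff< (∏-stable c i (N ∸ i)) i ℕ.≤-refl))

∏∞-cong : ∀ {f g} → (∀ i → f i ≈ g i) → ∏∞ f ≈ ∏∞ g
∏∞-cong p = coeffs λ n → coeff (∏-cong n p) n

⊛-convergent : ∀ {f g} → Convergent f → Convergent g → Convergent (λ i → f i ⊛ g i)
⊛-convergent cf cg i = ≈[]-trans (⊛-cong[] (cf i) (cg i)) (≈⇒≈[] (⊛-identityˡ 𝟙))

∏∞-⊛ : ∀ {f g} → Convergent f → Convergent g → ∏∞ (λ i → f i ⊛ g i) ≈ ∏∞ f ⊛ ∏∞ g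
∏∞-⊛ {f} {g} cf cg = ≈[]⇒≈ λ n → ≈[]-trans (∏∞-truncate (⊛-convergent cf cg) (ℕ.n≤1+n n))
  (≈[]-trans (≈⇒≈[] (∏-⊛ n f g))
    (≈[]-sym (⊛-cong[] (∏∞-truncate cf (ℕ.n≤1+n n)) (∏∞-truncate cg (ℕ.n≤1+n n)))))

blocks-convergent : ∀ b {f} → Convergent f → Convergent (λ i → ∏ (suc b) (λ j → f (i ℕ.* suc b ℕ.+ j)))
blocks-convergent b {f} c i = ∏-one (suc b) λ j →
  ≈[]-weaken (s≤s (ℕ.≤-trans (ℕ.m≤m*n i (suc b)) (ℕ.m≤m+n _ j))) (c (i ℕ.* suc b ℕ.+ j))

-- Regrouping consecutive factors; with blocks of 2 it doubles the modulus of a product, with blocks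
-- of 60 it sorts the factors 1 - qⁿ by the residue of n.
∏∞-blocks : ∀ b {f} → Convergent f → ∏∞ f ≈ ∏∞ (λ i → ∏ (suc b) (λ j → f (i ℕ.* suc b ℕ.+ j)))
∏∞-blocks b {f} c = ≈[]⇒≈ λ n →
  ≈[]-trans (∏∞-truncate c (ℕ.≤-trans (ℕ.m≤m*n n (suc b)) (ℕ.n≤1+n _)))
    (≈[]-trans (≈⇒≈[] (∏-blocks (suc b) n f)) (≈[]-sym (∏∞-truncate (blocks-convergent b c) (ℕ.n≤1+n n))))

one-minus-small : ∀ {n f} → f ≈[ n ] 𝟘 → 𝟙 ⊕ ⊖ f ≈[ n ] 𝟙
one-minus-small p = ≈[]-trans (⊕-cong[] ≈[]-refl (⊖-cong[] p)) (≈⇒≈[] (⊕-⊖-𝟘 𝟙))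

one-minus-q^ : ∀ {n} k → n ≤ k → 𝟙 ⊕ ⊖ q^ k ≈[ n ] 𝟙
one-minus-q^ k n≤k = one-minus-small (≈[]-trans (≈⇒≈[] (≈-sym (⊛-identityʳ (q^ k)))) (q^-small k 𝟙 n≤k))

-- (s qʳ; qᵐ)∞
poch : Series → ℕ → ℕ → Series
poch s m r = ∏∞ (λ i → 𝟙 ⊕ ⊖ (s ⊛ q^ (i ℕ.* m ℕ.+ r)))

poch-convergent : ∀ s m r → Convergent (λ i → 𝟙 ⊕ ⊖ (s ⊛ q^ (i ℕ.* suc m ℕ.+ suc r)))
poch-convergent s m r i = one-minus-small (≈[]-trans (≈⇒≈[] (⊛-comm s _)) (q^-small _ s bound))
  where
  bound : suc i ≤ i ℕ.* suc m ℕ.+ suc r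
  bound = ℕ.≤-trans (s≤s (ℕ.≤-trans (ℕ.m≤m*n i (suc m)) (ℕ.m≤m+n _ r))) (ℕ.≤-reflexive (sym (ℕ.+-suc _ r)))

-- Generating functions of partitions

≤ᵇ-true : ∀ {m n} → m ≤ n → (m ℕ.≤ᵇ n) ≡ true
≤ᵇ-true m≤n = Equivalence.to T-≡ (ℕ.≤⇒≤ᵇ m≤n)

≤ᵇ-false : ∀ {m n} → n < m → (m ℕ.≤ᵇ n) ≡ false
≤ᵇ-false {m} {n} n<m = ¬-not λ e → ℕ.<⇒≱ n<m (ℕ.≤ᵇ⇒≤ m n (Equivalence.from T-≡ e))

module _ (S : PosSet) where

  pb-excluded : ∀ k n f → S (suc k) ≡ false → pb S (suc k) n f ≡ pb S k n f
  pb-excluded k n zero e = refl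
  pb-excluded k n (suc f) e rewrite e = ℕ.+-identityʳ _

  pb-large : ∀ k n f → n < suc k → pb S (suc k) n f ≡ pb S k n f
  pb-large k n zero n<k = refl
  pb-large k n (suc f) n<k with S (suc k)
  ... | false = ℕ.+-identityʳ _
  ... | true rewrite ≤ᵇ-false n<k = ℕ.+-identityʳ _

  pb-included : ∀ k n f → S (suc k) ≡ true → suc k ≤ n →
    pb S (suc k) n (suc f) ≡ pb S k n (suc f) ℕ.+ pb S (suc k) (n ∸ suc k) f
  pb-included k n f e k<n rewrite e | ≤ᵇ-true k<n = refl

  -- Using a part lowers `n` by at least one and the fuel by exactly one, so the fuel never falls
  -- below `n`.
  pb-fuel : ∀ k n f f′ → n ≤ f → n ≤ f′ → pb S k n f ≡ pb S k n f′
  pb-fuel zero zero f f′ _ _ = refl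
  pb-fuel zero (suc n) f f′ _ _ = refl
  pb-fuel (suc k) n f f′ n≤f n≤f′ with S (suc k) in e | suc k ℕ.≤? n
  ... | false | _ = trans (pb-excluded k n f e) (trans (pb-fuel k n f f′ n≤f n≤f′) (sym (pb-excluded k n f′ e)))
  ... | true | no k≮n = trans (pb-large k n f n<k) (trans (pb-fuel k n f f′ n≤f n≤f′) (sym (pb-large k n f′ n<k)))
    where n<k = ℕ.≰⇒> k≮n
  pb-fuel (suc k) (suc n) (suc f) (suc f′) (s≤s n≤f) (s≤s n≤f′) | true | yes k<n = begin
    pb S (suc k) (suc n) (suc f) ≡⟨ pb-included k (suc n) f e k<n ⟩
    pb S k (suc n) (suc f) ℕ.+ pb S (suc k) (n ∸ k) f
      ≡⟨ cong₂ ℕ._+_ (pb-fuel k (suc n) (suc f) (suc f′) (s≤s n≤f) (s≤s n≤f′))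
                     (pb-fuel (suc k) (n ∸ k) f f′ (ℕ.≤-trans (ℕ.m∸n≤m n k) n≤f) (ℕ.≤-trans (ℕ.m∸n≤m n k) n≤f′)) ⟩
    pb S k (suc n) (suc f′) ℕ.+ pb S (suc k) (n ∸ k) f′ ≡⟨ sym (pb-included k (suc n) f′ e k<n) ⟩
    pb S (suc k) (suc n) (suc f′) ∎
    where open ≡-Reasoning

  partitions≤ : ℕ → Series
  partitions≤ k n = + pb S k n n

  partitions : Series
  partitions n = + p S n

  eulerFactor : ℕ → Series
  eulerFactor k = if S (suc k) then 𝟙 ⊕ ⊖ q^ suc k else 𝟙

  -- A partition into parts ≤ k + 1 either avoids k + 1 or arises by adding one copy of it, so
  -- G(k+1) = G(k) + q^(k+1) G(k+1) when k + 1 is allowed.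
  partitions≤-suc : ∀ k → eulerFactor k ⊛ partitions≤ (suc k) ≈ partitions≤ k
  partitions≤-suc k with S (suc k) in e
  ... | false = ≈-trans (⊛-identityˡ _) (coeffs λ n → cong +_ (pb-excluded k n n e))
  ... | true = begin
    (𝟙 ⊕ ⊖ q^ suc k) ⊛ partitions≤ (suc k)
      ≈⟨ solve 2 (λ x g → (con 1ℤ :+ :- x) :* g := g :+ :- (x :* g)) ≈-refl (q^ suc k) (partitions≤ (suc k)) ⟩
    partitions≤ (suc k) ⊕ ⊖ (q^ suc k ⊛ partitions≤ (suc k)) ≈⟨ ⊕-cong recurrence ≈-refl ⟩
    (partitions≤ k ⊕ q^ suc k ⊛ partitions≤ (suc k)) ⊕ ⊖ (q^ suc k ⊛ partitions≤ (suc k))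
      ≈⟨ solve 2 (λ g h → (g :+ h) :+ :- h := g) ≈-refl (partitions≤ k) (q^ suc k ⊛ partitions≤ (suc k)) ⟩
    partitions≤ k ∎
    where
    open SetoidReasoning ≈-setoid
    large : ∀ n → suc k ≤ n → + pb S (suc k) n n ≡ + pb S k n n ℤ.+ (q^ suc k ⊛ partitions≤ (suc k)) n
    large (suc n) k<n@(s≤s k≤n) = trans
      (cong +_ (trans (pb-included k (suc n) n e k<n)
        (cong (pb S k (suc n) (suc n) ℕ.+_) (pb-fuel (suc k) (n ∸ k) n (n ∸ k) (ℕ.m∸n≤m n k) ℕ.≤-refl))))
      (trans (ℤ.pos-+ (pb S k (suc n) (suc n)) _)
        (cong (λ z → + pb S k (suc n) (suc n) ℤ.+ z) (sym (trans
          (cong (q^ suc k ⊛ partitions≤ (suc k)) (cong suc (sym (ℕ.m+[n∸m]≡n k≤n))))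
          (q^-⊛-coeff (suc k) (partitions≤ (suc k)) (n ∸ k))))))
    recurrence : partitions≤ (suc k) ≈ partitions≤ k ⊕ q^ suc k ⊛ partitions≤ (suc k)
    recurrence = coeffs λ n → trans (go n (suc k ℕ.≤? n)) (sym (⊕-coeff (partitions≤ k) _ n))
      where
      go : ∀ n → _ → + pb S (suc k) n n ≡ + pb S k n n ℤ.+ (q^ suc k ⊛ partitions≤ (suc k)) n
      go n (yes k<n) = large n k<n
      go n (no k≮n) = trans (cong +_ (pb-large k n n (ℕ.≰⇒> k≮n))) (sym (trans
        (cong (λ z → + pb S k n n ℤ.+ z)
          (coeff< (q^-small (suc k) (partitions≤ (suc k)) ℕ.≤-refl) n (ℕ.≰⇒> k≮n)))
        (ℤ.+-identityʳ _)))

  ∏-eulerFactor-⊛-partitions≤ : ∀ k → ∏ k eulerFactor ⊛ partitions≤ k ≈ 𝟙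
  ∏-eulerFactor-⊛-partitions≤ zero = ≈-trans (⊛-identityˡ _) (coeffs λ { zero → refl ; (suc n) → refl })
  ∏-eulerFactor-⊛-partitions≤ (suc k) = ≈-trans (⊛-assoc (∏ k eulerFactor) _ _)
    (≈-trans (⊛-congˡ _ (partitions≤-suc k)) (∏-eulerFactor-⊛-partitions≤ k))

  partitions≤-stable : ∀ m n → pb S (m ℕ.+ n) n n ≡ pb S n n n
  partitions≤-stable zero n = refl
  partitions≤-stable (suc m) n = trans (pb-large (m ℕ.+ n) n n (s≤s (ℕ.m≤n+m n m))) (partitions≤-stable m n)

  eulerFactor-convergent : Convergent eulerFactor
  eulerFactor-convergent k with S (suc k)
  ... | false = ≈[]-refl
  ... | true = one-minus-q^ (suc k) ℕ.≤-refl

  -- Parts larger than i do not occur in partitions of i, so modulo qⁿ both factors may be replaced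
  -- by their versions with parts ≤ n.
  ∏∞-eulerFactor-⊛-partitions : ∏∞ eulerFactor ⊛ partitions ≈ 𝟙
  ∏∞-eulerFactor-⊛-partitions = ≈[]⇒≈ λ n → ≈[]-trans
    (⊛-cong[] (∏∞-truncate eulerFactor-convergent (ℕ.n≤1+n n)) (coeffs λ i i<n → cong +_ (sym (trans
      (cong (λ k → pb S k i i) (sym (ℕ.m∸n+n≡m (ℕ.<⇒≤ i<n)))) (partitions≤-stable (n ∸ i) i)))))
    (≈⇒≈[] (∏-eulerFactor-⊛-partitions≤ n))

-- Gaussian binomials and the Jacobi triple product

∑ : ℕ → (ℕ → Series) → Series
∑ zero f = 𝟘
∑ (suc n) f = ∑ n f ⊕ f n

∑-cong : ∀ n {f g} → (∀ i → f i ≈ g i) → ∑ n f ≈ ∑ n g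
∑-cong zero p = ≈-refl
∑-cong (suc n) p = ⊕-cong (∑-cong n p) (p n)

∑-cong[] : ∀ {k} n {f g} → (∀ i → i < n → f i ≈[ k ] g i) → ∑ n f ≈[ k ] ∑ n g
∑-cong[] zero p = ≈[]-refl
∑-cong[] (suc n) p = ⊕-cong[] (∑-cong[] n λ i i<n → p i (ℕ.m<n⇒m<1+n i<n)) (p n ℕ.≤-refl)

∑-𝟘 : ∀ n → ∑ n (λ _ → 𝟘) ≈ 𝟘
∑-𝟘 zero = ≈-refl
∑-𝟘 (suc n) = ≈-trans (⊕-cong (∑-𝟘 n) ≈-refl) (⊕-identityˡ 𝟘)

∑-⊕ : ∀ n f g → ∑ n (λ i → f i ⊕ g i) ≈ ∑ n f ⊕ ∑ n g
∑-⊕ zero f g = ≈-sym (⊕-identityˡ 𝟘)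
∑-⊕ (suc n) f g = ≈-trans (⊕-cong (∑-⊕ n f g) ≈-refl)
  (solve 4 (λ a b c d → (a :+ b) :+ (c :+ d) := (a :+ c) :+ (b :+ d)) ≈-refl (∑ n f) (∑ n g) (f n) (g n))

∑-⊛ʳ : ∀ n f g → ∑ n f ⊛ g ≈ ∑ n (λ i → f i ⊛ g)
∑-⊛ʳ zero f g = ⊛-zeroˡ g
∑-⊛ʳ (suc n) f g = ≈-trans (⊛-distribʳ g (∑ n f) (f n)) (⊕-cong (∑-⊛ʳ n f g) ≈-refl)

∑-⊛ˡ : ∀ n f g → g ⊛ ∑ n f ≈ ∑ n (λ i → g ⊛ f i)
∑-⊛ˡ n f g = ≈-trans (⊛-comm g (∑ n f)) (≈-trans (∑-⊛ʳ n f g) (∑-cong n λ i → ⊛-comm (f i) g))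

∑-+ : ∀ m n f → ∑ (m ℕ.+ n) f ≈ ∑ m f ⊕ ∑ n (λ i → f (m ℕ.+ i))
∑-+ m zero f = ≈-trans (≡⇒≈ (cong (λ k → ∑ k f) (ℕ.+-identityʳ m))) (≈-sym (⊕-identityʳ _))
∑-+ m (suc n) f = ≈-trans (≡⇒≈ (cong (λ k → ∑ k f) (ℕ.+-suc m n)))
  (≈-trans (⊕-cong (∑-+ m n f) ≈-refl) (⊕-assoc (∑ m f) _ _))

∑-head : ∀ n f → ∑ (suc n) f ≈ f 0 ⊕ ∑ n (f ∘ suc)
∑-head n f = ≈-trans (∑-+ 1 n f) (⊕-cong (⊕-identityˡ (f 0)) ≈-refl)

∏-head : ∀ n f → ∏ (suc n) f ≈ f 0 ⊛ ∏ n (f ∘ suc)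
∏-head n f = ≈-trans (∏-+ 1 n f) (⊛-congʳ _ (⊛-identityˡ (f 0)))

-- The summands at −L, …, len − L − 1.
window : ℕ → ℕ → (ℤ → Series) → Series
window L len g = ∑ len (λ i → g (i ℤ.⊖ L))

∑-small : ∀ {k} n {f} → (∀ i → i < n → f i ≈[ k ] 𝟘) → ∑ n f ≈[ k ] 𝟘
∑-small n p = ≈[]-trans (∑-cong[] n p) (≈⇒≈[] (∑-𝟘 n))

-- The hypotheses say that the window contains -n, ..., n - 1; all summands outside this range
-- vanish modulo qⁿ.
window-stable : ∀ {n L len g} → (∀ k → n ≤ ℤ.∣ k ∣ → g k ≈[ n ] 𝟘) → n ≤ L → L ℕ.+ n ≤ len →
  window L len g ≈[ n ] window n (n ℕ.+ n) g
window-stable {n} {L} {len} {g} small n≤L L+n≤len = subst₂ (λ L len → window L len g ≈[ n ] window n (n ℕ.+ n) g)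
  L-eq len-eq (≈[]-trans (≈⇒≈[] (≈-trans (∑-+ a _ _) (⊕-cong ≈-refl (∑-+ (n ℕ.+ n) b _))))
    (≈[]-trans (⊕-cong[] (∑-small a left) (⊕-cong[] (≈⇒≈[] (∑-cong (n ℕ.+ n) middle)) (∑-small b λ i _ → right i)))
      (≈⇒≈[] (≈-trans (⊕-identityˡ _) (⊕-identityʳ _)))))
  where
  a b : ℕ
  a = L ∸ n
  b = len ∸ (L ℕ.+ n)
  L-eq : a ℕ.+ n ≡ L
  L-eq = ℕ.m∸n+n≡m n≤L
  len-eq : a ℕ.+ (n ℕ.+ n ℕ.+ b) ≡ len
  len-eq = trans (trans (regroup a n b) (cong (λ z → z ℕ.+ n ℕ.+ b) L-eq)) (ℕ.m+[n∸m]≡n L+n≤len)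
    where
    regroup : ∀ a n b → a ℕ.+ (n ℕ.+ n ℕ.+ b) ≡ a ℕ.+ n ℕ.+ n ℕ.+ b
    regroup = ℕ-Solver.solve-∀
  left : ∀ i → i < a → g (i ℤ.⊖ (a ℕ.+ n)) ≈[ n ] 𝟘
  left i i<a = small _ (ℕ.≤-trans (ℕ.m≤n+m n (a ∸ i)) (ℕ.≤-reflexive (sym
    (trans (ℤ.∣⊖∣-≤ (ℕ.≤-trans (ℕ.<⇒≤ i<a) (ℕ.m≤m+n a n))) (ℕ.+-∸-comm n (ℕ.<⇒≤ i<a))))))
  middle : ∀ i → g ((a ℕ.+ i) ℤ.⊖ (a ℕ.+ n)) ≈ g (i ℤ.⊖ n)
  middle i = ≡⇒≈ (cong g (ℤ.+-cancelˡ-⊖ a i n))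
  right : ∀ i → g ((a ℕ.+ (n ℕ.+ n ℕ.+ i)) ℤ.⊖ (a ℕ.+ n)) ≈[ n ] 𝟘
  right i = small _ (ℕ.≤-trans (ℕ.m≤m+n n i) (ℕ.≤-reflexive (sym (cong ℤ.∣_∣
    (trans (ℤ.+-cancelˡ-⊖ a (n ℕ.+ n ℕ.+ i) n) (trans (cong (ℤ._⊖ n) (ℕ.+-assoc n n i))
      (trans (ℤ.⊖-≥ (ℕ.m≤m+n n (n ℕ.+ i))) (cong +_ (ℕ.m+n∸m≡n n (n ℕ.+ i))))))))))

∑-swap : ∀ m n (f : ℕ → ℕ → Series) → ∑ m (λ i → ∑ n (f i)) ≈ ∑ n (λ j → ∑ m (λ i → f i j))
∑-swap zero n f = ≈-sym (∑-𝟘 n)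
∑-swap (suc m) n f = ≈-trans (⊕-cong (∑-swap m n f) ≈-refl) (≈-sym (∑-⊕ n _ (f m)))

∑-pairs : ∀ n f → ∑ (n ℕ.* 2) f ≈ ∑ n (λ i → f (i ℕ.* 2) ⊕ f (suc (i ℕ.* 2)))
∑-pairs zero f = ≈-refl
∑-pairs (suc n) f = ≈-trans (⊕-assoc (∑ (n ℕ.* 2) f) _ _) (⊕-cong (∑-pairs n f) ≈-refl)

module Gaussian (m : ℕ) where

  -- Gaussian binomials in base qᵐ, introduced by the q-Pascal rule so that no quotient is formed.
  gauss : ℕ → ℕ → Series
  gauss n zero = 𝟙
  gauss zero (suc k) = 𝟘
  gauss (suc n) (suc k) = gauss n k ⊕ q^ (suc k ℕ.* m) ⊛ gauss n (suc k)

  gauss-zero : ∀ n k → n < k → gauss n k ≈ 𝟘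
  gauss-zero zero (suc k) _ = ≈-refl
  gauss-zero (suc n) (suc k) (s≤s n<k) = ≈-trans
    (⊕-cong (gauss-zero n k n<k) (≈-trans (⊛-congˡ _ (gauss-zero n (suc k) (ℕ.m<n⇒m<1+n n<k))) (⊛-zeroʳ _)))
    (⊕-identityˡ 𝟘)

  gauss-zeroʳ : ∀ n → gauss n 0 ≈ 𝟙
  gauss-zeroʳ zero = ≈-refl
  gauss-zeroʳ (suc n) = ≈-refl

  -- The q-Pascal rule summed against an arbitrary sequence `Y`. It is the induction step of both
  -- `q-binomial` and `finite-triple-product`.
  ∑-gauss-suc : ∀ n (Y : ℕ → Series) →
    ∑ (suc n) (λ j → gauss n j ⊛ Y (suc j)) ⊕ ∑ (suc n) (λ j → gauss n j ⊛ (q^ (j ℕ.* m) ⊛ Y j))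
      ≈ ∑ (suc (suc n)) (λ j → gauss (suc n) j ⊛ Y j)
  ∑-gauss-suc n Y = begin
    L ⊕ ∑ (suc n) R ≈⟨ ⊕-cong ≈-refl extend ⟩
    L ⊕ ∑ (suc (suc n)) R ≈⟨ ⊕-cong ≈-refl (∑-head (suc n) R) ⟩
    L ⊕ (R 0 ⊕ ∑ (suc n) (R ∘ suc))
      ≈⟨ solve 3 (λ a b c → a :+ (b :+ c) := b :+ (a :+ c)) ≈-refl L (R 0) (∑ (suc n) (R ∘ suc)) ⟩
    R 0 ⊕ (L ⊕ ∑ (suc n) (R ∘ suc)) ≈⟨ ⊕-cong first (≈-trans (≈-sym (∑-⊕ (suc n) _ _)) (∑-cong (suc n) rest)) ⟩
    gauss (suc n) 0 ⊛ Y 0 ⊕ ∑ (suc n) (λ j → gauss (suc n) (suc j) ⊛ Y (suc j)) ≈⟨ ≈-sym (∑-head (suc n) _) ⟩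
    ∑ (suc (suc n)) (λ j → gauss (suc n) j ⊛ Y j) ∎
    where
    open SetoidReasoning ≈-setoid
    L : Series
    L = ∑ (suc n) (λ j → gauss n j ⊛ Y (suc j))
    R : ℕ → Series
    R j = gauss n j ⊛ (q^ (j ℕ.* m) ⊛ Y j)
    extend : ∑ (suc n) R ≈ ∑ (suc (suc n)) R
    extend = ≈-sym (≈-trans (⊕-cong ≈-refl (≈-trans (⊛-congʳ _ (gauss-zero n (suc n) ℕ.≤-refl)) (⊛-zeroˡ _)))
      (⊕-identityʳ _))
    first : R 0 ≈ gauss (suc n) 0 ⊛ Y 0
    first = ⊛-cong (gauss-zeroʳ n) (⊛-identityˡ (Y 0))
    rest : ∀ j → gauss n j ⊛ Y (suc j) ⊕ R (suc j) ≈ gauss (suc n) (suc j) ⊛ Y (suc j)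
    rest j = solve 4 (λ g x h y → g :* y :+ h :* (x :* y) := (g :+ x :* h) :* y) ≈-refl
      (gauss n j) (q^ (suc j ℕ.* m)) (gauss n (suc j)) (Y (suc j))

  -- The factor `𝟙 ⊛` keeps the shape of the factors of `poch 𝟙 m m`, whose truncation this is.
  euler : ℕ → Series
  euler k = ∏ k (λ i → 𝟙 ⊕ ⊖ (𝟙 ⊛ q^ (i ℕ.* m ℕ.+ m)))

  -- The numerator (1 - q^(nm)) (1 - q^((n-1)m)) ... of the Gaussian binomial, with k factors; it is
  -- 0 for k > n.
  falling : ℕ → ℕ → Series
  falling n zero = 𝟙
  falling zero (suc k) = 𝟘
  falling (suc n) (suc k) = (𝟙 ⊕ ⊖ q^ (suc n ℕ.* m)) ⊛ falling n k

  -- The next factor is 1 - q^((n-k)m). Multiplying by q^(km) turns it into q^(km) - q^(nm), which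
  -- avoids the subtraction n - k.
  falling-suc : ∀ n k → q^ (k ℕ.* m) ⊛ falling n (suc k) ⊕ q^ (n ℕ.* m) ⊛ falling n k ≈ q^ (k ℕ.* m) ⊛ falling n k
  falling-suc zero zero = ≈-trans (⊕-cong (⊛-zeroʳ 𝟙) ≈-refl) (⊕-identityˡ _)
  falling-suc zero (suc k) = ≈-trans (⊕-cong ≈-refl (⊛-zeroʳ 𝟙)) (⊕-identityʳ _)
  falling-suc (suc n) zero = solve 1 (λ x → con 1ℤ :* ((con 1ℤ :+ :- x) :* con 1ℤ) :+ x :* con 1ℤ := con 1ℤ :* con 1ℤ)
    ≈-refl (q^ (suc n ℕ.* m))
  falling-suc (suc n) (suc k) = begin
    q^ (suc k ℕ.* m) ⊛ (f ⊛ falling n (suc k)) ⊕ q^ (suc n ℕ.* m) ⊛ (f ⊛ falling n k)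
      ≈⟨ ⊕-cong (⊛-congʳ _ (q^-+ m (k ℕ.* m))) (⊛-congʳ _ (q^-+ m (n ℕ.* m))) ⟩
    (q^ m ⊛ q^ (k ℕ.* m)) ⊛ (f ⊛ falling n (suc k)) ⊕ (q^ m ⊛ q^ (n ℕ.* m)) ⊛ (f ⊛ falling n k)
      ≈⟨ solve 6 (λ x a b f u v → (x :* a) :* (f :* u) :+ (x :* b) :* (f :* v) := (x :* f) :* (a :* u :+ b :* v)) ≈-refl
         (q^ m) (q^ (k ℕ.* m)) (q^ (n ℕ.* m)) f (falling n (suc k)) (falling n k) ⟩
    (q^ m ⊛ f) ⊛ (q^ (k ℕ.* m) ⊛ falling n (suc k) ⊕ q^ (n ℕ.* m) ⊛ falling n k) ≈⟨ ⊛-congˡ _ (falling-suc n k) ⟩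
    (q^ m ⊛ f) ⊛ (q^ (k ℕ.* m) ⊛ falling n k)
      ≈⟨ solve 4 (λ x f a v → (x :* f) :* (a :* v) := (x :* a) :* (f :* v)) ≈-refl (q^ m) f (q^ (k ℕ.* m)) (falling n k) ⟩
    (q^ m ⊛ q^ (k ℕ.* m)) ⊛ (f ⊛ falling n k) ≈⟨ ⊛-congʳ _ (≈-sym (q^-+ m (k ℕ.* m))) ⟩
    q^ (suc k ℕ.* m) ⊛ (f ⊛ falling n k) ∎
    where
    open SetoidReasoning ≈-setoid
    f : Series
    f = 𝟙 ⊕ ⊖ q^ (suc n ℕ.* m)

  euler-gauss : ∀ n k → euler k ⊛ gauss n k ≈ falling n k
  euler-gauss n zero = ≈-trans (⊛-identityˡ _) (gauss-zeroʳ n)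
  euler-gauss zero (suc k) = ⊛-zeroʳ _
  euler-gauss (suc n) (suc k) = begin
    (euler k ⊛ (𝟙 ⊕ ⊖ (𝟙 ⊛ q^ (k ℕ.* m ℕ.+ m)))) ⊛ (gauss n k ⊕ x ⊛ gauss n (suc k))
      ≈⟨ ⊛-congʳ _ (⊛-congˡ _ last) ⟩
    (euler k ⊛ (𝟙 ⊕ ⊖ x)) ⊛ (gauss n k ⊕ x ⊛ gauss n (suc k))
      ≈⟨ solve 4 (λ e x g h → (e :* (con 1ℤ :+ :- x)) :* (g :+ x :* h)
                   := (con 1ℤ :+ :- x) :* (e :* g) :+ x :* ((e :* (con 1ℤ :+ :- x)) :* h)) ≈-refl
         (euler k) x (gauss n k) (gauss n (suc k)) ⟩
    (𝟙 ⊕ ⊖ x) ⊛ (euler k ⊛ gauss n k) ⊕ x ⊛ ((euler k ⊛ (𝟙 ⊕ ⊖ x)) ⊛ gauss n (suc k))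
      ≈⟨ ⊕-cong (⊛-congˡ _ (euler-gauss n k))
           (⊛-congˡ _ (≈-trans (⊛-congʳ _ (⊛-congˡ _ (≈-sym last))) (euler-gauss n (suc k)))) ⟩
    (𝟙 ⊕ ⊖ x) ⊛ falling n k ⊕ x ⊛ falling n (suc k)
      ≈⟨ ⊕-cong ≈-refl (⊛-congʳ _ (q^-+ m (k ℕ.* m))) ⟩
    (𝟙 ⊕ ⊖ x) ⊛ falling n k ⊕ (q^ m ⊛ q^ (k ℕ.* m)) ⊛ falling n (suc k)
      ≈⟨ solve 6 (λ x p k n u v → (con 1ℤ :+ :- x) :* u :+ (p :* k) :* v
                   := ((con 1ℤ :+ :- x) :* u :+ p :* (k :* v :+ n :* u)) :+ :- ((p :* n) :* u)) ≈-refl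
         x (q^ m) (q^ (k ℕ.* m)) (q^ (n ℕ.* m)) (falling n k) (falling n (suc k)) ⟩
    ((𝟙 ⊕ ⊖ x) ⊛ falling n k ⊕ q^ m ⊛ (q^ (k ℕ.* m) ⊛ falling n (suc k) ⊕ q^ (n ℕ.* m) ⊛ falling n k))
      ⊕ ⊖ ((q^ m ⊛ q^ (n ℕ.* m)) ⊛ falling n k)
      ≈⟨ ⊕-cong (⊕-cong (⊛-congʳ _ (⊕-cong ≈-refl (⊖-cong (q^-+ m (k ℕ.* m))))) (⊛-congˡ _ (falling-suc n k)))
                (⊖-cong (⊛-congʳ _ (≈-sym (q^-+ m (n ℕ.* m))))) ⟩
    ((𝟙 ⊕ ⊖ (q^ m ⊛ q^ (k ℕ.* m))) ⊛ falling n k ⊕ q^ m ⊛ (q^ (k ℕ.* m) ⊛ falling n k))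
      ⊕ ⊖ (q^ (suc n ℕ.* m) ⊛ falling n k)
      ≈⟨ solve 4 (λ p k n u → ((con 1ℤ :+ :- (p :* k)) :* u :+ p :* (k :* u)) :+ :- (n :* u) := (con 1ℤ :+ :- n) :* u)
         ≈-refl (q^ m) (q^ (k ℕ.* m)) (q^ (suc n ℕ.* m)) (falling n k) ⟩
    (𝟙 ⊕ ⊖ q^ (suc n ℕ.* m)) ⊛ falling n k ∎
    where
    open SetoidReasoning ≈-setoid
    x : Series
    x = q^ (suc k ℕ.* m)
    last : 𝟙 ⊕ ⊖ (𝟙 ⊛ q^ (k ℕ.* m ℕ.+ m)) ≈ 𝟙 ⊕ ⊖ x
    last = ⊕-cong ≈-refl (⊖-cong (≈-trans (⊛-identityˡ _) (≡⇒≈ (cong q^_ (ℕ.+-comm (k ℕ.* m) m)))))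

module JacobiTriple (s : Series) (s² : s ⊛ s ≈ 𝟙) (m′ r′ t′ : ℕ) (r+t : suc r′ ℕ.+ suc t′ ≡ suc m′) where

  private
    m = suc m′
    r = suc r′
    t = suc t′

  open Gaussian m

  falling-one : ∀ n k → falling n k ≈[ n ∸ k ] 𝟙
  falling-one n zero = ≈[]-refl
  falling-one zero (suc k) = coeffs λ _ ()
  falling-one (suc n) (suc k) = ≈[]-trans (⊛-cong[] one (falling-one n k)) (≈⇒≈[] (⊛-identityˡ 𝟙))
    where
    one : 𝟙 ⊕ ⊖ q^ (suc n ℕ.* m) ≈[ n ∸ k ] 𝟙
    one = one-minus-q^ (suc n ℕ.* m) (ℕ.≤-trans (ℕ.m∸n≤m n k) (ℕ.≤-trans (ℕ.n≤1+n n) (ℕ.m≤m*n (suc n) m)))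

  euler∞ : Series
  euler∞ = poch 𝟙 m m

  -- Modulo q^d the infinite product may be cut to its first k factors, which turn the Gaussian
  -- binomial into `falling n k`; that is 1 modulo q^(n-k).
  euler∞-gauss : ∀ {d} n k → d ≤ k → d ≤ n ∸ k → euler∞ ⊛ gauss n k ≈[ d ] 𝟙
  euler∞-gauss n k d≤k d≤n∸k = ≈[]-trans
    (⊛-cong[] (∏∞-truncate (poch-convergent 𝟙 m′ m′) (ℕ.m≤n⇒m≤1+n d≤k)) ≈[]-refl)
    (≈[]-trans (≈⇒≈[] (euler-gauss n k)) (≈[]-weaken d≤n∸k (falling-one n k)))

  step : ℕ → ℕ → Series
  step r i = ⊖ (s ⊛ q^ (i ℕ.* m ℕ.+ r))

  -- The term (-s)^k q^(m k(k-1)/2 + r k) of the bilateral series. For k = -n the exponent equals m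
  -- n(n-1)/2 + t n because r + t = m, and (-s)^(-n) = (-s)^n because s² = 1.
  theta-term : ℤ → Series
  theta-term (+ n) = ∏ n (step r)
  theta-term -[1+ n ] = ∏ (suc n) (step t)

  finite-product : ℕ → ℕ → Series
  finite-product r n = ∏ n (λ i → 𝟙 ⊕ step r i)

  step-+ : ∀ r i j → step r (i ℕ.+ j) ≈ q^ (i ℕ.* m) ⊛ step r j
  step-+ r i j = begin
    ⊖ (s ⊛ q^ ((i ℕ.+ j) ℕ.* m ℕ.+ r)) ≈⟨ ⊖-cong (⊛-congˡ s (≈-trans (≡⇒≈ (cong q^_ exponent)) (q^-+ (i ℕ.* m) _))) ⟩
    ⊖ (s ⊛ (q^ (i ℕ.* m) ⊛ q^ (j ℕ.* m ℕ.+ r)))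
      ≈⟨ solve 3 (λ s x y → :- (s :* (x :* y)) := x :* :- (s :* y)) ≈-refl s (q^ (i ℕ.* m)) (q^ (j ℕ.* m ℕ.+ r)) ⟩
    q^ (i ℕ.* m) ⊛ step r j ∎
    where
    open SetoidReasoning ≈-setoid
    exponent : (i ℕ.+ j) ℕ.* m ℕ.+ r ≡ i ℕ.* m ℕ.+ (j ℕ.* m ℕ.+ r)
    exponent = trans (cong (ℕ._+ r) (ℕ.*-distribʳ-+ m i j)) (ℕ.+-assoc (i ℕ.* m) _ _)

  -- Induction by splitting off the factor with i = 0. What remains is the product for m + r, hence
  -- the quantification over `r`; each `∏ j (step r)` absorbs the usual power q^(m j(j-1)/2).
  q-binomial : ∀ n r → finite-product r n ≈ ∑ (suc n) (λ j → gauss n j ⊛ ∏ j (step r))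
  q-binomial zero r = ≈-sym (≈-trans (⊕-identityˡ _) (⊛-identityˡ 𝟙))
  q-binomial (suc n) r = begin
    finite-product r (suc n) ≈⟨ ∏-head n _ ⟩
    (𝟙 ⊕ step r 0) ⊛ ∏ n (λ i → 𝟙 ⊕ step r (suc i)) ≈⟨ ⊛-congˡ _ (∏-cong n λ i → ⊕-cong ≈-refl (shifted i)) ⟩
    (𝟙 ⊕ step r 0) ⊛ finite-product (m ℕ.+ r) n ≈⟨ ⊛-congˡ _ (q-binomial n (m ℕ.+ r)) ⟩
    (𝟙 ⊕ step r 0) ⊛ ∑ (suc n) (λ j → gauss n j ⊛ ∏ j (step (m ℕ.+ r)))
      ≈⟨ ⊛-congˡ _ (∑-cong (suc n) λ j → ⊛-congˡ _ (∏-cong j λ i → ≈-sym (shifted i))) ⟩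
    (𝟙 ⊕ step r 0) ⊛ ∑ (suc n) (λ j → gauss n j ⊛ ∏ j (step r ∘ suc))
      ≈⟨ solve 2 (λ a x → (con 1ℤ :+ a) :* x := a :* x :+ x) ≈-refl (step r 0) _ ⟩
    step r 0 ⊛ ∑ (suc n) (λ j → gauss n j ⊛ ∏ j (step r ∘ suc)) ⊕ ∑ (suc n) (λ j → gauss n j ⊛ ∏ j (step r ∘ suc))
      ≈⟨ ⊕-cong (≈-trans (∑-⊛ˡ (suc n) _ _) (∑-cong (suc n) λ j → ≈-trans
            (solve 3 (λ a g x → a :* (g :* x) := g :* (a :* x)) ≈-refl (step r 0) (gauss n j) _)
            (⊛-congˡ _ (≈-sym (∏-head j (step r))))))
          (∑-cong (suc n) λ j → ⊛-congˡ _ (scaled j)) ⟩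
    ∑ (suc n) (λ j → gauss n j ⊛ ∏ (suc j) (step r)) ⊕ ∑ (suc n) (λ j → gauss n j ⊛ (q^ (j ℕ.* m) ⊛ ∏ j (step r)))
      ≈⟨ ∑-gauss-suc n (λ j → ∏ j (step r)) ⟩
    ∑ (suc (suc n)) (λ j → gauss (suc n) j ⊛ ∏ j (step r)) ∎
    where
    open SetoidReasoning ≈-setoid
    shifted : ∀ i → step r (suc i) ≈ step (m ℕ.+ r) i
    shifted i = ⊖-cong (⊛-congˡ s (≡⇒≈ (cong q^_ (trans (cong (ℕ._+ r) (ℕ.+-comm m (i ℕ.* m))) (ℕ.+-assoc (i ℕ.* m) m r)))))
    scaled : ∀ j → ∏ j (step r ∘ suc) ≈ q^ (j ℕ.* m) ⊛ ∏ j (step r)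
    scaled zero = ≈-sym (⊛-identityˡ 𝟙)
    scaled (suc j) = begin
      ∏ j (step r ∘ suc) ⊛ step r (suc j) ≈⟨ ⊛-cong (scaled j) (step-+ r 1 j) ⟩
      (q^ (j ℕ.* m) ⊛ ∏ j (step r)) ⊛ (q^ (1 ℕ.* m) ⊛ step r j)
        ≈⟨ solve 4 (λ a b c d → (a :* b) :* (c :* d) := (c :* a) :* (b :* d)) ≈-refl (q^ (j ℕ.* m)) (∏ j (step r)) (q^ (1 ℕ.* m)) (step r j) ⟩
      (q^ (1 ℕ.* m) ⊛ q^ (j ℕ.* m)) ⊛ ∏ (suc j) (step r)
        ≈⟨ ⊛-congʳ _ (≈-trans (≈-sym (q^-+ (1 ℕ.* m) (j ℕ.* m))) (≡⇒≈ (cong (λ k → q^ (k ℕ.+ j ℕ.* m)) (ℕ.*-identityˡ m)))) ⟩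
      q^ (suc j ℕ.* m) ⊛ ∏ (suc j) (step r) ∎

  theta-term-neg : ∀ n → theta-term (ℤ.- (+ n)) ≡ ∏ n (step t)
  theta-term-neg zero = refl
  theta-term-neg (suc n) = refl

  step-step : ∀ i j → step t i ⊛ step r j ≈ q^ ((i ℕ.+ suc j) ℕ.* m)
  step-step i j = begin
    ⊖ (s ⊛ q^ (i ℕ.* m ℕ.+ t)) ⊛ ⊖ (s ⊛ q^ (j ℕ.* m ℕ.+ r))
      ≈⟨ solve 3 (λ s x y → :- (s :* x) :* :- (s :* y) := (s :* s) :* (x :* y)) ≈-refl s (q^ (i ℕ.* m ℕ.+ t)) (q^ (j ℕ.* m ℕ.+ r)) ⟩
    (s ⊛ s) ⊛ (q^ (i ℕ.* m ℕ.+ t) ⊛ q^ (j ℕ.* m ℕ.+ r)) ≈⟨ ⊛-cong s² (≈-sym (q^-+ (i ℕ.* m ℕ.+ t) (j ℕ.* m ℕ.+ r))) ⟩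
    𝟙 ⊛ q^ (i ℕ.* m ℕ.+ t ℕ.+ (j ℕ.* m ℕ.+ r)) ≈⟨ ⊛-identityˡ _ ⟩
    q^ (i ℕ.* m ℕ.+ t ℕ.+ (j ℕ.* m ℕ.+ r)) ≈⟨ ≡⇒≈ (cong q^_ exponent) ⟩
    q^ ((i ℕ.+ suc j) ℕ.* m) ∎
    where
    open SetoidReasoning ≈-setoid
    regroup : ∀ i j m r t → i ℕ.* m ℕ.+ t ℕ.+ (j ℕ.* m ℕ.+ r) ≡ i ℕ.* m ℕ.+ ((r ℕ.+ t) ℕ.+ j ℕ.* m)
    regroup = ℕ-Solver.solve-∀
    exponent : i ℕ.* m ℕ.+ t ℕ.+ (j ℕ.* m ℕ.+ r) ≡ (i ℕ.+ suc j) ℕ.* m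
    exponent = trans (regroup i j m r t) (trans (cong (λ z → i ℕ.* m ℕ.+ (z ℕ.+ j ℕ.* m)) r+t) (sym (ℕ.*-distribʳ-+ m i (suc j))))

  -- Consecutive terms k and k - 1 have ratio -s q^((k-1)m+r). For k = j - n, multiplying this by
  -- q^(jm) leaves -s q^((n+1)m-r), which is `step t n`. The cases follow the sign of k, where
  -- `theta-term` changes its formula.
  theta-term-step : ∀ j n → step t n ⊛ theta-term (j ℤ.⊖ n) ≈ q^ (j ℕ.* m) ⊛ theta-term (j ℤ.⊖ suc n)
  theta-term-step j n with ℕ.≤-total j n
  ... | inj₁ j≤n = begin
    step t n ⊛ theta-term (j ℤ.⊖ n) ≈⟨ ⊛-cong (≡⇒≈ (cong (step t) (sym (ℕ.m+[n∸m]≡n j≤n))))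
                                        (≡⇒≈ (trans (cong theta-term (ℤ.⊖-≤ j≤n)) (theta-term-neg (n ∸ j)))) ⟩
    step t (j ℕ.+ (n ∸ j)) ⊛ ∏ (n ∸ j) (step t) ≈⟨ ⊛-congʳ _ (step-+ t j (n ∸ j)) ⟩
    (q^ (j ℕ.* m) ⊛ step t (n ∸ j)) ⊛ ∏ (n ∸ j) (step t)
      ≈⟨ solve 3 (λ a b c → (a :* b) :* c := a :* (c :* b)) ≈-refl (q^ (j ℕ.* m)) (step t (n ∸ j)) (∏ (n ∸ j) (step t)) ⟩
    q^ (j ℕ.* m) ⊛ theta-term (-[1+ n ∸ j ]) ≈⟨ ⊛-congˡ _ (≡⇒≈ (cong theta-term (sym index))) ⟩
    q^ (j ℕ.* m) ⊛ theta-term (j ℤ.⊖ suc n) ∎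
    where
    open SetoidReasoning ≈-setoid
    index : j ℤ.⊖ suc n ≡ -[1+ n ∸ j ]
    index = trans (ℤ.⊖-< (s≤s j≤n)) (cong (ℤ.-_ ∘ +_) (ℕ.+-∸-assoc 1 j≤n))
  ... | inj₂ n≤j with ℕ.m≤n⇒m<n∨m≡n n≤j
  ...   | inj₂ refl = begin
    step t n ⊛ theta-term (n ℤ.⊖ n) ≈⟨ ⊛-cong (≈-trans (≡⇒≈ (cong (step t) (sym (ℕ.+-identityʳ n)))) (step-+ t n 0)) (≡⇒≈ (cong theta-term (ℤ.n⊖n≡0 n))) ⟩
    (q^ (n ℕ.* m) ⊛ step t 0) ⊛ 𝟙 ≈⟨ solve 2 (λ a b → (a :* b) :* con 1ℤ := a :* (con 1ℤ :* b)) ≈-refl (q^ (n ℕ.* m)) (step t 0) ⟩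
    q^ (n ℕ.* m) ⊛ theta-term -[1+ 0 ] ≈⟨ ⊛-congˡ _ (≡⇒≈ (cong theta-term (sym index))) ⟩
    q^ (n ℕ.* m) ⊛ theta-term (n ℤ.⊖ suc n) ∎
    where
    open SetoidReasoning ≈-setoid
    index : n ℤ.⊖ suc n ≡ -[1+ 0 ]
    index = trans (ℤ.⊖-< (ℕ.n<1+n n)) (cong (ℤ.-_ ∘ +_) (trans (ℕ.+-∸-assoc 1 (ℕ.≤-refl {n})) (cong suc (ℕ.n∸n≡0 n))))
  theta-term-step (suc j) n | inj₂ _ | inj₁ (s≤s n≤j) = begin
    step t n ⊛ theta-term (suc j ℤ.⊖ n)
      ≈⟨ ⊛-congˡ _ (≡⇒≈ (cong theta-term (trans (ℤ.⊖-≥ (ℕ.m≤n⇒m≤1+n n≤j)) (cong +_ (ℕ.+-∸-assoc 1 n≤j))))) ⟩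
    step t n ⊛ (∏ (j ∸ n) (step r) ⊛ step r (j ∸ n))
      ≈⟨ solve 3 (λ a b c → a :* (b :* c) := (a :* c) :* b) ≈-refl (step t n) (∏ (j ∸ n) (step r)) (step r (j ∸ n)) ⟩
    (step t n ⊛ step r (j ∸ n)) ⊛ ∏ (j ∸ n) (step r) ≈⟨ ⊛-congʳ _ (step-step n (j ∸ n)) ⟩
    q^ ((n ℕ.+ suc (j ∸ n)) ℕ.* m) ⊛ ∏ (j ∸ n) (step r)
      ≈⟨ ⊛-cong (≡⇒≈ (cong (λ k → q^ (k ℕ.* m)) (trans (ℕ.+-suc n (j ∸ n)) (cong suc (ℕ.m+[n∸m]≡n n≤j)))))
           (≡⇒≈ (cong theta-term (sym (ℤ.⊖-≥ (s≤s n≤j))))) ⟩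
    q^ (suc j ℕ.* m) ⊛ theta-term (suc j ℤ.⊖ suc n) ∎
    where open SetoidReasoning ≈-setoid

  -- Induction on `N`: the case 0 is the q-binomial theorem, and the new factor 1 + `step t N`
  -- produces exactly the two sums of the q-Pascal rule by `theta-term-step`.
  finite-triple-product : ∀ M N → finite-product r M ⊛ finite-product t N
    ≈ ∑ (suc (M ℕ.+ N)) (λ j → gauss (M ℕ.+ N) j ⊛ theta-term (j ℤ.⊖ N))
  finite-triple-product M zero = ≈-trans (⊛-identityʳ _) (≈-trans (q-binomial M r)
    (≈-sym (≡⇒≈ (cong (λ k → ∑ (suc k) (λ j → gauss k j ⊛ ∏ j (step r))) (ℕ.+-identityʳ M)))))
  finite-triple-product M (suc N) = begin
    finite-product r M ⊛ (finite-product t N ⊛ (𝟙 ⊕ step t N)) ≈⟨ ≈-sym (⊛-assoc (finite-product r M) _ _) ⟩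
    (finite-product r M ⊛ finite-product t N) ⊛ (𝟙 ⊕ step t N) ≈⟨ ⊛-congʳ _ (finite-triple-product M N) ⟩
    S ⊛ (𝟙 ⊕ step t N) ≈⟨ solve 2 (λ a x → x :* (con 1ℤ :+ a) := x :+ a :* x) ≈-refl (step t N) S ⟩
    S ⊕ step t N ⊛ S
      ≈⟨ ⊕-cong (∑-cong (suc (M ℕ.+ N)) λ j → ⊛-congˡ _ (≡⇒≈ (cong theta-term (sym (ℤ.[1+m]⊖[1+n]≡m⊖n j N)))))
          (≈-trans (∑-⊛ˡ (suc (M ℕ.+ N)) _ _) (∑-cong (suc (M ℕ.+ N)) λ j → ≈-trans
            (solve 3 (λ a g x → a :* (g :* x) := g :* (a :* x)) ≈-refl (step t N) (gauss (M ℕ.+ N) j) _)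
            (⊛-congˡ _ (theta-term-step j N)))) ⟩
    ∑ (suc (M ℕ.+ N)) (λ j → gauss (M ℕ.+ N) j ⊛ theta-term (suc j ℤ.⊖ suc N))
      ⊕ ∑ (suc (M ℕ.+ N)) (λ j → gauss (M ℕ.+ N) j ⊛ (q^ (j ℕ.* m) ⊛ theta-term (j ℤ.⊖ suc N)))
      ≈⟨ ∑-gauss-suc (M ℕ.+ N) (λ j → theta-term (j ℤ.⊖ suc N)) ⟩
    ∑ (suc (suc (M ℕ.+ N))) (λ j → gauss (suc (M ℕ.+ N)) j ⊛ theta-term (j ℤ.⊖ suc N))
      ≈⟨ ≡⇒≈ (cong (λ k → ∑ (suc k) (λ j → gauss k j ⊛ theta-term (j ℤ.⊖ suc N))) (sym (ℕ.+-suc M N))) ⟩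
    ∑ (suc (M ℕ.+ suc N)) (λ j → gauss (M ℕ.+ suc N) j ⊛ theta-term (j ℤ.⊖ suc N)) ∎
    where
    open SetoidReasoning ≈-setoid
    S : Series
    S = ∑ (suc (M ℕ.+ N)) (λ j → gauss (M ℕ.+ N) j ⊛ theta-term (j ℤ.⊖ N))

  theta-term-small : ∀ {n} k → n ≤ ℤ.∣ k ∣ → theta-term k ≈[ n ] 𝟘
  theta-term-small {n} k n≤k = ≈[]-weaken n≤k (small k)
    where
    step-small : ∀ r i → step (suc r) i ≈[ suc i ] 𝟘
    step-small r i = ≈[]-trans
      (≈⇒≈[] (solve 2 (λ s x → :- (s :* x) := x :* :- s) ≈-refl s (q^ (i ℕ.* m ℕ.+ suc r))))
      (q^-small _ (⊖ s) (ℕ.≤-trans (ℕ.≤-reflexive (ℕ.+-comm 1 i)) (ℕ.+-mono-≤ (ℕ.m≤m*n i m) (s≤s z≤n))))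
    last-small : ∀ r i → ∏ (suc i) (step (suc r)) ≈[ suc i ] 𝟘
    last-small r i = ≈[]-trans (⊛-cong[] {f = ∏ i (step (suc r))} ≈[]-refl (step-small r i)) (≈⇒≈[] (⊛-zeroʳ _))
    small : ∀ k → theta-term k ≈[ ℤ.∣ k ∣ ] 𝟘
    small (+ zero) = coeffs λ _ ()
    small (+ suc i) = last-small r′ i
    small -[1+ i ] = last-small t′ i

  bilateral : Series
  bilateral = euler∞ ⊛ (poch s m r ⊛ poch s m t)

  -- The finite product with M = N is multiplied by `euler∞`. The weight of term j is 1 modulo q^d
  -- with d = min(j, 2N - j), the term is divisible by q^|j-N|, and |j - N| + d = N.
  triple-product[] : ∀ N → bilateral ≈[ N ] window N (N ℕ.+ N) theta-term
  triple-product[] N = ≈[]-trans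
    (⊛-cong[] {f = euler∞} ≈[]-refl (⊛-cong[] (∏∞-truncate (poch-convergent s m′ r′) (ℕ.n≤1+n N))
                                              (∏∞-truncate (poch-convergent s m′ t′) (ℕ.n≤1+n N))))
    (≈[]-trans (≈⇒≈[] (≈-trans (⊛-congˡ euler∞ (finite-triple-product N N)) (∑-⊛ˡ (suc (N ℕ.+ N)) _ euler∞)))
      (≈[]-trans (∑-cong[] (suc (N ℕ.+ N)) λ j j≤2N → term j (ℕ.≤-pred j≤2N))
        -- The finite sum has 2N + 1 terms and the window 2N; the surplus term has index N and
        -- vanishes modulo q^N.
        (≈[]-trans (⊕-cong[] ≈[]-refl (theta-term-small (N ℕ.+ N ℤ.⊖ N) last)) (≈⇒≈[] (⊕-identityʳ _)))))
    where
    last : N ≤ ℤ.∣ N ℕ.+ N ℤ.⊖ N ∣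
    last = ℕ.≤-reflexive (sym (cong ℤ.∣_∣ (trans (ℤ.⊖-≥ (ℕ.m≤m+n N N)) (cong +_ (ℕ.m+n∸n≡m N N)))))
    term : ∀ j → j ≤ N ℕ.+ N →
      euler∞ ⊛ (gauss (N ℕ.+ N) j ⊛ theta-term (j ℤ.⊖ N)) ≈[ N ] theta-term (j ℤ.⊖ N)
    approximate : ∀ {d} j → d ≤ j → d ≤ N ℕ.+ N ∸ j → ℤ.∣ j ℤ.⊖ N ∣ ℕ.+ d ≡ N →
      euler∞ ⊛ (gauss (N ℕ.+ N) j ⊛ theta-term (j ℤ.⊖ N)) ≈[ N ] theta-term (j ℤ.⊖ N)
    approximate {d} j d≤j d≤ eq = subst
      (λ n → euler∞ ⊛ (gauss (N ℕ.+ N) j ⊛ theta-term (j ℤ.⊖ N)) ≈[ n ] theta-term (j ℤ.⊖ N)) eq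
      (≈[]-trans (≈⇒≈[] (≈-sym (⊛-assoc euler∞ _ _)))
        (≈[]-trans (⊛-cong-small (theta-term-small (j ℤ.⊖ N) ℕ.≤-refl) (euler∞-gauss (N ℕ.+ N) j d≤j d≤))
          (≈⇒≈[] (⊛-identityˡ _))))
    term j j≤2N with ℕ.≤-total j N
    ... | inj₁ j≤N = approximate j ℕ.≤-refl
      (ℕ.≤-trans j≤N (ℕ.≤-trans (ℕ.m≤m+n N (N ∸ j)) (ℕ.≤-reflexive (sym (ℕ.+-∸-assoc N j≤N)))))
      (trans (cong (ℕ._+ j) (ℤ.∣⊖∣-≤ j≤N)) (ℕ.m∸n+n≡m j≤N))
    ... | inj₂ N≤j = approximate j
      (ℕ.≤-trans (ℕ.∸-monoʳ-≤ (N ℕ.+ N) N≤j) (ℕ.≤-trans (ℕ.≤-reflexive (ℕ.m+n∸n≡m N N)) N≤j)) ℕ.≤-refl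
      (trans (cong (ℕ._+ (N ℕ.+ N ∸ j)) (trans (ℤ.∣m⊖n∣≡∣n⊖m∣ j N) (ℤ.∣⊖∣-≤ N≤j))) (total j≤2N N≤j))
      where
      total : ∀ {j} → j ≤ N ℕ.+ N → N ≤ j → j ∸ N ℕ.+ (N ℕ.+ N ∸ j) ≡ N
      total {j} j≤2N N≤j = ℕ.+-cancelˡ-≡ N _ _ (trans (sym (ℕ.+-assoc N (j ∸ N) _))
        (trans (cong (ℕ._+ (N ℕ.+ N ∸ j)) (ℕ.m+[n∸m]≡n N≤j)) (ℕ.m+[n∸m]≡n j≤2N)))

-- Products of two theta series

infixr 10 _^^_

_^^_ : Series → ℕ → Series
s ^^ zero = 𝟙
s ^^ suc n = s ^^ n ⊛ s

-- m n(n−1)/2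
triangle : ℕ → ℕ → ℕ
triangle m zero = 0
triangle m (suc n) = triangle m n ℕ.+ n ℕ.* m

-- m k(k−1)/2 + r k, provided that r + t = m
exponent : ℕ → ℕ → ℕ → ℤ → ℕ
exponent m r t (+ n) = triangle m n ℕ.+ n ℕ.* r
exponent m r t -[1+ n ] = triangle m (suc n) ℕ.+ suc n ℕ.* t

-- Twice the exponent is one integer polynomial for both signs of `k`, so exponent identities can be
-- left to the ring solver and halved afterwards.
double-exponent : ℤ → ℤ → ℤ → ℤ
double-exponent m r k = m ℤ.* (k ℤ.* (k ℤ.- + 1)) ℤ.+ + 2 ℤ.* (r ℤ.* k)

+-double-triangle : ∀ m n → + 2 ℤ.* + triangle m n ≡ + m ℤ.* (+ n ℤ.* (+ n ℤ.- + 1))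
+-double-triangle m zero = sym (ℤ.*-zeroʳ (+ m))
+-double-triangle m (suc n) = begin
  + 2 ℤ.* (+ triangle m n ℤ.+ + (n ℕ.* m)) ≡⟨ ℤ.*-distribˡ-+ (+ 2) (+ triangle m n) _ ⟩
  + 2 ℤ.* + triangle m n ℤ.+ + 2 ℤ.* + (n ℕ.* m) ≡⟨ cong₂ (λ x y → x ℤ.+ + 2 ℤ.* y) (+-double-triangle m n) (ℤ.pos-* n m) ⟩
  + m ℤ.* (+ n ℤ.* (+ n ℤ.- + 1)) ℤ.+ + 2 ℤ.* (+ n ℤ.* + m) ≡⟨ algebra (+ m) (+ n) ⟩
  + m ℤ.* ((+ 1 ℤ.+ + n) ℤ.* ((+ 1 ℤ.+ + n) ℤ.- + 1)) ∎
  where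
  open ≡-Reasoning
  algebra : ∀ m n → m ℤ.* (n ℤ.* (n ℤ.- + 1)) ℤ.+ + 2 ℤ.* (n ℤ.* m) ≡ m ℤ.* ((+ 1 ℤ.+ n) ℤ.* ((+ 1 ℤ.+ n) ℤ.- + 1))
  algebra = ℤ-Solver.solve-∀

+-double-exponent : ∀ {m r t} → r ℕ.+ t ≡ m → ∀ k → + 2 ℤ.* + exponent m r t k ≡ double-exponent (+ m) (+ r) k
+-double-exponent {m} {r} {t} _ (+ n) = begin
  + 2 ℤ.* (+ triangle m n ℤ.+ + (n ℕ.* r)) ≡⟨ ℤ.*-distribˡ-+ (+ 2) (+ triangle m n) _ ⟩
  + 2 ℤ.* + triangle m n ℤ.+ + 2 ℤ.* + (n ℕ.* r)
    ≡⟨ cong₂ (λ x y → x ℤ.+ + 2 ℤ.* y) (+-double-triangle m n) (trans (ℤ.pos-* n r) (ℤ.*-comm (+ n) (+ r))) ⟩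
  double-exponent (+ m) (+ r) (+ n) ∎
  where open ≡-Reasoning
+-double-exponent {r = r} {t} refl -[1+ n ] = begin
  + 2 ℤ.* (+ triangle m N ℤ.+ + (N ℕ.* t)) ≡⟨ ℤ.*-distribˡ-+ (+ 2) (+ triangle m N) _ ⟩
  + 2 ℤ.* + triangle m N ℤ.+ + 2 ℤ.* + (N ℕ.* t) ≡⟨ cong₂ (λ x y → x ℤ.+ + 2 ℤ.* y) (+-double-triangle m N) (ℤ.pos-* N t) ⟩
  + m ℤ.* (+ N ℤ.* (+ N ℤ.- + 1)) ℤ.+ + 2 ℤ.* (+ N ℤ.* + t) ≡⟨ algebra (+ r) (+ t) (+ N) ⟩
  double-exponent (+ m) (+ r) -[1+ n ] ∎
  where
  open ≡-Reasoning
  m N : ℕ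
  m = r ℕ.+ t
  N = suc n
  algebra : ∀ r t n → (r ℤ.+ t) ℤ.* (n ℤ.* (n ℤ.- + 1)) ℤ.+ + 2 ℤ.* (n ℤ.* t)
    ≡ (r ℤ.+ t) ℤ.* ((ℤ.- n) ℤ.* ((ℤ.- n) ℤ.- + 1)) ℤ.+ + 2 ℤ.* (r ℤ.* (ℤ.- n))
  algebra = ℤ-Solver.solve-∀

module _ (s : Series) (s² : s ⊛ s ≈ 𝟙) where

  ^^-square : ∀ n → s ^^ n ⊛ s ^^ n ≈ 𝟙
  ^^-square zero = ⊛-identityˡ 𝟙
  ^^-square (suc n) = ≈-trans (solve 2 (λ x s → (x :* s) :* (x :* s) := (x :* x) :* (s :* s)) ≈-refl (s ^^ n) s)
    (≈-trans (⊛-cong (^^-square n) s²) (⊛-identityˡ 𝟙))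

  -- Since s² = 1 only the parity of the exponent matters; so |k| may stand for a negative exponent
  -- k.
  ^^-suc : ∀ k → s ^^ ℤ.∣ ℤ.suc k ∣ ≈ s ^^ ℤ.∣ k ∣ ⊛ s
  ^^-suc (+ n) = ≈-refl
  ^^-suc -[1+ zero ] = ≈-sym (≈-trans (⊛-congʳ s (⊛-identityˡ s)) s²)
  ^^-suc -[1+ suc n ] = ≈-sym (≈-trans (⊛-assoc (s ^^ suc n) s s) (≈-trans (⊛-congˡ _ s²) (⊛-identityʳ _)))

  ^^-+double⁺ : ∀ n k → s ^^ ℤ.∣ k ℤ.+ + (n ℕ.+ n) ∣ ≈ s ^^ ℤ.∣ k ∣
  ^^-+double⁺ zero k = ≡⇒≈ (cong (λ k → s ^^ ℤ.∣ k ∣) (ℤ.+-identityʳ k))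
  ^^-+double⁺ (suc n) k = begin
    s ^^ ℤ.∣ k ℤ.+ + (suc n ℕ.+ suc n) ∣
      ≈⟨ ≡⇒≈ (cong (λ k → s ^^ ℤ.∣ k ∣) (trans (cong (λ z → k ℤ.+ + suc z) (ℕ.+-suc n n)) (index k (+ (n ℕ.+ n))))) ⟩
    s ^^ ℤ.∣ ℤ.suc (ℤ.suc (k ℤ.+ + (n ℕ.+ n))) ∣ ≈⟨ ^^-suc (ℤ.suc (k ℤ.+ + (n ℕ.+ n))) ⟩
    s ^^ ℤ.∣ ℤ.suc (k ℤ.+ + (n ℕ.+ n)) ∣ ⊛ s ≈⟨ ⊛-congʳ s (^^-suc (k ℤ.+ + (n ℕ.+ n))) ⟩
    (s ^^ ℤ.∣ k ℤ.+ + (n ℕ.+ n) ∣ ⊛ s) ⊛ s ≈⟨ ≈-trans (⊛-assoc _ s s) (≈-trans (⊛-congˡ _ s²) (⊛-identityʳ _)) ⟩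
    s ^^ ℤ.∣ k ℤ.+ + (n ℕ.+ n) ∣ ≈⟨ ^^-+double⁺ n k ⟩
    s ^^ ℤ.∣ k ∣ ∎
    where
    open SetoidReasoning ≈-setoid
    index : ∀ k z → k ℤ.+ (+ 1 ℤ.+ (+ 1 ℤ.+ z)) ≡ + 1 ℤ.+ (+ 1 ℤ.+ (k ℤ.+ z))
    index = ℤ-Solver.solve-∀

  ^^-+double : ∀ l j → s ^^ ℤ.∣ l ℤ.+ (j ℤ.+ j) ∣ ≈ s ^^ ℤ.∣ l ∣
  ^^-+double l (+ n) = ^^-+double⁺ n l
  ^^-+double l j@(-[1+ n ]) = ≈-trans (≈-sym (^^-+double⁺ (suc n) (l ℤ.+ (j ℤ.+ j))))
    (≡⇒≈ (cong (λ k → s ^^ ℤ.∣ k ∣) (index l j)))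
    where
    index : ∀ l j → l ℤ.+ (j ℤ.+ j) ℤ.+ (ℤ.- j ℤ.+ ℤ.- j) ≡ l
    index = ℤ-Solver.solve-∀

module _ (s : Series) (s² : s ⊛ s ≈ 𝟙) (m′ r′ t′ : ℕ) (r+t : suc r′ ℕ.+ suc t′ ≡ suc m′) where

  open JacobiTriple s s² m′ r′ t′ r+t

  ∏-step : ∀ r n → ∏ n (step r) ≈ (⊖ s) ^^ n ⊛ q^ (triangle (suc m′) n ℕ.+ n ℕ.* r)
  ∏-step r zero = ≈-sym (⊛-identityˡ 𝟙)
  ∏-step r (suc n) = begin
    ∏ n (step r) ⊛ ⊖ (s ⊛ q^ (n ℕ.* suc m′ ℕ.+ r)) ≈⟨ ⊛-congʳ _ (∏-step r n) ⟩
    ((⊖ s) ^^ n ⊛ q^ (triangle (suc m′) n ℕ.+ n ℕ.* r)) ⊛ ⊖ (s ⊛ q^ (n ℕ.* suc m′ ℕ.+ r))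
      ≈⟨ solve 4 (λ p x s y → (p :* x) :* :- (s :* y) := (p :* :- s) :* (x :* y)) ≈-refl
         ((⊖ s) ^^ n) (q^ (triangle (suc m′) n ℕ.+ n ℕ.* r)) s (q^ (n ℕ.* suc m′ ℕ.+ r)) ⟩
    (⊖ s) ^^ suc n ⊛ (q^ (triangle (suc m′) n ℕ.+ n ℕ.* r) ⊛ q^ (n ℕ.* suc m′ ℕ.+ r))
      ≈⟨ ⊛-congˡ _ (≈-trans (≈-sym (q^-+ (triangle (suc m′) n ℕ.+ n ℕ.* r) _))
           (≡⇒≈ (cong q^_ (regroup (triangle (suc m′) n) n r (suc m′))))) ⟩
    (⊖ s) ^^ suc n ⊛ q^ (triangle (suc m′) (suc n) ℕ.+ suc n ℕ.* r) ∎
    where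
    open SetoidReasoning ≈-setoid
    regroup : ∀ T n r m → T ℕ.+ n ℕ.* r ℕ.+ (n ℕ.* m ℕ.+ r) ≡ T ℕ.+ n ℕ.* m ℕ.+ (r ℕ.+ n ℕ.* r)
    regroup = ℕ-Solver.solve-∀

  theta-term-closed : ∀ k → theta-term k ≈ (⊖ s) ^^ ℤ.∣ k ∣ ⊛ q^ exponent (suc m′) (suc r′) (suc t′) k
  theta-term-closed (+ n) = ∏-step (suc r′) n
  theta-term-closed -[1+ n ] = ∏-step (suc t′) (suc n)

⊖𝟙-square : ⊖ 𝟙 ⊛ ⊖ 𝟙 ≈ 𝟙
⊖𝟙-square = solve 0 (:- con 1ℤ :* :- con 1ℤ := con 1ℤ) ≈-refl

⊖⊖𝟙-^^ : ∀ n → (⊖ ⊖ 𝟙) ^^ n ≈ 𝟙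
⊖⊖𝟙-^^ zero = ≈-refl
⊖⊖𝟙-^^ (suc n) = ≈-trans (⊛-congʳ _ (⊖⊖𝟙-^^ n)) (solve 0 (con 1ℤ :* :- :- con 1ℤ := con 1ℤ) ≈-refl)

-- ∑ₖ (−s)^k q^(m k(k−1)/2 + r k) for r + t = m, in the form given by the Jacobi triple product
thetaSum : Series → ℕ → ℕ → ℕ → Series
thetaSum s m r t = poch 𝟙 m m ⊛ (poch s m r ⊛ poch s m t)

⊖-∸-index : ∀ i j n → i ≤ n →
  j ℤ.⊖ (n ∸ i) ≡ (+ i ℤ.+ + j) ℤ.- + n
⊖-∸-index i j n i≤n = begin
  j ℤ.⊖ (n ∸ i) ≡⟨ sym (ℤ.m-n≡m⊖n j (n ∸ i)) ⟩
  + j ℤ.- + (n ∸ i) ≡⟨ cong (λ z → + j ℤ.- z) (trans (sym (ℤ.⊖-≥ i≤n)) (sym (ℤ.m-n≡m⊖n n i))) ⟩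
  + j ℤ.- (+ n ℤ.- + i) ≡⟨ algebra (+ i) (+ j) (+ n) ⟩
  (+ i ℤ.+ + j) ℤ.- + n ∎
  where
  open ≡-Reasoning
  algebra : ∀ i j n → j ℤ.- (n ℤ.- i) ≡ (i ℤ.+ j) ℤ.- n
  algebra = ℤ-Solver.solve-∀

-- Here a = b + 2w, so u = w + b and w are the half sum and half difference of a and b, and c = m -
-- a. Building everything from positive w, b, c makes all the complementary arguments visibly
-- positive.
module ThetaProduct (s : Series) (s² : s ⊛ s ≈ 𝟙) (w′ b′ c′ : ℕ) where

  private
    w = suc w′
    b = suc b′
    c = suc c′
    u = w ℕ.+ b
    a = w ℕ.+ u
    m = a ℕ.+ c
    m′ = w′ ℕ.+ u ℕ.+ c
    M′ = m′ ℕ.+ m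

    m-eq : w ℕ.+ b ℕ.+ (w ℕ.+ c) ≡ m
    m-eq = solution w b c
      where
      solution : ∀ w b c → w ℕ.+ b ℕ.+ (w ℕ.+ c) ≡ w ℕ.+ (w ℕ.+ b) ℕ.+ c
      solution = ℕ-Solver.solve-∀
    w-eq : w ℕ.+ (u ℕ.+ c) ≡ m
    w-eq = sym (ℕ.+-assoc w u c)
    A-eq : a ℕ.+ (c ℕ.+ m) ≡ m ℕ.+ m
    A-eq = sym (ℕ.+-assoc a c m)
    C-eq : a ℕ.+ m ℕ.+ c ≡ m ℕ.+ m
    C-eq = solution a m c
      where
      solution : ∀ a m c → a ℕ.+ m ℕ.+ c ≡ a ℕ.+ c ℕ.+ m
      solution = ℕ-Solver.solve-∀
    Aᵦ-eq : b ℕ.+ (w ℕ.+ w ℕ.+ c ℕ.+ m) ≡ m ℕ.+ m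
    Aᵦ-eq = solution w b c m
      where
      solution : ∀ w b c m → b ℕ.+ (w ℕ.+ w ℕ.+ c ℕ.+ m) ≡ w ℕ.+ (w ℕ.+ b) ℕ.+ c ℕ.+ m
      solution = ℕ-Solver.solve-∀
    Cᵦ-eq : b ℕ.+ m ℕ.+ (w ℕ.+ w ℕ.+ c) ≡ m ℕ.+ m
    Cᵦ-eq = solution w b c m
      where
      solution : ∀ w b c m → b ℕ.+ m ℕ.+ (w ℕ.+ w ℕ.+ c) ≡ w ℕ.+ (w ℕ.+ b) ℕ.+ c ℕ.+ m
      solution = ℕ-Solver.solve-∀

    module U = JacobiTriple s s² m′ (w′ ℕ.+ b) (w′ ℕ.+ c) m-eq
    module W = JacobiTriple s s² m′ w′ (w′ ℕ.+ b ℕ.+ c) w-eq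
    module A = JacobiTriple (⊖ 𝟙) ⊖𝟙-square M′ (w′ ℕ.+ u) (c′ ℕ.+ m) A-eq
    module C = JacobiTriple (⊖ 𝟙) ⊖𝟙-square M′ (w′ ℕ.+ u ℕ.+ m) c′ C-eq
    module Aᵦ = JacobiTriple (⊖ 𝟙) ⊖𝟙-square M′ b′ (w′ ℕ.+ w ℕ.+ c ℕ.+ m) Aᵦ-eq
    module Cᵦ = JacobiTriple (⊖ 𝟙) ⊖𝟙-square M′ (b′ ℕ.+ m) (w′ ℕ.+ w ℕ.+ c) Cᵦ-eq

    positive-term : ∀ r′ t′ eq k →
      JacobiTriple.theta-term (⊖ 𝟙) ⊖𝟙-square M′ r′ t′ eq k ≈ q^ exponent (m ℕ.+ m) (suc r′) (suc t′) k
    positive-term r′ t′ eq k = ≈-trans (theta-term-closed (⊖ 𝟙) ⊖𝟙-square M′ r′ t′ eq k)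
      (≈-trans (⊛-congʳ _ (⊖⊖𝟙-^^ ℤ.∣ k ∣)) (⊛-identityˡ _))

    eᵤ eᵥ eA eC eAᵦ eCᵦ : ℤ → ℕ
    eᵤ = exponent m u (w ℕ.+ c)
    eᵥ = exponent m w (u ℕ.+ c)
    eA = exponent (m ℕ.+ m) a (c ℕ.+ m)
    eC = exponent (m ℕ.+ m) (a ℕ.+ m) c
    eAᵦ = exponent (m ℕ.+ m) b (w ℕ.+ w ℕ.+ c ℕ.+ m)
    eCᵦ = exponent (m ℕ.+ m) (b ℕ.+ m) (w ℕ.+ w ℕ.+ c)

    halve : ∀ {x y} → + 2 ℤ.* + x ≡ + 2 ℤ.* + y → x ≡ y
    halve {x} {y} e = ℤ.+-injective (ℤ.*-cancelˡ-≡ (+ 2) (+ x) (+ y) e)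

    -- The substitution k = i + j, l = i - j separates the quadratic form. The index i + j is
    -- written as l + 2j so that the signs of the two terms visibly have equal parity.
    even-exponent : ∀ i j → eᵤ (i ℤ.- j ℤ.+ (j ℤ.+ j)) ℕ.+ eᵥ (i ℤ.- j) ≡ eA i ℕ.+ eCᵦ j
    even-exponent i j = halve (begin
      + 2 ℤ.* (+ eᵤ l₂ ℤ.+ + eᵥ l) ≡⟨ ℤ.*-distribˡ-+ (+ 2) (+ eᵤ l₂) _ ⟩
      + 2 ℤ.* + eᵤ l₂ ℤ.+ + 2 ℤ.* + eᵥ l ≡⟨ cong₂ ℤ._+_ (+-double-exponent m-eq l₂) (+-double-exponent w-eq l) ⟩
      double-exponent (+ m) (+ u) l₂ ℤ.+ double-exponent (+ m) (+ w) l ≡⟨ algebra (+ m) (+ w) (+ b) i j ⟩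
      double-exponent (+ (m ℕ.+ m)) (+ a) i ℤ.+ double-exponent (+ (m ℕ.+ m)) (+ (b ℕ.+ m)) j
        ≡⟨ sym (cong₂ ℤ._+_ (+-double-exponent A-eq i) (+-double-exponent Cᵦ-eq j)) ⟩
      + 2 ℤ.* + eA i ℤ.+ + 2 ℤ.* + eCᵦ j ≡⟨ sym (ℤ.*-distribˡ-+ (+ 2) (+ eA i) _) ⟩
      + 2 ℤ.* (+ eA i ℤ.+ + eCᵦ j) ∎)
      where
      open ≡-Reasoning
      l l₂ : ℤ
      l = i ℤ.- j
      l₂ = l ℤ.+ (j ℤ.+ j)
      algebra : ∀ m w b i j →
        m ℤ.* ((i ℤ.- j ℤ.+ (j ℤ.+ j)) ℤ.* (i ℤ.- j ℤ.+ (j ℤ.+ j) ℤ.- + 1)) ℤ.+ + 2 ℤ.* ((w ℤ.+ b) ℤ.* (i ℤ.- j ℤ.+ (j ℤ.+ j)))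
          ℤ.+ (m ℤ.* ((i ℤ.- j) ℤ.* (i ℤ.- j ℤ.- + 1)) ℤ.+ + 2 ℤ.* (w ℤ.* (i ℤ.- j)))
        ≡ (m ℤ.+ m) ℤ.* (i ℤ.* (i ℤ.- + 1)) ℤ.+ + 2 ℤ.* ((w ℤ.+ (w ℤ.+ b)) ℤ.* i)
          ℤ.+ ((m ℤ.+ m) ℤ.* (j ℤ.* (j ℤ.- + 1)) ℤ.+ + 2 ℤ.* ((b ℤ.+ m) ℤ.* j))
      algebra = ℤ-Solver.solve-∀

    -- Now k = i + j + 1, l = i - j. The separated form has index j + 1 in its second factor and
    -- leaves the constant w over.
    odd-exponent : ∀ i j → eᵤ (ℤ.suc (i ℤ.- j ℤ.+ (j ℤ.+ j))) ℕ.+ eᵥ (i ℤ.- j) ≡ w ℕ.+ (eC i ℕ.+ eAᵦ (ℤ.suc j))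
    odd-exponent i j = halve (begin
      + 2 ℤ.* (+ eᵤ l₂ ℤ.+ + eᵥ l) ≡⟨ ℤ.*-distribˡ-+ (+ 2) (+ eᵤ l₂) _ ⟩
      + 2 ℤ.* + eᵤ l₂ ℤ.+ + 2 ℤ.* + eᵥ l ≡⟨ cong₂ ℤ._+_ (+-double-exponent m-eq l₂) (+-double-exponent w-eq l) ⟩
      double-exponent (+ m) (+ u) l₂ ℤ.+ double-exponent (+ m) (+ w) l ≡⟨ algebra (+ m) (+ w) (+ b) i j ⟩
      + 2 ℤ.* + w ℤ.+ (double-exponent (+ (m ℕ.+ m)) (+ (a ℕ.+ m)) i ℤ.+ double-exponent (+ (m ℕ.+ m)) (+ b) (ℤ.suc j))
        ≡⟨ cong (λ z → + 2 ℤ.* + w ℤ.+ z) (sym (cong₂ ℤ._+_ (+-double-exponent C-eq i) (+-double-exponent Aᵦ-eq (ℤ.suc j)))) ⟩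
      + 2 ℤ.* + w ℤ.+ (+ 2 ℤ.* + eC i ℤ.+ + 2 ℤ.* + eAᵦ (ℤ.suc j)) ≡⟨ collect (+ w) (+ eC i) (+ eAᵦ (ℤ.suc j)) ⟩
      + 2 ℤ.* (+ w ℤ.+ (+ eC i ℤ.+ + eAᵦ (ℤ.suc j))) ∎)
      where
      open ≡-Reasoning
      l l₂ : ℤ
      l = i ℤ.- j
      l₂ = ℤ.suc (l ℤ.+ (j ℤ.+ j))
      collect : ∀ x y z → + 2 ℤ.* x ℤ.+ (+ 2 ℤ.* y ℤ.+ + 2 ℤ.* z) ≡ + 2 ℤ.* (x ℤ.+ (y ℤ.+ z))
      collect = ℤ-Solver.solve-∀
      algebra : ∀ m w b i j →
        m ℤ.* ((+ 1 ℤ.+ (i ℤ.- j ℤ.+ (j ℤ.+ j))) ℤ.* (+ 1 ℤ.+ (i ℤ.- j ℤ.+ (j ℤ.+ j)) ℤ.- + 1))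
          ℤ.+ + 2 ℤ.* ((w ℤ.+ b) ℤ.* (+ 1 ℤ.+ (i ℤ.- j ℤ.+ (j ℤ.+ j))))
          ℤ.+ (m ℤ.* ((i ℤ.- j) ℤ.* (i ℤ.- j ℤ.- + 1)) ℤ.+ + 2 ℤ.* (w ℤ.* (i ℤ.- j)))
        ≡ + 2 ℤ.* w ℤ.+ ((m ℤ.+ m) ℤ.* (i ℤ.* (i ℤ.- + 1)) ℤ.+ + 2 ℤ.* ((w ℤ.+ (w ℤ.+ b) ℤ.+ m) ℤ.* i)
          ℤ.+ ((m ℤ.+ m) ℤ.* ((+ 1 ℤ.+ j) ℤ.* (+ 1 ℤ.+ j ℤ.- + 1)) ℤ.+ + 2 ℤ.* (b ℤ.* (+ 1 ℤ.+ j))))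
      algebra = ℤ-Solver.solve-∀

    σ² : ⊖ s ⊛ ⊖ s ≈ 𝟙
    σ² = ≈-trans (solve 1 (λ s → :- s :* :- s := s :* s) ≈-refl s) s²

    U-closed : ∀ k → U.theta-term k ≈ (⊖ s) ^^ ℤ.∣ k ∣ ⊛ q^ eᵤ k
    U-closed = theta-term-closed s s² m′ (w′ ℕ.+ b) (w′ ℕ.+ c) m-eq

    W-closed : ∀ k → W.theta-term k ≈ (⊖ s) ^^ ℤ.∣ k ∣ ⊛ q^ eᵥ k
    W-closed = theta-term-closed s s² m′ w′ (w′ ℕ.+ b ℕ.+ c) w-eq

    even-term : ∀ i j → U.theta-term (i ℤ.- j ℤ.+ (j ℤ.+ j)) ⊛ W.theta-term (i ℤ.- j)
      ≈ A.theta-term i ⊛ Cᵦ.theta-term j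
    even-term i j = begin
      U.theta-term l₂ ⊛ W.theta-term l ≈⟨ ⊛-cong (U-closed l₂) (W-closed l) ⟩
      ((⊖ s) ^^ ℤ.∣ l₂ ∣ ⊛ q^ eᵤ l₂) ⊛ ((⊖ s) ^^ ℤ.∣ l ∣ ⊛ q^ eᵥ l)
        ≈⟨ solve 4 (λ x y z t → (x :* y) :* (z :* t) := (x :* z) :* (y :* t)) ≈-refl _ _ _ _ ⟩
      ((⊖ s) ^^ ℤ.∣ l₂ ∣ ⊛ (⊖ s) ^^ ℤ.∣ l ∣) ⊛ (q^ eᵤ l₂ ⊛ q^ eᵥ l)
        ≈⟨ ⊛-cong (≈-trans (⊛-congʳ _ (^^-+double (⊖ s) σ² l j)) (^^-square (⊖ s) σ² ℤ.∣ l ∣))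
             (≈-trans (≈-sym (q^-+ (eᵤ l₂) (eᵥ l))) (≈-trans (≡⇒≈ (cong q^_ (even-exponent i j))) (q^-+ (eA i) (eCᵦ j)))) ⟩
      𝟙 ⊛ (q^ eA i ⊛ q^ eCᵦ j) ≈⟨ ⊛-identityˡ _ ⟩
      q^ eA i ⊛ q^ eCᵦ j ≈⟨ ≈-sym (⊛-cong (positive-term _ _ A-eq i) (positive-term _ _ Cᵦ-eq j)) ⟩
      A.theta-term i ⊛ Cᵦ.theta-term j ∎
      where
      open SetoidReasoning ≈-setoid
      l l₂ : ℤ
      l = i ℤ.- j
      l₂ = l ℤ.+ (j ℤ.+ j)

    odd-term : ∀ i j → U.theta-term (ℤ.suc (i ℤ.- j ℤ.+ (j ℤ.+ j))) ⊛ W.theta-term (i ℤ.- j)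
      ≈ (⊖ s ⊛ q^ w) ⊛ (C.theta-term i ⊛ Aᵦ.theta-term (ℤ.suc j))
    odd-term i j = begin
      U.theta-term l₂ ⊛ W.theta-term l ≈⟨ ⊛-cong (U-closed l₂) (W-closed l) ⟩
      ((⊖ s) ^^ ℤ.∣ l₂ ∣ ⊛ q^ eᵤ l₂) ⊛ ((⊖ s) ^^ ℤ.∣ l ∣ ⊛ q^ eᵥ l)
        ≈⟨ solve 4 (λ x y z t → (x :* y) :* (z :* t) := (x :* z) :* (y :* t)) ≈-refl _ _ _ _ ⟩
      ((⊖ s) ^^ ℤ.∣ l₂ ∣ ⊛ (⊖ s) ^^ ℤ.∣ l ∣) ⊛ (q^ eᵤ l₂ ⊛ q^ eᵥ l)
        ≈⟨ ⊛-cong sign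
             (≈-trans (≈-sym (q^-+ (eᵤ l₂) (eᵥ l))) (≈-trans (≡⇒≈ (cong q^_ (odd-exponent i j)))
               (≈-trans (q^-+ w _) (⊛-congˡ _ (q^-+ (eC i) (eAᵦ (ℤ.suc j))))))) ⟩
      ⊖ s ⊛ (q^ w ⊛ (q^ eC i ⊛ q^ eAᵦ (ℤ.suc j))) ≈⟨ ≈-sym (⊛-assoc (⊖ s) (q^ w) _) ⟩
      (⊖ s ⊛ q^ w) ⊛ (q^ eC i ⊛ q^ eAᵦ (ℤ.suc j))
        ≈⟨ ⊛-congˡ _ (≈-sym (⊛-cong (positive-term _ _ C-eq i) (positive-term _ _ Aᵦ-eq (ℤ.suc j)))) ⟩
      (⊖ s ⊛ q^ w) ⊛ (C.theta-term i ⊛ Aᵦ.theta-term (ℤ.suc j)) ∎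
      where
      open SetoidReasoning ≈-setoid
      l l₂ : ℤ
      l = i ℤ.- j
      l₂ = ℤ.suc (l ℤ.+ (j ℤ.+ j))
      sign : (⊖ s) ^^ ℤ.∣ l₂ ∣ ⊛ (⊖ s) ^^ ℤ.∣ l ∣ ≈ ⊖ s
      sign = ≈-trans (⊛-congʳ _ (≈-trans (^^-suc (⊖ s) σ² (l ℤ.+ (j ℤ.+ j))) (⊛-congʳ _ (^^-+double (⊖ s) σ² l j))))
        (≈-trans (solve 2 (λ p s → (p :* s) :* p := (p :* p) :* s) ≈-refl ((⊖ s) ^^ ℤ.∣ l ∣) (⊖ s))
          (≈-trans (⊛-congʳ _ (^^-square (⊖ s) σ² ℤ.∣ l ∣)) (⊛-identityˡ _)))

  -- The double series on the left is summed along the lines k − l = const; even and odd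
  -- differences k − l = 2j, 2j + 1 give the two products on the right.
  thetaSum-⊛-thetaSum :
    thetaSum s m u (w ℕ.+ c) ⊛ thetaSum s m w (u ℕ.+ c)
    ≈ thetaSum (⊖ 𝟙) (m ℕ.+ m) a (c ℕ.+ m) ⊛ thetaSum (⊖ 𝟙) (m ℕ.+ m) (b ℕ.+ m) (w ℕ.+ w ℕ.+ c)
      ⊕ (⊖ s ⊛ q^ w) ⊛ (thetaSum (⊖ 𝟙) (m ℕ.+ m) (a ℕ.+ m) c ⊛ thetaSum (⊖ 𝟙) (m ℕ.+ m) b (w ℕ.+ w ℕ.+ c ℕ.+ m))
  thetaSum-⊛-thetaSum = ≈[]⇒≈ modulo
    where
    modulo : ∀ n → _ ≈[ n ] _
    modulo n = begin
      U.bilateral ⊛ W.bilateral ≈⟨ ⊛-cong[] (triple U.theta-term U.triple-product[]) (triple W.theta-term W.triple-product[]) ⟩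
      window N 2N U.theta-term ⊛ window N 2N W.theta-term ≈⟨ ≈⇒≈[] (∑-⊛ˡ 2N _ _) ⟩
      ∑ 2N (λ i → window N 2N U.theta-term ⊛ W.theta-term (i ℤ.⊖ N)) ≈⟨ ∑-cong[] 2N widen ⟩
      -- For l = i - N the window of k starts at i - 3N, so the inner index d is k - l + 2N for
      -- every i; summing over i with d fixed then runs along a line k - l = const.
      ∑ 2N (λ i → window (N+2N ∸ i) 4N U.theta-term ⊛ W.theta-term (i ℤ.⊖ N)) ≈⟨ ≈⇒≈[] (∑-cong 2N λ i → ∑-⊛ʳ 4N _ _) ⟩
      ∑ 2N (λ i → ∑ 4N (F i)) ≈⟨ ≈⇒≈[] (∑-swap 2N 4N F) ⟩
      ∑ 4N (λ d → ∑ 2N (λ i → F i d)) ≈⟨ ≈⇒≈[] (∑-pairs 2N _) ⟩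
      ∑ 2N (λ j → ∑ 2N (λ i → F i (j ℕ.* 2)) ⊕ ∑ 2N (λ i → F i (suc (j ℕ.* 2))))
        ≈⟨ ∑-cong[] 2N (λ j j<2N → ⊕-cong[] (even-row j j<2N) (odd-row j j<2N)) ⟩
      ∑ 2N (λ j → window 2N 4N A.theta-term ⊛ Cᵦ.theta-term (j ℤ.⊖ N)
                ⊕ ((⊖ s ⊛ q^ w) ⊛ window 2N 4N C.theta-term) ⊛ Aᵦ.theta-term (j ℤ.⊖ n))
        ≈⟨ ≈⇒≈[] (≈-trans (∑-⊕ 2N _ _) (⊕-cong (≈-sym (∑-⊛ˡ 2N _ _)) (≈-sym (∑-⊛ˡ 2N _ _)))) ⟩
      window 2N 4N A.theta-term ⊛ window N 2N Cᵦ.theta-term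
        ⊕ ((⊖ s ⊛ q^ w) ⊛ window 2N 4N C.theta-term) ⊛ window n 2N Aᵦ.theta-term
        ≈⟨ ⊕-cong[] (⊛-cong[] (wide A.triple-product[] A.theta-term-small) (≈[]-sym (triple Cᵦ.theta-term Cᵦ.triple-product[])))
             (⊛-cong[] (⊛-cong[] {f = ⊖ s ⊛ q^ w} ≈[]-refl (wide C.triple-product[] C.theta-term-small)) narrow) ⟩
      A.bilateral ⊛ Cᵦ.bilateral ⊕ ((⊖ s ⊛ q^ w) ⊛ C.bilateral) ⊛ Aᵦ.bilateral
        ≈⟨ ≈⇒≈[] (⊕-cong ≈-refl (⊛-assoc (⊖ s ⊛ q^ w) _ _)) ⟩
      A.bilateral ⊛ Cᵦ.bilateral ⊕ (⊖ s ⊛ q^ w) ⊛ (C.bilateral ⊛ Aᵦ.bilateral) ∎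
      where
      open SetoidReasoning (≈[]-setoid n)
      N 2N 4N N+2N : ℕ
      -- One more than the precision: in the odd rows the index is shifted to j + 1, so their window
      -- starts at -n and must still cover -n, ..., n - 1.
      N = suc n
      2N = N ℕ.+ N
      4N = 2N ℕ.* 2
      N+2N = N ℕ.+ 2N
      n≤N : n ≤ N
      n≤N = ℕ.n≤1+n n
      N≤2N : N ≤ 2N
      N≤2N = ℕ.m≤m+n N N
      4N-eq : 4N ≡ 2N ℕ.+ 2N
      4N-eq = trans (ℕ.*-comm 2N 2) (cong (2N ℕ.+_) (ℕ.+-identityʳ 2N))
      F : ℕ → ℕ → Series
      F i d = U.theta-term (d ℤ.⊖ (N+2N ∸ i)) ⊛ W.theta-term (i ℤ.⊖ N)
      triple : ∀ {f} g → (∀ N → f ≈[ N ] window N (N ℕ.+ N) g) → f ≈[ n ] window N 2N g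
      triple g p = ≈[]-weaken n≤N (p N)
      wide : ∀ {f g} → (∀ N → f ≈[ N ] window N (N ℕ.+ N) g) → (∀ {n} k → n ≤ ℤ.∣ k ∣ → g k ≈[ n ] 𝟘) →
        window 2N 4N g ≈[ n ] f
      wide p small = ≈[]-trans (window-stable small (ℕ.≤-trans n≤N N≤2N)
        (ℕ.≤-trans (ℕ.+-monoʳ-≤ 2N (ℕ.≤-trans n≤N N≤2N)) (ℕ.≤-reflexive (sym 4N-eq)))) (≈[]-sym (p n))
      narrow : window n 2N Aᵦ.theta-term ≈[ n ] Aᵦ.bilateral
      narrow = ≈[]-trans (window-stable Aᵦ.theta-term-small ℕ.≤-refl (ℕ.+-mono-≤ n≤N n≤N)) (≈[]-sym (Aᵦ.triple-product[] n))
      widen : ∀ i → i < 2N → window N 2N U.theta-term ⊛ W.theta-term (i ℤ.⊖ N)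
        ≈[ n ] window (N+2N ∸ i) 4N U.theta-term ⊛ W.theta-term (i ℤ.⊖ N)
      widen i i<2N = ⊛-cong[] (≈[]-trans (window-stable U.theta-term-small n≤N (ℕ.+-monoʳ-≤ N n≤N))
        (≈[]-sym (window-stable U.theta-term-small
          (ℕ.≤-trans n≤N (ℕ.≤-trans (ℕ.≤-reflexive (sym (ℕ.m+n∸n≡m N 2N))) (ℕ.∸-monoʳ-≤ N+2N (ℕ.<⇒≤ i<2N))))
          (ℕ.≤-trans (ℕ.+-mono-≤ (ℕ.m∸n≤m N+2N i) n≤N) (ℕ.≤-reflexive (regroup N)))))) ≈[]-refl
        where
        regroup : ∀ N → N ℕ.+ (N ℕ.+ N) ℕ.+ N ≡ (N ℕ.+ N) ℕ.* 2
        regroup = ℕ-Solver.solve-∀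
      i≤3N : ∀ {i} → i < 2N → i ≤ N+2N
      i≤3N i<2N = ℕ.≤-trans (ℕ.<⇒≤ i<2N) (ℕ.m≤n+m 2N N)
      even-index : ∀ i j → i < 2N → (j ℕ.* 2) ℤ.⊖ (N+2N ∸ i) ≡ (i ℤ.⊖ N) ℤ.+ ((j ℤ.⊖ N) ℤ.+ (j ℤ.⊖ N))
      even-index i j i<2N = trans (⊖-∸-index i (j ℕ.* 2) N+2N (i≤3N i<2N))
        (trans (cong (λ z → (+ i ℤ.+ z) ℤ.- + N+2N) (ℤ.pos-* j 2))
          (trans (algebra (+ i) (+ j) (+ N))
            (cong₂ (λ x y → x ℤ.+ (y ℤ.+ y)) (ℤ.m-n≡m⊖n i N) (ℤ.m-n≡m⊖n j N))))
        where
        algebra : ∀ i j N → i ℤ.+ j ℤ.* + 2 ℤ.- (N ℤ.+ (N ℤ.+ N)) ≡ i ℤ.- N ℤ.+ ((j ℤ.- N) ℤ.+ (j ℤ.- N))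
        algebra = ℤ-Solver.solve-∀
      odd-index : ∀ i j → i < 2N → suc (j ℕ.* 2) ℤ.⊖ (N+2N ∸ i) ≡ ℤ.suc ((i ℤ.⊖ N) ℤ.+ ((j ℤ.⊖ N) ℤ.+ (j ℤ.⊖ N)))
      odd-index i j i<2N = trans (⊖-∸-index i (suc (j ℕ.* 2)) N+2N (i≤3N i<2N))
        (trans (algebra (+ i) (+ (j ℕ.* 2)) (+ N+2N))
          (cong ℤ.suc (trans (sym (⊖-∸-index i (j ℕ.* 2) N+2N (i≤3N i<2N))) (even-index i j i<2N))))
        where
        algebra : ∀ i j N → i ℤ.+ (+ 1 ℤ.+ j) ℤ.- N ≡ + 1 ℤ.+ (i ℤ.+ j ℤ.- N)
        algebra = ℤ-Solver.solve-∀
      -- Replaces the summation index l by i - j. This moves the window by an amount depending on j,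
      -- which a window of length 4N tolerates modulo qⁿ.
      recentre : ∀ (g : ℤ → Series) j → j < 2N → (∀ k → n ≤ ℤ.∣ k ∣ → g k ≈[ n ] 𝟘) →
        window N 2N g ≈[ n ] ∑ 4N (λ i → g ((i ℤ.⊖ 2N) ℤ.- (j ℤ.⊖ N)))
      recentre g j j<2N small = ≈[]-trans (window-stable small n≤N (ℕ.+-monoʳ-≤ N n≤N))
        (≈[]-trans (≈[]-sym (window-stable small (ℕ.≤-trans n≤N (ℕ.m≤m+n N j))
          (ℕ.≤-trans (ℕ.+-mono-≤ (ℕ.+-monoʳ-≤ N (ℕ.<⇒≤ j<2N)) n≤N) (ℕ.≤-reflexive (regroup N)))))
          (≈⇒≈[] (∑-cong 4N λ i → ≡⇒≈ (cong g (index i)))))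
        where
        regroup : ∀ N → N ℕ.+ (N ℕ.+ N) ℕ.+ N ≡ (N ℕ.+ N) ℕ.* 2
        regroup = ℕ-Solver.solve-∀
        algebra : ∀ i j N → i ℤ.- (N ℤ.+ j) ≡ i ℤ.- (N ℤ.+ N) ℤ.- (j ℤ.- N)
        algebra = ℤ-Solver.solve-∀
        index : ∀ i → i ℤ.⊖ (N ℕ.+ j) ≡ (i ℤ.⊖ 2N) ℤ.- (j ℤ.⊖ N)
        index i = trans (sym (ℤ.m-n≡m⊖n i (N ℕ.+ j))) (trans (algebra (+ i) (+ j) (+ N))
          (cong₂ ℤ._-_ (ℤ.m-n≡m⊖n i 2N) (ℤ.m-n≡m⊖n j N)))
      W-small : ∀ f k → n ≤ ℤ.∣ k ∣ → f ⊛ W.theta-term k ≈[ n ] 𝟘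
      W-small f k n≤k = ≈[]-trans (⊛-cong[] {f = f} ≈[]-refl (W.theta-term-small k n≤k)) (≈⇒≈[] (⊛-zeroʳ f))
      even-row : ∀ j → j < 2N → ∑ 2N (λ i → F i (j ℕ.* 2)) ≈[ n ] window 2N 4N A.theta-term ⊛ Cᵦ.theta-term (j ℤ.⊖ N)
      even-row j j<2N = begin
        ∑ 2N (λ i → F i (j ℕ.* 2))
          ≈⟨ ∑-cong[] 2N (λ i i<2N → ≈⇒≈[] (⊛-congʳ _ (≡⇒≈ (cong U.theta-term (even-index i j i<2N))))) ⟩
        window N 2N (λ l → U.theta-term (l ℤ.+ ((j ℤ.⊖ N) ℤ.+ (j ℤ.⊖ N))) ⊛ W.theta-term l)
          ≈⟨ recentre _ j j<2N (λ k → W-small (U.theta-term (k ℤ.+ ((j ℤ.⊖ N) ℤ.+ (j ℤ.⊖ N)))) k) ⟩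
        ∑ 4N (λ i → U.theta-term ((i ℤ.⊖ 2N) ℤ.- (j ℤ.⊖ N) ℤ.+ ((j ℤ.⊖ N) ℤ.+ (j ℤ.⊖ N))) ⊛ W.theta-term ((i ℤ.⊖ 2N) ℤ.- (j ℤ.⊖ N)))
          ≈⟨ ≈⇒≈[] (∑-cong 4N λ i → even-term (i ℤ.⊖ 2N) (j ℤ.⊖ N)) ⟩
        ∑ 4N (λ i → A.theta-term (i ℤ.⊖ 2N) ⊛ Cᵦ.theta-term (j ℤ.⊖ N)) ≈⟨ ≈⇒≈[] (≈-sym (∑-⊛ʳ 4N _ _)) ⟩
        window 2N 4N A.theta-term ⊛ Cᵦ.theta-term (j ℤ.⊖ N) ∎
      odd-row : ∀ j → j < 2N → ∑ 2N (λ i → F i (suc (j ℕ.* 2)))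
        ≈[ n ] ((⊖ s ⊛ q^ w) ⊛ window 2N 4N C.theta-term) ⊛ Aᵦ.theta-term (j ℤ.⊖ n)
      odd-row j j<2N = begin
        ∑ 2N (λ i → F i (suc (j ℕ.* 2)))
          ≈⟨ ∑-cong[] 2N (λ i i<2N → ≈⇒≈[] (⊛-congʳ _ (≡⇒≈ (cong U.theta-term (odd-index i j i<2N))))) ⟩
        window N 2N (λ l → U.theta-term (ℤ.suc (l ℤ.+ ((j ℤ.⊖ N) ℤ.+ (j ℤ.⊖ N)))) ⊛ W.theta-term l)
          ≈⟨ recentre _ j j<2N (λ k → W-small (U.theta-term (ℤ.suc (k ℤ.+ ((j ℤ.⊖ N) ℤ.+ (j ℤ.⊖ N))))) k) ⟩
        ∑ 4N (λ i → U.theta-term (ℤ.suc ((i ℤ.⊖ 2N) ℤ.- (j ℤ.⊖ N) ℤ.+ ((j ℤ.⊖ N) ℤ.+ (j ℤ.⊖ N)))) ⊛ W.theta-term ((i ℤ.⊖ 2N) ℤ.- (j ℤ.⊖ N)))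
          ≈⟨ ≈⇒≈[] (∑-cong 4N λ i → ≈-trans (odd-term (i ℤ.⊖ 2N) (j ℤ.⊖ N))
               (≈-trans (≈-sym (⊛-assoc (⊖ s ⊛ q^ w) _ _))
                 (⊛-congˡ _ (≡⇒≈ (cong Aᵦ.theta-term (suc-index j)))))) ⟩
        ∑ 4N (λ i → ((⊖ s ⊛ q^ w) ⊛ C.theta-term (i ℤ.⊖ 2N)) ⊛ Aᵦ.theta-term (j ℤ.⊖ n)) ≈⟨ ≈⇒≈[] (≈-sym (∑-⊛ʳ 4N _ _)) ⟩
        ∑ 4N (λ i → (⊖ s ⊛ q^ w) ⊛ C.theta-term (i ℤ.⊖ 2N)) ⊛ Aᵦ.theta-term (j ℤ.⊖ n)
          ≈⟨ ≈⇒≈[] (⊛-congʳ _ (≈-sym (∑-⊛ˡ 4N _ _))) ⟩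
        ((⊖ s ⊛ q^ w) ⊛ window 2N 4N C.theta-term) ⊛ Aᵦ.theta-term (j ℤ.⊖ n) ∎
        where
        suc-index : ∀ j → ℤ.suc (j ℤ.⊖ N) ≡ (j ℤ.⊖ n)
        suc-index j = trans (cong ℤ.suc (sym (ℤ.m-n≡m⊖n j N))) (trans (algebra (+ j) (+ n)) (ℤ.m-n≡m⊖n j n))
          where
          algebra : ∀ j n → + 1 ℤ.+ (j ℤ.- (+ 1 ℤ.+ n)) ≡ j ℤ.- n
          algebra = ℤ-Solver.solve-∀

-- The Weierstrass relation

sgn : Sign → Series
sgn Sign.+ = 𝟙
sgn Sign.- = ⊖ 𝟙

sgn-* : ∀ s t → sgn (s Sign.* t) ≈ sgn s ⊛ sgn t
sgn-* Sign.+ t = ≈-sym (⊛-identityˡ (sgn t))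
sgn-* Sign.- Sign.+ = ≈-sym (⊛-identityʳ (⊖ 𝟙))
sgn-* Sign.- Sign.- = ≈-sym ⊖𝟙-square

sgn-square : ∀ s → sgn s ⊛ sgn s ≈ 𝟙
sgn-square Sign.+ = ⊛-identityˡ 𝟙
sgn-square Sign.- = ⊖𝟙-square

theta : Sign → ℕ → ℕ → Series
theta s m r = poch (sgn s) m r ⊛ poch (sgn s) m (m ∸ r)

-- With s = -1 all signs cancel: these are ∑ q^(m k(k-1) + a k) and ∑ q^(m k² + a k), the functions
-- A and C.
evenTheta oddTheta : ℕ → ℕ → Series
evenTheta m a = thetaSum (⊖ 𝟙) (m ℕ.+ m) a (m ℕ.+ m ∸ a)
oddTheta m a = thetaSum (⊖ 𝟙) (m ℕ.+ m) (a ℕ.+ m) (m ∸ a)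

-- `ThetaProduct` with its negative term moved to the left. `theta` lacks the product (qᵐ; qᵐ)∞
-- contained in `thetaSum`, hence the two extra factors.
theta-⊛-theta : ∀ s m w b → 1 ≤ w → 1 ≤ b → w ℕ.+ (w ℕ.+ b) < m →
  (poch 𝟙 m m ⊛ poch 𝟙 m m) ⊛ (theta s m (w ℕ.+ b) ⊛ theta s m w)
  ⊕ (sgn s ⊛ q^ w) ⊛ (oddTheta m (w ℕ.+ (w ℕ.+ b)) ⊛ evenTheta m b)
  ≈ evenTheta m (w ℕ.+ (w ℕ.+ b)) ⊛ oddTheta m b
theta-⊛-theta s m w@(suc w′) b@(suc b′) _ _ a<m = subst
  (λ m → (poch 𝟙 m m ⊛ poch 𝟙 m m) ⊛ (theta s m u ⊛ theta s m w) ⊕ (sgn s ⊛ q^ w) ⊛ (oddTheta m a ⊛ evenTheta m b)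
         ≈ evenTheta m a ⊛ oddTheta m b)
  (trans (ℕ.+-suc a (m ∸ suc a)) (ℕ.m+[n∸m]≡n a<m))
  (begin
    (E ⊛ E) ⊛ (theta s M u ⊛ theta s M w) ⊕ (sgn s ⊛ q^ w) ⊛ (oddTheta M a ⊛ evenTheta M b)
      ≈⟨ ⊕-cong (solve 3 (λ e x y → (e :* e) :* (x :* y) := (e :* x) :* (e :* y)) ≈-refl E (theta s M u) (theta s M w)) ≈-refl ⟩
    thetaSum (sgn s) M u (M ∸ u) ⊛ thetaSum (sgn s) M w (M ∸ w) ⊕ (sgn s ⊛ q^ w) ⊛ (oddTheta M a ⊛ evenTheta M b)
      ≈⟨ ⊕-cong (≡⇒≈ (cong₂ (λ x y → thetaSum (sgn s) M u x ⊛ thetaSum (sgn s) M w y) u-eq w-eq))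
           (⊛-congˡ _ (≡⇒≈ (cong₂ (λ x y → thetaSum (⊖ 𝟙) (M ℕ.+ M) (a ℕ.+ M) x ⊛ thetaSum (⊖ 𝟙) (M ℕ.+ M) b y) a-eq b-eq))) ⟩
    thetaSum (sgn s) M u (w ℕ.+ c) ⊛ thetaSum (sgn s) M w (u ℕ.+ c)
      ⊕ (sgn s ⊛ q^ w) ⊛ (thetaSum (⊖ 𝟙) (M ℕ.+ M) (a ℕ.+ M) c ⊛ thetaSum (⊖ 𝟙) (M ℕ.+ M) b (w ℕ.+ w ℕ.+ c ℕ.+ M))
      ≈⟨ ⊕-cong (ThetaProduct.thetaSum-⊛-thetaSum (sgn s) (sgn-square s) w′ b′ (m ∸ suc a)) ≈-refl ⟩
    (thetaSum (⊖ 𝟙) (M ℕ.+ M) a (c ℕ.+ M) ⊛ thetaSum (⊖ 𝟙) (M ℕ.+ M) (b ℕ.+ M) (w ℕ.+ w ℕ.+ c)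
      ⊕ (⊖ sgn s ⊛ q^ w) ⊛ (thetaSum (⊖ 𝟙) (M ℕ.+ M) (a ℕ.+ M) c ⊛ thetaSum (⊖ 𝟙) (M ℕ.+ M) b (w ℕ.+ w ℕ.+ c ℕ.+ M)))
      ⊕ (sgn s ⊛ q^ w) ⊛ (thetaSum (⊖ 𝟙) (M ℕ.+ M) (a ℕ.+ M) c ⊛ thetaSum (⊖ 𝟙) (M ℕ.+ M) b (w ℕ.+ w ℕ.+ c ℕ.+ M))
      ≈⟨ solve 4 (λ x s q y → (x :+ (:- s :* q) :* y) :+ (s :* q) :* y := x) ≈-refl _ (sgn s) (q^ w) _ ⟩
    thetaSum (⊖ 𝟙) (M ℕ.+ M) a (c ℕ.+ M) ⊛ thetaSum (⊖ 𝟙) (M ℕ.+ M) (b ℕ.+ M) (w ℕ.+ w ℕ.+ c)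
      ≈⟨ ≡⇒≈ (cong₂ (λ x y → thetaSum (⊖ 𝟙) (M ℕ.+ M) a x ⊛ thetaSum (⊖ 𝟙) (M ℕ.+ M) (b ℕ.+ M) y) (sym A-eq) (sym Cᵦ-eq)) ⟩
    evenTheta M a ⊛ oddTheta M b ∎)
  where
  open SetoidReasoning ≈-setoid
  c u a M : ℕ
  c = suc (m ∸ suc a)
  u = w ℕ.+ b
  a = w ℕ.+ u
  M = a ℕ.+ c
  E : Series
  E = poch 𝟙 M M
  difference : ∀ {k l n} → n ≡ k ℕ.+ l → n ∸ k ≡ l
  difference {k} {l} e = trans (cong (_∸ k) e) (ℕ.m+n∸m≡n k l)
  u-eq : M ∸ u ≡ w ℕ.+ c
  u-eq = difference {u} (solution w u c)
    where
    solution : ∀ w u c → w ℕ.+ u ℕ.+ c ≡ u ℕ.+ (w ℕ.+ c)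
    solution = ℕ-Solver.solve-∀
  w-eq : M ∸ w ≡ u ℕ.+ c
  w-eq = difference {w} (ℕ.+-assoc w u c)
  a-eq : M ∸ a ≡ c
  a-eq = difference {a} refl
  A-eq : M ℕ.+ M ∸ a ≡ c ℕ.+ M
  A-eq = difference {a} (ℕ.+-assoc a c M)
  b-eq : M ℕ.+ M ∸ b ≡ w ℕ.+ w ℕ.+ c ℕ.+ M
  b-eq = difference {b} (solution w b c M)
    where
    solution : ∀ w b c M → w ℕ.+ (w ℕ.+ b) ℕ.+ c ℕ.+ M ≡ b ℕ.+ (w ℕ.+ w ℕ.+ c ℕ.+ M)
    solution = ℕ-Solver.solve-∀
  Cᵦ-eq : M ∸ b ≡ w ℕ.+ w ℕ.+ c
  Cᵦ-eq = difference {b} (solution w b c)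
    where
    solution : ∀ w b c → w ℕ.+ (w ℕ.+ b) ℕ.+ c ≡ b ℕ.+ (w ℕ.+ w ℕ.+ c)
    solution = ℕ-Solver.solve-∀

theta-pair : Sign → ℕ → ℕ → ℕ → Series
theta-pair s m w b = theta s m (w ℕ.+ b) ⊛ theta s m w

-- Each θ-pair is a 2 × 2 minor of the matrix with columns (evenTheta m aᵢ, ± q^(aᵢ/2) oddTheta m aᵢ),
-- so this is the Plücker relation between the minors of four columns.
weierstrass : ∀ m x y z d s₁ s₂ s₃ → 1 ≤ x → 1 ≤ y → 1 ≤ z → 1 ≤ d →
  x ℕ.+ (x ℕ.+ (y ℕ.+ (y ℕ.+ (z ℕ.+ (z ℕ.+ d))))) < m →
  theta-pair (s₁ Sign.* s₂) m (x ℕ.+ y) (z ℕ.+ (z ℕ.+ d)) ⊛ theta-pair (s₂ Sign.* s₃) m (y ℕ.+ z) d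
  ≈ theta-pair (s₁ Sign.* s₂ Sign.* s₃) m (x ℕ.+ y ℕ.+ z) d ⊛ theta-pair s₂ m y (z ℕ.+ (z ℕ.+ d))
    ⊕ (sgn s₂ ⊛ q^ y) ⊛ (theta-pair s₁ m x (y ℕ.+ (y ℕ.+ (z ℕ.+ (z ℕ.+ d)))) ⊛ theta-pair s₃ m z d)
-- Each θ-pair needs the square of (qᵐ; qᵐ)∞ to become a minor, so a product of two pairs needs this
-- square twice.
weierstrass m x y z d s₁ s₂ s₃ 1≤x 1≤y 1≤z 1≤d a<m = unit-cancel {E ⊛ E} refl (unit-cancel {E ⊛ E} refl (begin
  (E ⊛ E) ⊛ ((E ⊛ E) ⊛ (ac ⊛ bd))
    ≈⟨ solve 3 (λ e x y → e :* (e :* (x :* y)) := (e :* x) :* (e :* y)) ≈-refl (E ⊛ E) ac bd ⟩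
  ((E ⊛ E) ⊛ ac) ⊛ ((E ⊛ E) ⊛ bd) ≈⟨ ⊛-cong ac-minor bd-minor ⟩
  (Aa ⊛ Cc ⊕ ⊖ ((e₁ ⊛ e₂) ⊛ (Ca ⊛ Ac))) ⊛ (Ab ⊛ Cd ⊕ ⊖ ((e₂ ⊛ e₃) ⊛ (Cb ⊛ Ad)))
    ≈⟨ plücker ⟩
  (Aa ⊛ Cd ⊕ ⊖ ((e₁ ⊛ e₂ ⊛ e₃) ⊛ (Ca ⊛ Ad))) ⊛ (Ab ⊛ Cc ⊕ ⊖ (e₂ ⊛ (Cb ⊛ Ac)))
    ⊕ e₂ ⊛ ((Aa ⊛ Cb ⊕ ⊖ (e₁ ⊛ (Ca ⊛ Ab))) ⊛ (Ac ⊛ Cd ⊕ ⊖ (e₃ ⊛ (Cc ⊛ Ad))))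
    ≈⟨ ≈-sym (⊕-cong (⊛-cong ad-minor bc-minor) (⊛-congˡ e₂ (⊛-cong ab-minor cd-minor))) ⟩
  ((E ⊛ E) ⊛ ad) ⊛ ((E ⊛ E) ⊛ bc) ⊕ e₂ ⊛ (((E ⊛ E) ⊛ ab) ⊛ ((E ⊛ E) ⊛ cd))
    ≈⟨ solve 6 (λ e x y z t s → (e :* x) :* (e :* y) :+ s :* ((e :* z) :* (e :* t)) := e :* (e :* (x :* y :+ s :* (z :* t))))
       ≈-refl (E ⊛ E) ad bc ab cd e₂ ⟩
  (E ⊛ E) ⊛ ((E ⊛ E) ⊛ (ad ⊛ bc ⊕ e₂ ⊛ (ab ⊛ cd))) ∎))
  where
  open SetoidReasoning ≈-setoid
  a b c : ℕ
  c = z ℕ.+ (z ℕ.+ d)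
  b = y ℕ.+ (y ℕ.+ c)
  a = x ℕ.+ (x ℕ.+ b)
  E e₁ e₂ e₃ Aa Ab Ac Ad Ca Cb Cc Cd ab ac ad bc bd cd : Series
  E = poch 𝟙 m m
  e₁ = sgn s₁ ⊛ q^ x
  e₂ = sgn s₂ ⊛ q^ y
  e₃ = sgn s₃ ⊛ q^ z
  Aa = evenTheta m a
  Ab = evenTheta m b
  Ac = evenTheta m c
  Ad = evenTheta m d
  Ca = oddTheta m a
  Cb = oddTheta m b
  Cc = oddTheta m c
  Cd = oddTheta m d
  ab = theta-pair s₁ m x b
  cd = theta-pair s₃ m z d
  bc = theta-pair s₂ m y c
  ac = theta-pair (s₁ Sign.* s₂) m (x ℕ.+ y) c
  bd = theta-pair (s₂ Sign.* s₃) m (y ℕ.+ z) d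
  ad = theta-pair (s₁ Sign.* s₂ Sign.* s₃) m (x ℕ.+ y ℕ.+ z) d
  b≤a : b ≤ a
  b≤a = ℕ.≤-trans (ℕ.m≤n+m b x) (ℕ.m≤n+m _ x)
  c≤b : c ≤ b
  c≤b = ℕ.≤-trans (ℕ.m≤n+m c y) (ℕ.m≤n+m _ y)
  minor : ∀ s w b {a e} → 1 ≤ w → 1 ≤ b → w ℕ.+ (w ℕ.+ b) ≡ a → a < m → sgn s ⊛ q^ w ≈ e →
    (E ⊛ E) ⊛ theta-pair s m w b ≈ evenTheta m a ⊛ oddTheta m b ⊕ ⊖ (e ⊛ (oddTheta m a ⊛ evenTheta m b))
  minor s w b {a} {e} 1≤w 1≤b refl a<m p = begin
    t ≈⟨ solve 2 (λ t y → t := (t :+ y) :+ :- y) ≈-refl t y′ ⟩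
    (t ⊕ y′) ⊕ ⊖ y′ ≈⟨ ⊕-cong (theta-⊛-theta s m w b 1≤w 1≤b a<m) (⊖-cong (⊛-congʳ _ p)) ⟩
    evenTheta m a ⊛ oddTheta m b ⊕ ⊖ (e ⊛ (oddTheta m a ⊛ evenTheta m b)) ∎
    where
    t y′ : Series
    t = (E ⊛ E) ⊛ theta-pair s m w b
    y′ = (sgn s ⊛ q^ w) ⊛ (oddTheta m a ⊛ evenTheta m b)
  sgn-q^-* : ∀ s t k l → sgn (s Sign.* t) ⊛ q^ (k ℕ.+ l) ≈ (sgn s ⊛ q^ k) ⊛ (sgn t ⊛ q^ l)
  sgn-q^-* s t k l = ≈-trans (⊛-cong (sgn-* s t) (q^-+ k l))
    (solve 4 (λ s t k l → (s :* t) :* (k :* l) := (s :* k) :* (t :* l)) ≈-refl (sgn s) (sgn t) (q^ k) (q^ l))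
  double : ∀ x y c → x ℕ.+ y ℕ.+ (x ℕ.+ y ℕ.+ c) ≡ x ℕ.+ (x ℕ.+ (y ℕ.+ (y ℕ.+ c)))
  double = ℕ-Solver.solve-∀
  triple : ∀ x y z d → x ℕ.+ y ℕ.+ z ℕ.+ (x ℕ.+ y ℕ.+ z ℕ.+ d) ≡ x ℕ.+ (x ℕ.+ (y ℕ.+ (y ℕ.+ (z ℕ.+ (z ℕ.+ d)))))
  triple = ℕ-Solver.solve-∀
  1≤c : 1 ≤ c
  1≤c = ℕ.≤-trans 1≤z (ℕ.m≤m+n z _)
  b<m = ℕ.≤-<-trans b≤a a<m
  c<m = ℕ.≤-<-trans c≤b b<m
  ab-minor = minor s₁ x b 1≤x (ℕ.≤-trans 1≤y (ℕ.m≤m+n y _)) refl a<m ≈-refl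
  cd-minor = minor s₃ z d 1≤z 1≤d refl c<m ≈-refl
  bc-minor = minor s₂ y c 1≤y 1≤c refl b<m ≈-refl
  ac-minor = minor (s₁ Sign.* s₂) (x ℕ.+ y) c (ℕ.≤-trans 1≤x (ℕ.m≤m+n x y)) 1≤c (double x y c) a<m (sgn-q^-* s₁ s₂ x y)
  bd-minor = minor (s₂ Sign.* s₃) (y ℕ.+ z) d (ℕ.≤-trans 1≤y (ℕ.m≤m+n y z)) 1≤d (double y z d) b<m (sgn-q^-* s₂ s₃ y z)
  ad-minor = minor (s₁ Sign.* s₂ Sign.* s₃) (x ℕ.+ y ℕ.+ z) d
    (ℕ.≤-trans 1≤x (ℕ.≤-trans (ℕ.m≤m+n x y) (ℕ.m≤m+n _ z))) 1≤d (triple x y z d) a<m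
    (≈-trans (sgn-q^-* (s₁ Sign.* s₂) s₃ (x ℕ.+ y) z) (⊛-congʳ e₃ (sgn-q^-* s₁ s₂ x y)))
  -- Only quotients of the column weights ± q^(a/2) enter: `e₁`, `e₂`, `e₃` belong to neighbouring
  -- columns and multiply for distant ones. The relation is thus polynomial in independent
  -- variables.
  plücker = solve 11 (λ e₁ e₂ e₃ Aa Ab Ac Ad Ca Cb Cc Cd →
      (Aa :* Cc :+ :- ((e₁ :* e₂) :* (Ca :* Ac))) :* (Ab :* Cd :+ :- ((e₂ :* e₃) :* (Cb :* Ad)))
      := (Aa :* Cd :+ :- ((e₁ :* e₂ :* e₃) :* (Ca :* Ad))) :* (Ab :* Cc :+ :- (e₂ :* (Cb :* Ac)))
         :+ e₂ :* ((Aa :* Cb :+ :- (e₁ :* (Ca :* Ab))) :* (Ac :* Cd :+ :- (e₃ :* (Cc :* Ad)))))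
    ≈-refl e₁ e₂ e₃ Aa Ab Ac Ad Ca Cb Cc Cd

-- Theta products modulo 60

⟦_⟧ : List ℕ → Series
⟦ [] ⟧ = 𝟙
⟦ r ∷ rs ⟧ = poch 𝟙 60 r ⊛ ⟦ rs ⟧

⟦⟧-++ : ∀ rs ts → ⟦ rs ++ ts ⟧ ≈ ⟦ rs ⟧ ⊛ ⟦ ts ⟧
⟦⟧-++ [] ts = ≈-sym (⊛-identityˡ _)
⟦⟧-++ (r ∷ rs) ts = ≈-trans (⊛-congˡ _ (⟦⟧-++ rs ts)) (≈-sym (⊛-assoc (poch 𝟙 60 r) _ _))

insert : ℕ → List ℕ → List ℕ
insert r [] = r ∷ []
insert r (t ∷ ts) = if r ≤ᵇ t then r ∷ t ∷ ts else t ∷ insert r ts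

sort : List ℕ → List ℕ
sort [] = []
sort (r ∷ rs) = insert r (sort rs)

⟦insert⟧ : ∀ r ts → ⟦ insert r ts ⟧ ≈ poch 𝟙 60 r ⊛ ⟦ ts ⟧
⟦insert⟧ r [] = ≈-refl
⟦insert⟧ r (t ∷ ts) with r ≤ᵇ t
... | true = ≈-refl
... | false = ≈-trans (⊛-congˡ _ (⟦insert⟧ r ts))
  (solve 3 (λ x y z → x :* (y :* z) := y :* (x :* z)) ≈-refl (poch 𝟙 60 t) (poch 𝟙 60 r) ⟦ ts ⟧)

⟦sort⟧ : ∀ rs → ⟦ sort rs ⟧ ≈ ⟦ rs ⟧
⟦sort⟧ [] = ≈-refl
⟦sort⟧ (r ∷ rs) = ≈-trans (⟦insert⟧ r (sort rs)) (⊛-congˡ _ (⟦sort⟧ rs))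

-- Reduces the comparison of concrete products to equality of sorted lists, which holds by
-- computation. The symmetry θ(r) = θ(60 - r) is absorbed too, as both expand to the same two
-- residues.
⟦⟧-permute : ∀ rs ts → sort rs ≡ sort ts → ⟦ rs ⟧ ≈ ⟦ ts ⟧
⟦⟧-permute rs ts e = ≈-trans (≈-sym (⟦sort⟧ rs)) (≈-trans (≡⇒≈ (cong ⟦_⟧ e)) (⟦sort⟧ ts))

⟦⟧-one : ∀ rs → ⟦ rs ⟧ 0 ≡ 1ℤ
⟦⟧-one [] = refl
⟦⟧-one (r ∷ rs) = trans (ℤ.*-identityˡ (⟦ rs ⟧ 0)) (⟦⟧-one rs)

-- Factors of even and of odd index.
poch-double : ∀ s m r → poch s (suc m) (suc r) ≈
  poch s (suc m ℕ.+ suc m) (suc r) ⊛ poch s (suc m ℕ.+ suc m) (suc m ℕ.+ suc r)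
poch-double s m r = begin
  poch s (suc m) (suc r) ≈⟨ ∏∞-blocks 1 (poch-convergent s m r) ⟩
  ∏∞ (λ i → ∏ 2 (λ j → factor (suc m) (suc r) (i ℕ.* 2 ℕ.+ j))) ≈⟨ ∏∞-cong (λ i → ⊛-cong
      (≈-trans (⊛-identityˡ _) (rewrite-exponent (even i m r))) (rewrite-exponent (odd i m r))) ⟩
  ∏∞ (λ i → factor 2m (suc r) i ⊛ factor 2m (suc m ℕ.+ suc r) i)
    ≈⟨ ∏∞-⊛ (poch-convergent s _ r) (poch-convergent s _ (m ℕ.+ suc r)) ⟩
  poch s 2m (suc r) ⊛ poch s 2m (suc m ℕ.+ suc r) ∎
  where
  open SetoidReasoning ≈-setoid
  2m : ℕ
  2m = suc m ℕ.+ suc m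
  factor : ℕ → ℕ → ℕ → Series
  factor m r i = 𝟙 ⊕ ⊖ (s ⊛ q^ (i ℕ.* m ℕ.+ r))
  rewrite-exponent : ∀ {k l} → k ≡ l → 𝟙 ⊕ ⊖ (s ⊛ q^ k) ≈ 𝟙 ⊕ ⊖ (s ⊛ q^ l)
  rewrite-exponent e = ≡⇒≈ (cong (λ k → 𝟙 ⊕ ⊖ (s ⊛ q^ k)) e)
  even : ∀ i m r → (i ℕ.* 2 ℕ.+ 0) ℕ.* suc m ℕ.+ suc r ≡ i ℕ.* (suc m ℕ.+ suc m) ℕ.+ suc r
  even = ℕ-Solver.solve-∀
  odd : ∀ i m r → (i ℕ.* 2 ℕ.+ 1) ℕ.* suc m ℕ.+ suc r ≡ i ℕ.* (suc m ℕ.+ suc m) ℕ.+ (suc m ℕ.+ suc r)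
  odd = ℕ-Solver.solve-∀

-- Factorwise (1 + x)(1 - x) = 1 - x².
poch-conjugate : ∀ m r → poch (⊖ 𝟙) (suc m) (suc r) ⊛ poch 𝟙 (suc m) (suc r)
  ≈ poch 𝟙 (suc m ℕ.+ suc m) (suc r ℕ.+ suc r)
poch-conjugate m r = ≈-trans (≈-sym (∏∞-⊛ (poch-convergent (⊖ 𝟙) m r) (poch-convergent 𝟙 m r))) (∏∞-cong factor)
  where
  factor : ∀ i → (𝟙 ⊕ ⊖ (⊖ 𝟙 ⊛ q^ (i ℕ.* suc m ℕ.+ suc r))) ⊛ (𝟙 ⊕ ⊖ (𝟙 ⊛ q^ (i ℕ.* suc m ℕ.+ suc r)))
    ≈ 𝟙 ⊕ ⊖ (𝟙 ⊛ q^ (i ℕ.* (suc m ℕ.+ suc m) ℕ.+ (suc r ℕ.+ suc r)))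
  factor i = begin
    (𝟙 ⊕ ⊖ (⊖ 𝟙 ⊛ x)) ⊛ (𝟙 ⊕ ⊖ (𝟙 ⊛ x))
      ≈⟨ solve 1 (λ x → (con 1ℤ :+ :- (:- con 1ℤ :* x)) :* (con 1ℤ :+ :- (con 1ℤ :* x)) := con 1ℤ :+ :- (con 1ℤ :* (x :* x))) ≈-refl x ⟩
    𝟙 ⊕ ⊖ (𝟙 ⊛ (x ⊛ x)) ≈⟨ ⊕-cong ≈-refl (⊖-cong (⊛-congˡ 𝟙 (≈-trans (≈-sym (q^-+ e e)) (≡⇒≈ (cong q^_ (exponents i m r)))))) ⟩
    𝟙 ⊕ ⊖ (𝟙 ⊛ q^ (i ℕ.* (suc m ℕ.+ suc m) ℕ.+ (suc r ℕ.+ suc r))) ∎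
    where
    open SetoidReasoning ≈-setoid
    e : ℕ
    e = i ℕ.* suc m ℕ.+ suc r
    x : Series
    x = q^ e
    exponents : ∀ i m r → i ℕ.* suc m ℕ.+ suc r ℕ.+ (i ℕ.* suc m ℕ.+ suc r) ≡ i ℕ.* (suc m ℕ.+ suc m) ℕ.+ (suc r ℕ.+ suc r)
    exponents = ℕ-Solver.solve-∀

-- The lists of residues modulo 60 occurring in theta Sign.+ 60 r and theta Sign.+ 30 r, and in
-- theta Sign.- 30 r times theta Sign.+ 30 r.
θ₆₀ θ₃₀ θ₃₀⁻ : ℕ → List ℕ
θ₆₀ r = r ∷ 60 ∸ r ∷ []
θ₃₀ r = r ∷ 30 ℕ.+ r ∷ 30 ∸ r ∷ 30 ℕ.+ (30 ∸ r) ∷ []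
θ₃₀⁻ r = r ℕ.+ r ∷ (30 ∸ r) ℕ.+ (30 ∸ r) ∷ []

theta₆₀ : ∀ r → theta Sign.+ 60 r ≈ ⟦ θ₆₀ r ⟧
theta₆₀ r = ⊛-congˡ _ (≈-sym (⊛-identityʳ _))

theta₃₀ : ∀ r → 1 ≤ r → r < 30 → theta Sign.+ 30 r ≈ ⟦ θ₃₀ r ⟧
theta₃₀ r@(suc r′) _ (s≤s r≤29) = ≈-trans
  (⊛-cong (poch-double 𝟙 29 r′) (≈-trans (≡⇒≈ (cong (poch 𝟙 30) e)) (≈-trans (poch-double 𝟙 29 (29 ∸ r))
    (≡⇒≈ (cong (λ t → poch 𝟙 60 t ⊛ poch 𝟙 60 (30 ℕ.+ t)) (sym e))))))
  (solve 4 (λ x y z t → (x :* y) :* (z :* t) := x :* (y :* (z :* (t :* con 1ℤ)))) ≈-refl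
    (poch 𝟙 60 r) (poch 𝟙 60 (30 ℕ.+ r)) (poch 𝟙 60 (30 ∸ r)) (poch 𝟙 60 (30 ℕ.+ (30 ∸ r))))
  where
  e : 30 ∸ r ≡ suc (29 ∸ r)
  e = ℕ.+-∸-assoc 1 r≤29

-- (-qʳ; q³⁰)∞ is only a quotient of products modulo 60; multiplying by (qʳ; q³⁰)∞ clears the
-- denominator.
theta₃₀⁻ : ∀ r → 1 ≤ r → r < 30 → theta Sign.- 30 r ⊛ ⟦ θ₃₀ r ⟧ ≈ ⟦ θ₃₀⁻ r ⟧
theta₃₀⁻ r@(suc r′) 1≤r r<30@(s≤s r≤29) = ≈-trans (⊛-congˡ _ (≈-sym (theta₃₀ r 1≤r r<30)))
  (≈-trans (solve 4 (λ x y z t → (x :* y) :* (z :* t) := (x :* z) :* ((y :* t) :* con 1ℤ)) ≈-refl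
     (poch (⊖ 𝟙) 30 r) (poch (⊖ 𝟙) 30 (30 ∸ r)) (poch 𝟙 30 r) (poch 𝟙 30 (30 ∸ r)))
   (⊛-cong (poch-conjugate 29 r′) (⊛-congʳ 𝟙 conjugate)))
  where
  conjugate : poch (⊖ 𝟙) 30 (30 ∸ r) ⊛ poch 𝟙 30 (30 ∸ r) ≈ poch 𝟙 60 ((30 ∸ r) ℕ.+ (30 ∸ r))
  conjugate = subst (λ t → poch (⊖ 𝟙) 30 t ⊛ poch 𝟙 30 t ≈ poch 𝟙 60 (t ℕ.+ t))
    (sym (ℕ.+-∸-assoc 1 r≤29)) (poch-conjugate 29 (29 ∸ r))

thetas : Sign → ℕ → List ℕ → Series
thetas s m [] = 𝟙
thetas s m (r ∷ rs) = theta s m r ⊛ thetas s m rs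

thetas₆₀ : ∀ rs → thetas Sign.+ 60 rs ≈ ⟦ concatMap θ₆₀ rs ⟧
thetas₆₀ [] = ≈-refl
thetas₆₀ (r ∷ rs) = ≈-trans (⊛-cong (theta₆₀ r) (thetas₆₀ rs)) (≈-sym (⟦⟧-++ (θ₆₀ r) (concatMap θ₆₀ rs)))

thetas₃₀ : ∀ {rs} → All (λ r → 1 ≤ r × r < 30) rs → thetas Sign.+ 30 rs ≈ ⟦ concatMap θ₃₀ rs ⟧
thetas₃₀ [] = ≈-refl
thetas₃₀ {r ∷ rs} ((1≤r , r<30) ∷ p) = ≈-trans (⊛-cong (theta₃₀ r 1≤r r<30) (thetas₃₀ p)) (≈-sym (⟦⟧-++ (θ₃₀ r) (concatMap θ₃₀ rs)))

thetas₃₀⁻ : ∀ {rs} → All (λ r → 1 ≤ r × r < 30) rs → thetas Sign.- 30 rs ⊛ ⟦ concatMap θ₃₀ rs ⟧ ≈ ⟦ concatMap θ₃₀⁻ rs ⟧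
thetas₃₀⁻ [] = ⊛-identityˡ 𝟙
thetas₃₀⁻ {r ∷ rs} ((1≤r , r<30) ∷ p) = ≈-trans (⊛-congˡ _ (⟦⟧-++ (θ₃₀ r) (concatMap θ₃₀ rs)))
  (≈-trans (solve 4 (λ x y z t → (x :* y) :* (z :* t) := (x :* z) :* (y :* t)) ≈-refl
      (theta Sign.- 30 r) (thetas Sign.- 30 rs) ⟦ θ₃₀ r ⟧ ⟦ concatMap θ₃₀ rs ⟧)
    (≈-trans (⊛-cong (theta₃₀⁻ r 1≤r r<30) (thetas₃₀⁻ p)) (≈-sym (⟦⟧-++ (θ₃₀⁻ r) (concatMap θ₃₀⁻ rs)))))

-- For a = b + 2x, b = c + 2y, c = d + 2z these lists hold the half sums and half differences of the
-- pairs {a,c}, {b,d}, of {a,d}, {b,c}, and of {a,b}, {c,d}.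
module _ (x y z d : ℕ) where

  acbd adbc abcd : List ℕ
  acbd = x ℕ.+ y ℕ.+ (z ℕ.+ (z ℕ.+ d)) ∷ x ℕ.+ y ∷ y ℕ.+ z ℕ.+ d ∷ y ℕ.+ z ∷ []
  adbc = x ℕ.+ y ℕ.+ z ℕ.+ d ∷ x ℕ.+ y ℕ.+ z ∷ y ℕ.+ (z ℕ.+ (z ℕ.+ d)) ∷ y ∷ []
  abcd = x ℕ.+ (y ℕ.+ (y ℕ.+ (z ℕ.+ (z ℕ.+ d)))) ∷ x ∷ z ℕ.+ d ∷ z ∷ []

  Admissible : ℕ → Set
  Admissible m = (1 ≤ x × 1 ≤ y × 1 ≤ z × 1 ≤ d) × x ℕ.+ (x ℕ.+ (y ℕ.+ (y ℕ.+ (z ℕ.+ (z ℕ.+ d))))) < m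

  admissible? : ∀ m → Dec (Admissible m)
  admissible? m = (1 ℕ.≤? x ×-dec 1 ℕ.≤? y ×-dec 1 ℕ.≤? z ×-dec 1 ℕ.≤? d) ×-dec (_ ℕ.<? m)

  -- All three signs are taken equal. Pairs combining two steps then get sign s² = +, and pairs
  -- combining one or three steps get s.
  weierstrass-thetas : ∀ s m → Admissible m → thetas (s Sign.* s) m acbd
    ≈ thetas s m adbc ⊕ (sgn s ⊛ q^ y) ⊛ thetas s m abcd
  weierstrass-thetas s m ((1≤x , 1≤y , 1≤z , 1≤d) , a<m) = begin
    thetas (s Sign.* s) m acbd ≈⟨ ≈-sym (flatten (s Sign.* s) _ _ _ _) ⟩
    _ ≈⟨ weierstrass m x y z d s s s 1≤x 1≤y 1≤z 1≤d a<m ⟩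
    theta-pair (s Sign.* s Sign.* s) m (x ℕ.+ y ℕ.+ z) d ⊛ theta-pair s m y (z ℕ.+ (z ℕ.+ d)) ⊕ (sgn s ⊛ q^ y) ⊛ _
      ≈⟨ ⊕-cong (≡⇒≈ (cong (λ t → theta-pair t m (x ℕ.+ y ℕ.+ z) d ⊛ theta-pair s m y (z ℕ.+ (z ℕ.+ d))) (cube s))) ≈-refl ⟩
    theta-pair s m (x ℕ.+ y ℕ.+ z) d ⊛ theta-pair s m y (z ℕ.+ (z ℕ.+ d)) ⊕ (sgn s ⊛ q^ y) ⊛ _
      ≈⟨ ⊕-cong (flatten s _ _ _ _) (⊛-congˡ _ (flatten s _ _ _ _)) ⟩
    thetas s m adbc ⊕ (sgn s ⊛ q^ y) ⊛ thetas s m abcd ∎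
    where
    open SetoidReasoning ≈-setoid
    cube : ∀ s → s Sign.* s Sign.* s ≡ s
    cube Sign.+ = refl
    cube Sign.- = refl
    flatten : ∀ s h i j k → (theta s m h ⊛ theta s m i) ⊛ (theta s m j ⊛ theta s m k) ≈ thetas s m (h ∷ i ∷ j ∷ k ∷ [])
    flatten s h i j k = solve 4 (λ h i j k → (h :* i) :* (j :* k) := h :* (i :* (j :* (k :* con 1ℤ)))) ≈-refl
      (theta s m h) (theta s m i) (theta s m j) (theta s m k)

  weierstrass₆₀ : Admissible 60 →
    ⟦ concatMap θ₆₀ acbd ⟧ ≈ ⟦ concatMap θ₆₀ adbc ⟧ ⊕ q^ y ⊛ ⟦ concatMap θ₆₀ abcd ⟧
  weierstrass₆₀ p = ≈-trans (≈-sym (thetas₆₀ acbd)) (≈-trans (weierstrass-thetas Sign.+ 60 p)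
    (⊕-cong (thetas₆₀ adbc) (⊛-cong (⊛-identityˡ (q^ y)) (thetas₆₀ abcd))))

  -- The case s = -: `acbd` has plain arguments, the other two terms have arguments -qʳ. Multiplying
  -- by the plain products for `adbc` and `abcd` makes every term a product of factors modulo 60.
  weierstrass₃₀ : Admissible 30 → All (λ r → 1 ≤ r × r < 30) (acbd ++ adbc ++ abcd) →
    ⟦ concatMap θ₃₀⁻ adbc ⟧ ⊛ ⟦ concatMap θ₃₀ abcd ⟧
    ≈ q^ y ⊛ (⟦ concatMap θ₃₀⁻ abcd ⟧ ⊛ ⟦ concatMap θ₃₀ adbc ⟧)
      ⊕ ⟦ concatMap θ₃₀ acbd ⟧ ⊛ (⟦ concatMap θ₃₀ adbc ⟧ ⊛ ⟦ concatMap θ₃₀ abcd ⟧)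
  weierstrass₃₀ p range = begin
    ⟦ concatMap θ₃₀⁻ adbc ⟧ ⊛ V ≈⟨ ⊛-congʳ V (≈-sym (thetas₃₀⁻ adbc-range)) ⟩
    (ad ⊛ U) ⊛ V ≈⟨ solve 5 (λ ad U V q ab → (ad :* U) :* V := q :* ((ab :* V) :* U) :+ (ad :+ (:- con 1ℤ :* q) :* ab) :* (U :* V))
                     ≈-refl ad U V (q^ y) ab ⟩
    q^ y ⊛ ((ab ⊛ V) ⊛ U) ⊕ (ad ⊕ (⊖ 𝟙 ⊛ q^ y) ⊛ ab) ⊛ (U ⊛ V)
      ≈⟨ ⊕-cong (⊛-congˡ _ (⊛-congʳ U (thetas₃₀⁻ abcd-range)))
           (⊛-congʳ _ (≈-trans (≈-sym (weierstrass-thetas Sign.- 30 p)) (thetas₃₀ acbd-range))) ⟩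
    q^ y ⊛ (⟦ concatMap θ₃₀⁻ abcd ⟧ ⊛ U) ⊕ ⟦ concatMap θ₃₀ acbd ⟧ ⊛ (U ⊛ V) ∎
    where
    open SetoidReasoning ≈-setoid
    U V ad ab : Series
    U = ⟦ concatMap θ₃₀ adbc ⟧
    V = ⟦ concatMap θ₃₀ abcd ⟧
    ad = thetas Sign.- 30 adbc
    ab = thetas Sign.- 30 abcd
    acbd-range = ++⁻ˡ acbd range
    adbc-range = ++⁻ˡ adbc (++⁻ʳ acbd range)
    abcd-range = ++⁻ʳ adbc (++⁻ʳ acbd range)

-- ∏ over the positive n ≡ ± r (mod 60), r ∈ rs, of 1 − qⁿ
⟦±_⟧ : List ℕ → Series
⟦± rs ⟧ = ⟦ concatMap θ₆₀ rs ⟧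

-- In x α v = α γ + q₂ α δ the third relation replaces α γ; the terms with δ then recombine to q₂ δ
-- (α + q₁ β) = q₂ δ x t.
eliminate : ∀ {x t v α β γ δ u q₁ q₂} → x 0 ≡ 1ℤ →
  x ⊛ t ≈ α ⊕ q₁ ⊛ β → x ⊛ v ≈ γ ⊕ q₂ ⊛ δ → α ⊛ γ ≈ (q₁ ⊛ q₂) ⊛ (β ⊛ δ) ⊕ x ⊛ u →
  α ⊛ v ≈ u ⊕ q₂ ⊛ (δ ⊛ t)
eliminate {x} {t} {v} {α} {β} {γ} {δ} {u} {q₁} {q₂} x₀ xt xv αγ = unit-cancel x₀ (begin
  x ⊛ (α ⊛ v) ≈⟨ solve 3 (λ x a v → x :* (a :* v) := a :* (x :* v)) ≈-refl x α v ⟩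
  α ⊛ (x ⊛ v) ≈⟨ ⊛-congˡ α xv ⟩
  α ⊛ (γ ⊕ q₂ ⊛ δ) ≈⟨ solve 4 (λ a c q d → a :* (c :+ q :* d) := a :* c :+ q :* (d :* a)) ≈-refl α γ q₂ δ ⟩
  α ⊛ γ ⊕ q₂ ⊛ (δ ⊛ α) ≈⟨ ⊕-cong αγ ≈-refl ⟩
  ((q₁ ⊛ q₂) ⊛ (β ⊛ δ) ⊕ x ⊛ u) ⊕ q₂ ⊛ (δ ⊛ α)
    ≈⟨ solve 6 (λ a b d p q y → ((p :* q) :* (b :* d) :+ y) :+ q :* (d :* a) := y :+ q :* (d :* (a :+ p :* b)))
         ≈-refl α β δ q₁ q₂ (x ⊛ u) ⟩
  x ⊛ u ⊕ q₂ ⊛ (δ ⊛ (α ⊕ q₁ ⊛ β)) ≈⟨ ⊕-cong ≈-refl (⊛-congˡ q₂ (⊛-congˡ δ (≈-sym xt))) ⟩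
  x ⊛ u ⊕ q₂ ⊛ (δ ⊛ (x ⊛ t))
    ≈⟨ solve 5 (λ x u q d t → x :* u :+ q :* (d :* (x :* t)) := x :* (u :+ q :* (d :* t))) ≈-refl x u q₂ δ t ⟩
  x ⊛ (u ⊕ q₂ ⊛ (δ ⊛ t)) ∎)
  where open SetoidReasoning ≈-setoid

-- The third relation now pairs α with δ, so the first relation is multiplied by δ; the terms with
-- q₃ β recombine to x v.
eliminateᵗ : ∀ {x t v α β γ δ u q₁ q₂ q₃} → x 0 ≡ 1ℤ → q₁ ≈ q₂ ⊛ q₃ →
  x ⊛ t ≈ α ⊕ q₁ ⊛ β → x ⊛ v ≈ γ ⊕ q₂ ⊛ δ → α ⊛ δ ≈ q₃ ⊛ (β ⊛ γ) ⊕ x ⊛ u →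
  δ ⊛ t ≈ u ⊕ q₃ ⊛ (β ⊛ v)
eliminateᵗ {x} {t} {v} {α} {β} {γ} {δ} {u} {q₁} {q₂} {q₃} x₀ q₁≈ xt xv αδ = unit-cancel x₀ (begin
  x ⊛ (δ ⊛ t) ≈⟨ solve 3 (λ x d t → x :* (d :* t) := d :* (x :* t)) ≈-refl x δ t ⟩
  δ ⊛ (x ⊛ t) ≈⟨ ⊛-congˡ δ (≈-trans xt (⊕-cong ≈-refl (⊛-congʳ β q₁≈))) ⟩
  δ ⊛ (α ⊕ (q₂ ⊛ q₃) ⊛ β)
    ≈⟨ solve 5 (λ a b d q r → d :* (a :+ (q :* r) :* b) := a :* d :+ (q :* r) :* (b :* d)) ≈-refl α β δ q₂ q₃ ⟩
  α ⊛ δ ⊕ (q₂ ⊛ q₃) ⊛ (β ⊛ δ) ≈⟨ ⊕-cong αδ ≈-refl ⟩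
  (q₃ ⊛ (β ⊛ γ) ⊕ x ⊛ u) ⊕ (q₂ ⊛ q₃) ⊛ (β ⊛ δ)
    ≈⟨ solve 6 (λ b c d y q r → (r :* (b :* c) :+ y) :+ (q :* r) :* (b :* d) := y :+ r :* (b :* (c :+ q :* d)))
         ≈-refl β γ δ (x ⊛ u) q₂ q₃ ⟩
  x ⊛ u ⊕ q₃ ⊛ (β ⊛ (γ ⊕ q₂ ⊛ δ)) ≈⟨ ⊕-cong ≈-refl (⊛-congˡ q₃ (⊛-congˡ β (≈-sym xv))) ⟩
  x ⊛ u ⊕ q₃ ⊛ (β ⊛ (x ⊛ v))
    ≈⟨ solve 5 (λ x u q b v → x :* u :+ q :* (b :* (x :* v)) := x :* (u :+ q :* (b :* v))) ≈-refl x u q₃ β v ⟩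
  x ⊛ (u ⊕ q₃ ⊛ (β ⊛ v)) ∎)
  where open SetoidReasoning ≈-setoid

-- From the same relations, with the second multiplied by α: the terms with γ recombine to x t, and
-- `u` survives with the coefficient q₂.
eliminateᵘ : ∀ {x t v α β γ δ u q₁ q₂ q₃} → x 0 ≡ 1ℤ → q₁ ≈ q₂ ⊛ q₃ →
  x ⊛ t ≈ α ⊕ q₁ ⊛ β → x ⊛ v ≈ γ ⊕ q₂ ⊛ δ → α ⊛ δ ≈ q₃ ⊛ (β ⊛ γ) ⊕ x ⊛ u →
  α ⊛ v ≈ γ ⊛ t ⊕ q₂ ⊛ u
eliminateᵘ {x} {t} {v} {α} {β} {γ} {δ} {u} {q₁} {q₂} {q₃} x₀ q₁≈ xt xv αδ = unit-cancel x₀ (begin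
  x ⊛ (α ⊛ v) ≈⟨ solve 3 (λ x a v → x :* (a :* v) := a :* (x :* v)) ≈-refl x α v ⟩
  α ⊛ (x ⊛ v) ≈⟨ ⊛-congˡ α xv ⟩
  α ⊛ (γ ⊕ q₂ ⊛ δ) ≈⟨ solve 4 (λ a c q d → a :* (c :+ q :* d) := a :* c :+ q :* (a :* d)) ≈-refl α γ q₂ δ ⟩
  α ⊛ γ ⊕ q₂ ⊛ (α ⊛ δ) ≈⟨ ⊕-cong ≈-refl (⊛-congˡ q₂ αδ) ⟩
  α ⊛ γ ⊕ q₂ ⊛ (q₃ ⊛ (β ⊛ γ) ⊕ x ⊛ u)
    ≈⟨ solve 6 (λ a b c y q r → a :* c :+ q :* (r :* (b :* c) :+ y) := c :* (a :+ (q :* r) :* b) :+ q :* y)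
         ≈-refl α β γ (x ⊛ u) q₂ q₃ ⟩
  γ ⊛ (α ⊕ (q₂ ⊛ q₃) ⊛ β) ⊕ q₂ ⊛ (x ⊛ u)
    ≈⟨ ⊕-cong (⊛-congˡ γ (≈-sym (≈-trans xt (⊕-cong ≈-refl (⊛-congʳ β q₁≈))))) ≈-refl ⟩
  γ ⊛ (x ⊛ t) ⊕ q₂ ⊛ (x ⊛ u)
    ≈⟨ solve 5 (λ x t c q u → c :* (x :* t) :+ q :* (x :* u) := x :* (c :* t :+ q :* u)) ≈-refl x t γ q₂ u ⟩
  x ⊛ (γ ⊛ t ⊕ q₂ ⊛ u) ∎)
  where open SetoidReasoning ≈-setoid

-- Generating functions of partitions into residue classes modulo 60

pmMod-periodic : ∀ rs i j → pmMod 60 rs (suc (i ℕ.* 60 ℕ.+ j)) ≡ pmMod 60 rs (suc j)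
pmMod-periodic rs i j = any-cong rs λ r → cong₂ (λ k l → (k ≡ᵇ r % 60) ∨ (l ≡ᵇ 0))
  (period j) (trans (cong (λ k → suc k % 60) (ℕ.+-assoc (i ℕ.* 60) j r)) (period (j ℕ.+ r)))
  where
  any-cong : ∀ {f g : ℕ → Bool} rs → (∀ r → f r ≡ g r) → any f rs ≡ any g rs
  any-cong [] p = refl
  any-cong (r ∷ rs) p = cong₂ _∨_ (p r) (any-cong rs p)
  period : ∀ k → suc (i ℕ.* 60 ℕ.+ k) % 60 ≡ suc k % 60
  period k = trans (cong (λ n → suc n % 60) (ℕ.+-comm (i ℕ.* 60) k)) ([m+kn]%n≡m%n (suc k) i 60)

∏∞-𝟙 : ∏∞ (λ _ → 𝟙) ≈ 𝟙
∏∞-𝟙 = ≈[]⇒≈ λ n → ≈[]-trans (∏∞-truncate (λ _ → ≈[]-refl) (ℕ.n≤1+n n)) (∏-one n λ _ → ≈[]-refl)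

∏∞-∏ : ∀ n (g : ℕ → ℕ → Series) → (∀ j → Convergent (g j)) → ∏∞ (λ i → ∏ n (λ j → g j i)) ≈ ∏ n (λ j → ∏∞ (g j))
∏∞-∏ zero g c = ∏∞-𝟙
∏∞-∏ (suc n) g c = ≈-trans (∏∞-⊛ (λ i → ∏-one n λ j → c j i) (c n)) (⊛-congʳ _ (∏∞-∏ n g c))

residues : List ℕ → ℕ → List ℕ
residues rs zero = []
residues rs (suc n) = if pmMod 60 rs (suc n) then suc n ∷ residues rs n else residues rs n

module _ (rs : List ℕ) where

  residueFactor : ℕ → ℕ → Series
  residueFactor j i = if pmMod 60 rs (suc j) then 𝟙 ⊕ ⊖ (𝟙 ⊛ q^ (i ℕ.* 60 ℕ.+ suc j)) else 𝟙

  residueFactor-convergent : ∀ j → Convergent (residueFactor j)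
  residueFactor-convergent j with pmMod 60 rs (suc j)
  ... | true = poch-convergent 𝟙 59 j
  ... | false = λ _ → ≈[]-refl

  eulerFactor-residueFactor : ∀ i j → eulerFactor (pmMod 60 rs) (i ℕ.* 60 ℕ.+ j) ≈ residueFactor j i
  eulerFactor-residueFactor i j rewrite pmMod-periodic rs i j with pmMod 60 rs (suc j)
  ... | true = ⊕-cong ≈-refl (⊖-cong (≈-sym (≈-trans (⊛-identityˡ _) (≡⇒≈ (cong q^_ (ℕ.+-suc (i ℕ.* 60) j))))))
  ... | false = ≈-refl

  ∏-residues : ∀ n → ∏ n (λ j → ∏∞ (residueFactor j)) ≈ ⟦ residues rs n ⟧
  ∏-residues zero = ≈-refl
  ∏-residues (suc n) with pmMod 60 rs (suc n)
  ... | true = ≈-trans (⊛-congʳ _ (∏-residues n)) (⊛-comm _ _)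
  ... | false = ≈-trans (⊛-cong (∏-residues n) ∏∞-𝟙) (⊛-identityʳ _)

  -- The hypothesis is a finite computation. It says that the residues r and 60 - r are pairwise
  -- distinct and exhaust the set, so that each 1 - qⁿ occurs exactly once.
  ⟦±⟧-partitions : sort (residues rs 60) ≡ sort (concatMap θ₆₀ rs) → ⟦± rs ⟧ ⊛ partitions (pmMod 60 rs) ≈ 𝟙
  ⟦±⟧-partitions e = ≈-trans (⊛-congʳ _ (≈-sym euler)) (∏∞-eulerFactor-⊛-partitions (pmMod 60 rs))
    where
    open SetoidReasoning ≈-setoid
    euler : ∏∞ (eulerFactor (pmMod 60 rs)) ≈ ⟦± rs ⟧
    euler = begin
      ∏∞ (eulerFactor (pmMod 60 rs)) ≈⟨ ∏∞-blocks 59 (eulerFactor-convergent (pmMod 60 rs)) ⟩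
      ∏∞ (λ i → ∏ 60 (λ j → eulerFactor (pmMod 60 rs) (i ℕ.* 60 ℕ.+ j)))
        ≈⟨ ∏∞-cong (λ i → ∏-cong 60 (eulerFactor-residueFactor i)) ⟩
      ∏∞ (λ i → ∏ 60 (λ j → residueFactor j i)) ≈⟨ ∏∞-∏ 60 residueFactor residueFactor-convergent ⟩
      ∏ 60 (λ j → ∏∞ (residueFactor j)) ≈⟨ ∏-residues 60 ⟩
      ⟦ residues rs 60 ⟧ ≈⟨ ⟦⟧-permute (residues rs 60) (concatMap θ₆₀ rs) e ⟩
      ⟦± rs ⟧ ∎

⟦±⟧-++ : ∀ rs ts → ⟦± rs ++ ts ⟧ ≈ ⟦± rs ⟧ ⊛ ⟦± ts ⟧
⟦±⟧-++ [] ts = ≈-sym (⊛-identityˡ _)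
⟦±⟧-++ (r ∷ rs) ts = ≈-trans (⟦⟧-++ (θ₆₀ r) (concatMap θ₆₀ (rs ++ ts)))
  (≈-trans (⊛-congˡ _ (⟦±⟧-++ rs ts)) (≈-trans (≈-sym (⊛-assoc ⟦ θ₆₀ r ⟧ _ _))
    (⊛-congʳ _ (≈-sym (⟦⟧-++ (θ₆₀ r) (concatMap θ₆₀ rs))))))

⟦±⟧-permute : ∀ rs ts → sort (concatMap θ₆₀ rs) ≡ sort (concatMap θ₆₀ ts) → ⟦± rs ⟧ ≈ ⟦± ts ⟧
⟦±⟧-permute rs ts = ⟦⟧-permute (concatMap θ₆₀ rs) (concatMap θ₆₀ ts)

-- A product relation between the parts ss and ts of S and T outside their common part cs,
-- with us = S ∪ T, is multiplied by ⟦± cs ⟧ and divided by ⟦± S ⟧ ⊛ ⟦± T ⟧.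
module _ (S T cs ss ts us : List ℕ)
  (S-split : sort (concatMap θ₆₀ (cs ++ ss)) ≡ sort (concatMap θ₆₀ S))
  (T-split : sort (concatMap θ₆₀ (cs ++ ts)) ≡ sort (concatMap θ₆₀ T))
  (ST-split : sort (concatMap θ₆₀ (cs ++ us)) ≡ sort (concatMap θ₆₀ (S ++ T)))
  (S-residues : sort (residues S 60) ≡ sort (concatMap θ₆₀ S))
  (T-residues : sort (residues T 60) ≡ sort (concatMap θ₆₀ T))
  where

  private
    P Q : Series
    P = partitions (pmMod 60 S)
    Q = partitions (pmMod 60 T)
    S-product : ⟦± cs ⟧ ⊛ ⟦± ss ⟧ ≈ ⟦± S ⟧
    S-product = ≈-trans (≈-sym (⟦±⟧-++ cs ss)) (⟦±⟧-permute (cs ++ ss) S S-split)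
    T-product : ⟦± cs ⟧ ⊛ ⟦± ts ⟧ ≈ ⟦± T ⟧
    T-product = ≈-trans (≈-sym (⟦±⟧-++ cs ts)) (⟦±⟧-permute (cs ++ ts) T T-split)
    ST-product : ⟦± cs ⟧ ⊛ ⟦± us ⟧ ≈ ⟦± S ⟧ ⊛ ⟦± T ⟧
    ST-product = ≈-trans (≈-sym (⟦±⟧-++ cs us)) (≈-trans (⟦±⟧-permute (cs ++ us) (S ++ T) ST-split) (⟦±⟧-++ S T))

    divide-ss : (P ⊛ Q) ⊛ (⟦± cs ⟧ ⊛ ⟦± ss ⟧) ≈ Q
    divide-ss = ≈-trans (⊛-congˡ _ S-product)
      (≈-trans (solve 3 (λ a b c → (a :* b) :* c := (c :* a) :* b) ≈-refl P Q ⟦± S ⟧)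
        (≈-trans (⊛-congʳ Q (⟦±⟧-partitions S S-residues)) (⊛-identityˡ Q)))

    divide-ts : (P ⊛ Q) ⊛ (⟦± cs ⟧ ⊛ ⟦± ts ⟧) ≈ P
    divide-ts = ≈-trans (⊛-congˡ _ T-product)
      (≈-trans (solve 3 (λ a b c → (a :* b) :* c := (c :* b) :* a) ≈-refl P Q ⟦± T ⟧)
        (≈-trans (⊛-congʳ P (⟦±⟧-partitions T T-residues)) (⊛-identityˡ P)))

    divide-us : (P ⊛ Q) ⊛ (⟦± cs ⟧ ⊛ ⟦± us ⟧) ≈ 𝟙
    divide-us = ≈-trans (⊛-congˡ _ ST-product) (≈-trans
      (solve 4 (λ a b c d → (a :* b) :* (c :* d) := (c :* a) :* (d :* b)) ≈-refl P Q ⟦± S ⟧ ⟦± T ⟧)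
      (≈-trans (⊛-cong (⟦±⟧-partitions S S-residues) (⟦±⟧-partitions T T-residues)) (⊛-identityˡ 𝟙)))

  partitions-shifted : ∀ k → ⟦± ts ⟧ ≈ ⟦± us ⟧ ⊕ q^ k ⊛ ⟦± ss ⟧ → P ≈ 𝟙 ⊕ q^ k ⊛ Q
  partitions-shifted k e = begin
    P ≈⟨ ≈-sym divide-ts ⟩
    (P ⊛ Q) ⊛ (⟦± cs ⟧ ⊛ ⟦± ts ⟧) ≈⟨ ⊛-congˡ _ (⊛-congˡ _ e) ⟩
    (P ⊛ Q) ⊛ (⟦± cs ⟧ ⊛ (⟦± us ⟧ ⊕ q^ k ⊛ ⟦± ss ⟧))
      ≈⟨ solve 5 (λ p c u q s → p :* (c :* (u :+ q :* s)) := p :* (c :* u) :+ q :* (p :* (c :* s))) ≈-refl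
         (P ⊛ Q) ⟦± cs ⟧ ⟦± us ⟧ (q^ k) ⟦± ss ⟧ ⟩
    (P ⊛ Q) ⊛ (⟦± cs ⟧ ⊛ ⟦± us ⟧) ⊕ q^ k ⊛ ((P ⊛ Q) ⊛ (⟦± cs ⟧ ⊛ ⟦± ss ⟧)) ≈⟨ ⊕-cong divide-us (⊛-congˡ _ divide-ss) ⟩
    𝟙 ⊕ q^ k ⊛ Q ∎
    where open SetoidReasoning ≈-setoid

  partitions-difference : ∀ k → ⟦± ss ⟧ ≈ ⟦± ts ⟧ ⊕ q^ k ⊛ ⟦± us ⟧ → Q ≈ P ⊕ q^ k
  partitions-difference k e = begin
    Q ≈⟨ ≈-sym divide-ss ⟩
    (P ⊛ Q) ⊛ (⟦± cs ⟧ ⊛ ⟦± ss ⟧) ≈⟨ ⊛-congˡ _ (⊛-congˡ _ e) ⟩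
    (P ⊛ Q) ⊛ (⟦± cs ⟧ ⊛ (⟦± ts ⟧ ⊕ q^ k ⊛ ⟦± us ⟧))
      ≈⟨ solve 5 (λ p c u q s → p :* (c :* (u :+ q :* s)) := p :* (c :* u) :+ q :* (p :* (c :* s))) ≈-refl
         (P ⊛ Q) ⟦± cs ⟧ ⟦± ts ⟧ (q^ k) ⟦± us ⟧ ⟩
    (P ⊛ Q) ⊛ (⟦± cs ⟧ ⊛ ⟦± ts ⟧) ⊕ q^ k ⊛ ((P ⊛ Q) ⊛ (⟦± cs ⟧ ⊛ ⟦± us ⟧)) ≈⟨ ⊕-cong divide-ts (⊛-congˡ _ divide-us) ⟩
    P ⊕ q^ k ⊛ 𝟙 ≈⟨ ⊕-cong ≈-refl (⊛-identityʳ _) ⟩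
    P ⊕ q^ k ∎
    where open SetoidReasoning ≈-setoid

-- Reading off coefficients

𝟙-coeff : ∀ n → 1 ≤ n → 𝟙 n ≡ 0ℤ
𝟙-coeff (suc n) _ = refl

q^-coeff : ∀ k n → n ≢ k → (q^ k) n ≡ 0ℤ
q^-coeff zero zero n≢k = contradiction refl n≢k
q^-coeff zero (suc n) _ = refl
q^-coeff (suc k) zero _ = refl
q^-coeff (suc k) (suc n) n≢k = q^-coeff k n (n≢k ∘ cong suc)

shifted-coeff : ∀ {S T} k n → 1 ≤ k → k ≤ n → partitions S ≈ 𝟙 ⊕ q^ k ⊛ partitions T → p S n ≡ p T (n ∸ k)
shifted-coeff {S} {T} k n 1≤k k≤n e = ℤ.+-injective (begin
  + p S n ≡⟨ coeff e n ⟩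
  (𝟙 ⊕ q^ k ⊛ partitions T) n ≡⟨ ⊕-coeff 𝟙 _ n ⟩
  𝟙 n ℤ.+ (q^ k ⊛ partitions T) n ≡⟨ cong (λ z → z ℤ.+ (q^ k ⊛ partitions T) n) (𝟙-coeff n (ℕ.≤-trans 1≤k k≤n)) ⟩
  0ℤ ℤ.+ (q^ k ⊛ partitions T) n ≡⟨ ℤ.+-identityˡ _ ⟩
  (q^ k ⊛ partitions T) n ≡⟨ cong (q^ k ⊛ partitions T) (sym (ℕ.m+[n∸m]≡n k≤n)) ⟩
  (q^ k ⊛ partitions T) (k ℕ.+ (n ∸ k)) ≡⟨ q^-⊛-coeff k (partitions T) (n ∸ k) ⟩
  + p T (n ∸ k) ∎)
  where open ≡-Reasoning

difference-coeff : ∀ {S T} k n → n ≢ k → partitions T ≈ partitions S ⊕ q^ k → p S n ≡ p T n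
difference-coeff {S} {T} k n n≢k e = ℤ.+-injective (sym (begin
  + p T n ≡⟨ coeff e n ⟩
  (partitions S ⊕ q^ k) n ≡⟨ ⊕-coeff (partitions S) (q^ k) n ⟩
  + p S n ℤ.+ (q^ k) n ≡⟨ cong (λ z → + p S n ℤ.+ z) (q^-coeff k n n≢k) ⟩
  + p S n ℤ.+ 0ℤ ≡⟨ ℤ.+-identityʳ _ ⟩
  + p S n ∎))
  where open ≡-Reasoning

-- Three-term relations on lists of residues

three-term₆₀ : ∀ x y z d → Admissible x y z d 60 → ∀ xs ts αs βs →
  sort (concatMap θ₆₀ (acbd x y z d)) ≡ sort (concatMap θ₆₀ (xs ++ ts)) →
  sort (concatMap θ₆₀ (adbc x y z d)) ≡ sort (concatMap θ₆₀ αs) →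
  sort (concatMap θ₆₀ (abcd x y z d)) ≡ sort (concatMap θ₆₀ βs) →
  ⟦± xs ⟧ ⊛ ⟦± ts ⟧ ≈ ⟦± αs ⟧ ⊕ q^ y ⊛ ⟦± βs ⟧
three-term₆₀ x y z d p xs ts αs βs e₁ e₂ e₃ = begin
  ⟦± xs ⟧ ⊛ ⟦± ts ⟧ ≈⟨ ≈-sym (⟦±⟧-++ xs ts) ⟩
  ⟦± xs ++ ts ⟧ ≈⟨ ≈-sym (⟦±⟧-permute (acbd x y z d) (xs ++ ts) e₁) ⟩
  ⟦± acbd x y z d ⟧ ≈⟨ weierstrass₆₀ x y z d p ⟩
  ⟦± adbc x y z d ⟧ ⊕ q^ y ⊛ ⟦± abcd x y z d ⟧
    ≈⟨ ⊕-cong (⟦±⟧-permute (adbc x y z d) αs e₂) (⊛-congˡ _ (⟦±⟧-permute (abcd x y z d) βs e₃)) ⟩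
  ⟦± αs ⟧ ⊕ q^ y ⊛ ⟦± βs ⟧ ∎
  where open SetoidReasoning ≈-setoid

-- `gs` collects the thetas that all three terms have in common after passing from nome q³⁰ to q⁶⁰;
-- they are cancelled.
three-term₃₀ : ∀ x y z d → Admissible x y z d 30 →
  All (λ r → 1 ≤ r × r < 30) (acbd x y z d ++ adbc x y z d ++ abcd x y z d) →
  ∀ gs αs γs βs δs xs us →
  sort (concatMap θ₃₀⁻ (adbc x y z d) ++ concatMap θ₃₀ (abcd x y z d)) ≡ sort (concatMap θ₆₀ (gs ++ αs ++ γs)) →
  sort (concatMap θ₃₀⁻ (abcd x y z d) ++ concatMap θ₃₀ (adbc x y z d)) ≡ sort (concatMap θ₆₀ (gs ++ βs ++ δs)) →
  sort (concatMap θ₃₀ (acbd x y z d) ++ concatMap θ₃₀ (adbc x y z d) ++ concatMap θ₃₀ (abcd x y z d))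
    ≡ sort (concatMap θ₆₀ (gs ++ xs ++ us)) →
  ⟦± αs ⟧ ⊛ ⟦± γs ⟧ ≈ q^ y ⊛ (⟦± βs ⟧ ⊛ ⟦± δs ⟧) ⊕ ⟦± xs ⟧ ⊛ ⟦± us ⟧
three-term₃₀ x y z d p range gs αs γs βs δs xs us e₁ e₂ e₃ = unit-cancel (⟦⟧-one (concatMap θ₆₀ gs)) (begin
  G ⊛ (⟦± αs ⟧ ⊛ ⟦± γs ⟧) ≈⟨ ≈-sym (regroup αs γs) ⟩
  ⟦± gs ++ αs ++ γs ⟧ ≈⟨ ≈-sym (⟦⟧-permute (concatMap θ₃₀⁻ (adbc x y z d) ++ V) (concatMap θ₆₀ (gs ++ αs ++ γs)) e₁) ⟩
  ⟦ concatMap θ₃₀⁻ (adbc x y z d) ++ V ⟧ ≈⟨ ⟦⟧-++ (concatMap θ₃₀⁻ (adbc x y z d)) V ⟩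
  ⟦ concatMap θ₃₀⁻ (adbc x y z d) ⟧ ⊛ ⟦ V ⟧ ≈⟨ weierstrass₃₀ x y z d p range ⟩
  q^ y ⊛ (⟦ concatMap θ₃₀⁻ (abcd x y z d) ⟧ ⊛ ⟦ U ⟧) ⊕ ⟦ W ⟧ ⊛ (⟦ U ⟧ ⊛ ⟦ V ⟧)
    ≈⟨ ⊕-cong (⊛-congˡ _ (≈-sym (⟦⟧-++ (concatMap θ₃₀⁻ (abcd x y z d)) U)))
         (≈-sym (≈-trans (⟦⟧-++ W (U ++ V)) (⊛-congˡ _ (⟦⟧-++ U V)))) ⟩
  q^ y ⊛ ⟦ concatMap θ₃₀⁻ (abcd x y z d) ++ U ⟧ ⊕ ⟦ W ++ U ++ V ⟧
    ≈⟨ ⊕-cong (⊛-congˡ _ (⟦⟧-permute (concatMap θ₃₀⁻ (abcd x y z d) ++ U) (concatMap θ₆₀ (gs ++ βs ++ δs)) e₂))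
         (⟦⟧-permute (W ++ U ++ V) (concatMap θ₆₀ (gs ++ xs ++ us)) e₃) ⟩
  q^ y ⊛ ⟦± gs ++ βs ++ δs ⟧ ⊕ ⟦± gs ++ xs ++ us ⟧ ≈⟨ ⊕-cong (⊛-congˡ _ (regroup βs δs)) (regroup xs us) ⟩
  q^ y ⊛ (G ⊛ (⟦± βs ⟧ ⊛ ⟦± δs ⟧)) ⊕ G ⊛ (⟦± xs ⟧ ⊛ ⟦± us ⟧)
    ≈⟨ solve 4 (λ q g b u → q :* (g :* b) :+ g :* u := g :* (q :* b :+ u)) ≈-refl (q^ y) G _ _ ⟩
  G ⊛ (q^ y ⊛ (⟦± βs ⟧ ⊛ ⟦± δs ⟧) ⊕ ⟦± xs ⟧ ⊛ ⟦± us ⟧) ∎)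
  where
  open SetoidReasoning ≈-setoid
  U V W : List ℕ
  U = concatMap θ₃₀ (adbc x y z d)
  V = concatMap θ₃₀ (abcd x y z d)
  W = concatMap θ₃₀ (acbd x y z d)
  G : Series
  G = ⟦± gs ⟧
  regroup : ∀ αs γs → ⟦± gs ++ αs ++ γs ⟧ ≈ G ⊛ (⟦± αs ⟧ ⊛ ⟦± γs ⟧)
  regroup αs γs = ≈-trans (⟦±⟧-++ gs (αs ++ γs)) (⊛-congˡ G (⟦±⟧-++ αs γs))

range? : ∀ rs → Dec (All (λ r → 1 ≤ r × r < 30) rs)
range? = all? λ r → 1 ℕ.≤? r ×-dec r ℕ.<? 30

-- The concrete theta products

module PartsOneFour where

  S₁ T₁ S₄ T₄ xs ts vs αs βs γs δs us : List ℕ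
  S₁ = 1 ∷ 8 ∷ 10 ∷ 11 ∷ 12 ∷ 13 ∷ 14 ∷ 15 ∷ 17 ∷ 19 ∷ 21 ∷ 23 ∷ []
  T₁ = 1 ∷ 7 ∷ 9 ∷ 10 ∷ 11 ∷ 12 ∷ 13 ∷ 15 ∷ 23 ∷ 26 ∷ 28 ∷ 29 ∷ []
  S₄ = 7 ∷ 8 ∷ 9 ∷ 10 ∷ 11 ∷ 12 ∷ 13 ∷ 14 ∷ 15 ∷ 17 ∷ 19 ∷ 29 ∷ []
  T₄ = 1 ∷ 7 ∷ 10 ∷ 12 ∷ 15 ∷ 17 ∷ 19 ∷ 21 ∷ 23 ∷ 26 ∷ 28 ∷ 29 ∷ []
  xs = 15 ∷ 18 ∷ 20 ∷ []
  ts = 21 ∷ []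
  vs = 9 ∷ []
  αs = 7 ∷ 26 ∷ 28 ∷ 29 ∷ []
  βs = 8 ∷ 11 ∷ 13 ∷ 14 ∷ []
  γs = 1 ∷ 23 ∷ 26 ∷ 28 ∷ []
  δs = 8 ∷ 14 ∷ 17 ∷ 19 ∷ []
  us = 1 ∷ 7 ∷ 8 ∷ 9 ∷ 10 ∷ 11 ∷ 12 ∷ 13 ∷ 14 ∷ 15 ∷ 17 ∷ 19 ∷ 21 ∷ 23 ∷ 26 ∷ 28 ∷ 29 ∷ []

  xt : ⟦± xs ⟧ ⊛ ⟦± ts ⟧ ≈ ⟦± αs ⟧ ⊕ q^ 7 ⊛ ⟦± βs ⟧
  -- The columns are 57, 35, 21, 5; θ(39) = θ(21) comes from the half sum of 57 and 21.
  xt = three-term₆₀ 11 7 8 5 (from-yes (admissible? 11 7 8 5 60)) xs ts αs βs refl refl refl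

  xv : ⟦± xs ⟧ ⊛ ⟦± vs ⟧ ≈ ⟦± γs ⟧ ⊕ q^ 1 ⊛ ⟦± δs ⟧
  -- The columns are 57, 29, 27, 11.
  xv = three-term₆₀ 14 1 8 11 (from-yes (admissible? 14 1 8 11 60)) xs vs γs δs refl refl refl

  αγ : ⟦± αs ⟧ ⊛ ⟦± γs ⟧ ≈ q^ 8 ⊛ (⟦± βs ⟧ ⊛ ⟦± δs ⟧) ⊕ ⟦± xs ⟧ ⊛ ⟦± us ⟧
  -- The columns are 27, 25, 9, 5. The pairs {27, 9} and {25, 5} give the arguments 18, 9, 15, 10
  -- modulo 30, which split into θ(18)θ(12), θ(9)θ(21), θ(15)², θ(10)θ(20) and so supply `x`.
  αγ = three-term₃₀ 1 8 2 5 (from-yes (admissible? 1 8 2 5 30))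
    (from-yes (range? (acbd 1 8 2 5 ++ adbc 1 8 2 5 ++ abcd 1 8 2 5)))
    (2 ∷ 4 ∷ 16 ∷ 22 ∷ []) αs γs βs δs xs us refl refl refl

  part₁ : partitions (pmMod 60 S₁) ≈ 𝟙 ⊕ q^ 1 ⊛ partitions (pmMod 60 T₁)
  part₁ = partitions-shifted S₁ T₁ (1 ∷ 10 ∷ 11 ∷ 12 ∷ 13 ∷ 15 ∷ 23 ∷ []) (δs ++ ts) (αs ++ vs) us refl refl refl refl refl 1
    (≈-trans (⟦±⟧-++ αs vs) (≈-trans (eliminate (⟦⟧-one (concatMap θ₆₀ xs)) xt xv
      (≈-trans αγ (⊕-cong (⊛-congʳ _ (q^-+ 7 1)) ≈-refl))) (⊕-cong ≈-refl (⊛-congˡ _ (≈-sym (⟦±⟧-++ δs ts))))))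

  part₄ : partitions (pmMod 60 S₄) ≈ 𝟙 ⊕ q^ 7 ⊛ partitions (pmMod 60 T₄)
  part₄ = partitions-shifted S₄ T₄ (7 ∷ 10 ∷ 12 ∷ 15 ∷ 17 ∷ 19 ∷ 29 ∷ []) (βs ++ vs) (γs ++ ts) us refl refl refl refl refl 7
    -- The two relations are interchanged, so q and q⁷ change places.
    (≈-trans (⟦±⟧-++ γs ts) (≈-trans (eliminate (⟦⟧-one (concatMap θ₆₀ xs)) xv xt
      (≈-trans (⊛-comm _ _) (≈-trans αγ (⊕-cong (⊛-cong (q^-+ 1 7) (⊛-comm _ _)) ≈-refl))))
      (⊕-cong ≈-refl (⊛-congˡ _ (≈-sym (⟦±⟧-++ βs vs))))))

module PartsTwoThree where

  S₂ T₂ S₃ T₃ xs ts vs αs βs γs δs us : List ℕ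
  S₂ = 2 ∷ 3 ∷ 7 ∷ 10 ∷ 11 ∷ 15 ∷ 16 ∷ 17 ∷ 19 ∷ 23 ∷ 24 ∷ 29 ∷ []
  T₂ = 1 ∷ 4 ∷ 7 ∷ 10 ∷ 13 ∷ 15 ∷ 17 ∷ 19 ∷ 22 ∷ 24 ∷ 27 ∷ 29 ∷ []
  S₃ = 1 ∷ 3 ∷ 4 ∷ 10 ∷ 11 ∷ 13 ∷ 15 ∷ 17 ∷ 22 ∷ 23 ∷ 24 ∷ 29 ∷ []
  T₃ = 1 ∷ 2 ∷ 7 ∷ 10 ∷ 11 ∷ 13 ∷ 15 ∷ 16 ∷ 19 ∷ 23 ∷ 24 ∷ 27 ∷ []
  xs = 6 ∷ 15 ∷ 20 ∷ []
  ts = 27 ∷ []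
  vs = 3 ∷ []
  αs = 4 ∷ 17 ∷ 22 ∷ 29 ∷ []
  βs = 2 ∷ 11 ∷ 16 ∷ 23 ∷ []
  γs = 2 ∷ 7 ∷ 16 ∷ 19 ∷ []
  δs = 1 ∷ 4 ∷ 13 ∷ 22 ∷ []
  us = 1 ∷ 2 ∷ 3 ∷ 4 ∷ 7 ∷ 10 ∷ 11 ∷ 13 ∷ 15 ∷ 16 ∷ 17 ∷ 19 ∷ 22 ∷ 23 ∷ 24 ∷ 27 ∷ 29 ∷ []

  xt : ⟦± xs ⟧ ⊛ ⟦± ts ⟧ ≈ ⟦± αs ⟧ ⊕ q^ 4 ⊛ ⟦± βs ⟧
  -- The columns are 55, 33, 25, 21.
  xt = three-term₆₀ 11 4 2 21 (from-yes (admissible? 11 4 2 21 60)) xs ts αs βs refl refl refl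

  xv : ⟦± xs ⟧ ⊛ ⟦± vs ⟧ ≈ ⟦± γs ⟧ ⊕ q^ 2 ⊛ ⟦± δs ⟧
  -- The columns are 51, 43, 39, 37.
  xv = three-term₆₀ 4 2 1 37 (from-yes (admissible? 4 2 1 37 60)) xs vs γs δs refl refl refl

  αδ : ⟦± αs ⟧ ⊛ ⟦± δs ⟧ ≈ q^ 2 ⊛ (⟦± βs ⟧ ⊛ ⟦± γs ⟧) ⊕ ⟦± xs ⟧ ⊛ ⟦± us ⟧
  -- The columns are 23, 21, 17, 9; the arguments 20, 3, 15, 6 modulo 30 supply `x`.
  αδ = three-term₃₀ 1 2 4 9 (from-yes (admissible? 1 2 4 9 30))
    (from-yes (range? (acbd 1 2 4 9 ++ adbc 1 2 4 9 ++ abcd 1 2 4 9)))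
    (8 ∷ 14 ∷ 26 ∷ 28 ∷ []) αs δs βs γs xs us refl refl refl

  part₂ : partitions (pmMod 60 S₂) ≈ 𝟙 ⊕ q^ 2 ⊛ partitions (pmMod 60 T₂)
  part₂ = partitions-shifted S₂ T₂ (7 ∷ 10 ∷ 15 ∷ 17 ∷ 19 ∷ 24 ∷ 29 ∷ []) (βs ++ vs) (δs ++ ts) us refl refl refl refl refl 2
    (≈-trans (⟦±⟧-++ δs ts) (≈-trans (eliminateᵗ (⟦⟧-one (concatMap θ₆₀ xs)) (q^-+ 2 2) xt xv αδ)
      (⊕-cong ≈-refl (⊛-congˡ _ (≈-sym (⟦±⟧-++ βs vs))))))

  -- The two generating functions differ by exactly q², which is why n = 2 is the only exception.
  part₃ : partitions (pmMod 60 T₃) ≈ partitions (pmMod 60 S₃) ⊕ q^ 2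
  part₃ = partitions-difference S₃ T₃ (1 ∷ 10 ∷ 11 ∷ 13 ∷ 15 ∷ 23 ∷ 24 ∷ []) (αs ++ vs) (γs ++ ts) us refl refl refl refl refl 2
    (≈-trans (⟦±⟧-++ αs vs) (≈-trans (eliminateᵘ (⟦⟧-one (concatMap θ₆₀ xs)) (q^-+ 2 2) xt xv αδ)
      (⊕-cong (≈-sym (⟦±⟧-++ γs ts)) ≈-refl)))

theorem12p6 : ((n : ℕ) → 1 ≤ n →
    p (pmMod 60 (1 ∷ 8 ∷ 10 ∷ 11 ∷ 12 ∷ 13 ∷ 14 ∷ 15 ∷ 17 ∷ 19 ∷ 21 ∷ 23 ∷ [])) n
    ≡ p (pmMod 60 (1 ∷ 7 ∷ 9 ∷ 10 ∷ 11 ∷ 12 ∷ 13 ∷ 15 ∷ 23 ∷ 26 ∷ 28 ∷ 29 ∷ [])) (n ∸ 1))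
    × ((n : ℕ) → 2 ≤ n →
    p (pmMod 60 (2 ∷ 3 ∷ 7 ∷ 10 ∷ 11 ∷ 15 ∷ 16 ∷ 17 ∷ 19 ∷ 23 ∷ 24 ∷ 29 ∷ [])) n
    ≡ p (pmMod 60 (1 ∷ 4 ∷ 7 ∷ 10 ∷ 13 ∷ 15 ∷ 17 ∷ 19 ∷ 22 ∷ 24 ∷ 27 ∷ 29 ∷ [])) (n ∸ 2))
    × ((n : ℕ) → n ≢ 2 →
    p (pmMod 60 (1 ∷ 3 ∷ 4 ∷ 10 ∷ 11 ∷ 13 ∷ 15 ∷ 17 ∷ 22 ∷ 23 ∷ 24 ∷ 29 ∷ [])) n
    ≡ p (pmMod 60 (1 ∷ 2 ∷ 7 ∷ 10 ∷ 11 ∷ 13 ∷ 15 ∷ 16 ∷ 19 ∷ 23 ∷ 24 ∷ 27 ∷ [])) n)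
    × ((n : ℕ) → 7 ≤ n →
    p (pmMod 60 (7 ∷ 8 ∷ 9 ∷ 10 ∷ 11 ∷ 12 ∷ 13 ∷ 14 ∷ 15 ∷ 17 ∷ 19 ∷ 29 ∷ [])) n
    ≡ p (pmMod 60 (1 ∷ 7 ∷ 10 ∷ 12 ∷ 15 ∷ 17 ∷ 19 ∷ 21 ∷ 23 ∷ 26 ∷ 28 ∷ 29 ∷ [])) (n ∸ 7))
theorem12p6 =
  (λ n 1≤n → shifted-coeff 1 n (s≤s z≤n) 1≤n PartsOneFour.part₁) ,
  (λ n 2≤n → shifted-coeff 2 n (s≤s z≤n) 2≤n PartsTwoThree.part₂) ,
  (λ n n≢2 → difference-coeff 2 n n≢2 PartsTwoThree.part₃) ,
  (λ n 7≤n → shifted-coeff 7 n (s≤s z≤n) 7≤n PartsOneFour.part₄)
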